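{- Let $m,n$ be positive integers and let $\mathcal{A}\subseteq \mathcal{A}_m^n$ be a strongly transitive arrangement. Then the map $\overline{\Phi}_\mathcal{A}$ is a bijection from the set $\overline{\mathcal{T}}_m^n(\mathcal{A})$ of marked trees to the set of faces of $\mathcal{A}$. Moreover, for every $(T,\mu)\in\overline{\mathcal{T}}_m^n(\mathcal{A})$, the number $|\mu|$ of marked edges equals the codimension of the face $\overline{\Phi}_\mathcal{A}(T,\mu)$.
   Context: Notation: $\mathbb{N}=\{0,1,2,\ldots\}$; for integers $a,b$, $[a;b]=\{k\in\mathbb{Z}: a\le k\le b\}$ and $[n]=[1;n]$. For distinct $i,j\in[n]$ and $s\in\mathbb{Z}$, $\{x_i-x_j=s\}$ denotes the hyperplane $\{(x_1,\dots,x_n)\in\mathbb{R}^n : x_i-x_j=s\}$ (so $\{x_i-x_j=s\}=\{x_j-x_i=-s\}$). A braid-type arrangement in $\mathbb{R}^n$ is a finite set of such hyperplanes. The $m$-Catalan arrangement $\mathcal{A}_m^n$ is the set of all hyperplanes $\{x_i-x_j=s\}$ with $1\le i<j\le n$ and $s\in[-m;m]$. Let $\mathrm{Tr}_m^n$ be the set of triples $(i,j,s)$ with $i,j\in[n]$, $i\neq j$, $s\in[0;m]$ and ($s>0$ or $i>j$); every hyperplane of $\mathcal{A}_m^n$ equals $\{x_i-x_j=s\}$ for exactly one triple in $\mathrm{Tr}_m^n$. For $\mathcal{A}\subseteq\mathcal{A}_m^n$, $\mathrm{Tr}_m^n(\mathcal{A})$ is the set of triples $(i,j,s)\in \mathrm{Tr}_m^n$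 with $\{x_i-x_j=s\}\in\mathcal{A}$. A braid-type arrangement $\mathcal{A}$ in $\mathbb{R}^n$ is strongly transitive if for all distinct $i,j,k\in[n]$ and all integers $s,t\ge 0$: if $\{x_i-x_j=s\}\notin\mathcal{A}$ and $\{x_j-x_k=t\}\notin\mathcal{A}$, then $\{x_i-x_k=s+t\}\notin\mathcal{A}$. A face of a hyperplane arrangement is a nonempty set obtained by choosing, for each hyperplane $\{f=c\}$ of the arrangement, one of the conditions $f<c$, $f=c$, $f>c$, and intersecting the resulting sets; its codimension is $n$ minus the dimension of its affine span. An $(m,n)$-tree is a rooted plane tree in which every internal vertex (called a node) has exactly $m+1$ ordered children, called its $0$-child, $1$-child, ..., $m$-child, each child being a node or a leaf, with exactly $n$ nodes labeled bijectively by $[n]$ (leaves are unlabeled); nodes are identified with their labels. A node $i$ is the $s$-cadet of node $j$ if $i$ is the $s$-child of $j$ and the $t$-child of $j$ is a leaf for every $t\in[s+1;m]$; then $\{i,j\}$ is called a cadet edge. For a vertex $v$ (node or leaf) with root-to-$v$ path $v_0,v_1,\dots,v_k=v$, let $\mathrm{path}_T(v)=(s_1,\dots,s_k)$ where $v_i$ is the $s_i$-child of $v_{i-1}$, and $\mathrm{drift}_T(v)=\sum_{i=1}^k s_i$. The total order $\prec_T$ on all vertices of $T$ is: for distinct $v,w$ with $\mathrm{path}_T(v)=(s_1,\dots,s_k)$, $\mathrm{path}_T(w)=(t_1,\dots,t_\ell)$, $v\prec_T w$ iff $\mathrm{drift}_T(v)<\mathrm{drift}_T(w)$, or $\mathrm{drift}_T(v)=\mathrm{drift}_T(w)$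 and there is $j\le k$ with $(s_1,\dots,s_j)=(t_1,\dots,t_j)$ and ($j=k$ or $s_{j+1}>t_{j+1}$). Write $\preceq_T,\succeq_T$ for the associated non-strict relations. A marked $(m,n)$-tree is a pair $(T,\mu)$ where $T$ is an $(m,n)$-tree and $\mu$ is a set of cadet edges of $T$ such that whenever $\{j,i\}\in\mu$ with $i$ the $0$-cadet of $j$, we have $j<i$; edges in $\mu$ are called marked. $\overline{\mathcal{T}}_m^n$ denotes the set of marked $(m,n)$-trees. For nodes $i,j$ write $i\overset{\mu}{\sim}j$ if $i=j$ or all edges of the path of $T$ between $i$ and $j$ are in $\mu$; the equivalence classes are the blocks of $(T,\mu)$. For $\mathcal{A}\subseteq\mathcal{A}_m^n$: a block $B$ of $(T,\mu)$ is $\mathcal{A}$-connected if the graph with vertex set $B$ and edges $\{i,j\}$ ($i\ne j\in B$) such that $\{x_i-x_j=\mathrm{drift}_T(i)-\mathrm{drift}_T(j)\}\in\mathcal{A}$ is connected; $(T,\mu)$ is $\mathcal{A}$-connected if all its blocks are. $(T,\mu)$ satisfies the $\mathcal{A}$-cadet condition if every cadet edge $\{i,j\}\notin\mu$, with $i$ the $s$-cadet of $j$, satisfies ($s=0$ and $i<j$) or (there exist $i'\overset{\mu}{\sim}i$ and $j'\overset{\mu}{\sim}j$ with $\{x_{i'}-x_{j'}=\mathrm{drift}_T(i')-\mathrm{drift}_T(j')\}\in\mathcal{A}$). $\overline{\mathcal{T}}_m^n(\mathcal{A})$ is the set of marked trees in $\overline{\mathcal{T}}_m^n$ that are $\mathcal{A}$-connected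 and satisfy the $\mathcal{A}$-cadet condition. For $(T,\mu)\in\overline{\mathcal{T}}_m^n(\mathcal{A})$, $\overline{\Phi}_\mathcal{A}(T,\mu)=\Big(\bigcap_{\{i,j\}\in\mu,\ i=s\text{ -child of }j}\{x_i-x_j=s\}\Big)\cap\Big(\bigcap_{(i,j,s)\in\mathrm{Tr}_m^n(\mathcal{A}),\ i\not\overset{\mu}{\sim}j,\ i\prec_T v_{j,s}}\{x_i-x_j<s\}\Big)\cap\Big(\bigcap_{(i,j,s)\in\mathrm{Tr}_m^n(\mathcal{A}),\ i\not\overset{\mu}{\sim}j,\ i\succeq_T v_{j,s}}\{x_i-x_j>s\}\Big)$, where $v_{j,s}$ denotes the $s$-child of $j$ (a node or a leaf).
   Formalization: The hyperplanes, faces, the sets given by the map and their codimensions are taken in rational n-space instead of real n-space; everything else is as stated. -}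

module Defs where

open import Level using (Level; 0ℓ) renaming (suc to lsuc)
open import Data.Bool using (Bool; true; false)
open import Data.Nat as ℕ using (ℕ; zero; suc; _+_; _≤_; _<_)
open import Data.Fin as Fin using (Fin; toℕ)
open import Data.Fin.Subset using (Subset; _∈_; _∉_)
open import Data.Vec as Vec using (Vec)
open import Data.List as List using (List; []; _∷_; _++_; [_]; allFin)
open import Data.List.Relation.Binary.Permutation.Propositional using (_↭_)
open import Data.Integer as ℤ using (ℤ; +_)
open import Data.Rational as ℚ using (ℚ)
open import Data.Maybe using (Maybe; just; nothing)
open import Data.Product using (Σ; ∃; ∃₂; _×_; _,_)
open import Data.Sum using (_⊎_)
open import Data.Empty using (⊥)
open import Data.Unit using (⊤)
open import Relation.Nullary using (¬_)
open import Relation.Binary.PropositionalEquality using (_≡_; _≢_)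
open import Relation.Binary.Construct.Closure.ReflexiveTransitive using (Star)
open import Data.Nat.ListAction using (sum)

Point : ℕ → Set
Point n = Fin n → ℚ

ℕtoℚ : ℕ → ℚ
ℕtoℚ s = (+ s) ℚ./ 1

sumℚ : (k : ℕ) → (Fin k → ℚ) → ℚ
sumℚ zero    f = ℚ.0ℚ
sumℚ (suc k) f = f Fin.zero ℚ.+ sumℚ k (λ i → f (Fin.suc i))

LinIndep : {n : ℕ} (k : ℕ) → (Fin k → Point n) → Set
LinIndep {n} k v =
  (c : Fin k → ℚ) → (∀ r → sumℚ k (λ i → c i ℚ.* v i r) ≡ ℚ.0ℚ) → ∀ i → c i ≡ ℚ.0ℚ

AffIndep : {n : ℕ} (k : ℕ) → (Fin (suc k) → Point n) → Set
AffIndep {n} k p = LinIndep k (λ i r → p (Fin.suc i) r ℚ.- p Fin.zero r)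

AffDim : {n : ℕ} → (Point n → Set) → ℕ → Set
AffDim {n} S d =
  (Σ (Fin (suc d) → Point n) λ p → (∀ i → S (p i)) × AffIndep d p)
  × ((p : Fin (suc (suc d)) → Point n) → (∀ i → S (p i)) → ¬ AffIndep (suc d) p)

Codim : {n : ℕ} → (Point n → Set) → ℕ → Set
Codim {n} S c = Σ ℕ λ d → AffDim S d × (c + d ≡ n)

_≐_ : {n : ℕ} → (Point n → Set) → (Point n → Set) → Set
_≐_ {n} F G = ∀ (x : Point n) → (F x → G x) × (G x → F x)

-- mem i j s = true  iff  {x_i - x_j = s} ∈ A
record Arr (m n : ℕ) : Set where
  field
    mem    : Fin n → Fin n → ℤ → Bool
    mem-sym    : ∀ i j s → mem i j s ≡ mem j i (ℤ.- s)
    mem-irrefl : ∀ i s → mem i i s ≡ false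
    mem-bound  : ∀ i j s → mem i j s ≡ true → ℤ.∣ s ∣ ≤ m

module _ {m n : ℕ} (A : Arr m n) where
  open Arr A

  InA : Fin n → Fin n → ℤ → Set
  InA i j s = mem i j s ≡ true

  StronglyTransitive : Set
  StronglyTransitive =
    ∀ (i j k : Fin n) → i ≢ j → j ≢ k → i ≢ k → ∀ (s t : ℕ) →
    ¬ InA i j (+ s) → ¬ InA j k (+ t) → ¬ InA i k (+ (s + t))

  InTr : Fin n → Fin n → ℕ → Set
  InTr i j s = i ≢ j × s ≤ m × (0 < s ⊎ j Fin.< i) × InA i j (+ s)

data Sign : Set where
  lt eq gt : Sign

holds : Sign → ℚ → ℚ → Set
holds lt a b = a ℚ.< b
holds eq a b = a ≡ b
holds gt a b = a ℚ.> b

module _ {m n : ℕ} (A : Arr m n) where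

  -- the set obtained by choosing, for each hyperplane {x_i - x_j = s}
  -- of A (indexed by its triple in Tr_m^n(A)), the condition σ i j s
  FaceSet : (Fin n → Fin n → ℕ → Sign) → Point n → Set
  FaceSet σ x = ∀ i j s → InTr A i j s → holds (σ i j s) (x i ℚ.- x j) (ℕtoℚ s)

  IsFace : (Point n → Set) → Set
  IsFace F = Σ (Fin n → Fin n → ℕ → Sign) λ σ → (F ≐ FaceSet σ) × Σ (Point n) F

data Tree (m n : ℕ) : Set where
  leaf : Tree m n
  node : Fin n → Vec (Tree m n) (suc m) → Tree m n

-- a vertex is addressed by its path from the root: (s_1,...,s_k)
Path : Set
Path = List ℕ

drift : Path → ℕ
drift p = sum p

module _ {m n : ℕ} where
  labels  : Tree m n → List (Fin n)
  labelsV : {k : ℕ} → Vec (Tree m n) k → List (Fin n)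
  labels leaf        = []
  labels (node i cs) = i ∷ labelsV cs
  labelsV Vec.[]       = []
  labelsV (c Vec.∷ cs) = labels c ++ labelsV cs

  at  : Tree m n → Path → Maybe (Tree m n)
  atV : {k : ℕ} → Vec (Tree m n) k → ℕ → Path → Maybe (Tree m n)
  at t []                 = just t
  at leaf (_ ∷ _)         = nothing
  at (node i cs) (s ∷ p)  = atV cs s p
  atV Vec.[] _ _                = nothing
  atV (c Vec.∷ cs) zero p       = at c p
  atV (c Vec.∷ cs) (suc s) p    = atV cs s p

  ValidTree : Tree m n → Set
  ValidTree T = labels T ↭ allFin n

  NodeAt : Tree m n → Path → Fin n → Set
  NodeAt T p i = Σ (Vec (Tree m n) (suc m)) λ cs → at T p ≡ just (node i cs)

  LeafAt : Tree m n → Path → Set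
  LeafAt T p = at T p ≡ just leaf

  ChildOf : Tree m n → Fin n → ℕ → Fin n → Set
  ChildOf T i s j = Σ Path λ q → NodeAt T q j × NodeAt T (q ++ [ s ]) i

  CadetOf : Tree m n → Fin n → ℕ → Fin n → Set
  CadetOf T i s j = ChildOf T i s j ×
    (∀ t → s < t → t ≤ m → ∀ q → NodeAt T q j → LeafAt T (q ++ [ t ]))

prefLex : Path → Path → Set
prefLex []      []      = ⊥
prefLex []      (_ ∷ _) = ⊤
prefLex (_ ∷ _) []      = ⊥
prefLex (a ∷ p) (b ∷ q) = (b < a) ⊎ ((a ≡ b) × prefLex p q)

_≺_ : Path → Path → Set
p ≺ q = (drift p < drift q) ⊎ ((drift p ≡ drift q) × prefLex p q)

_⪰_ : Path → Path → Set
p ⪰ q = (q ≺ p) ⊎ (p ≡ q)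

IsPrefix : Path → Path → Set
IsPrefix r p = Σ Path λ u → r ++ u ≡ p

-- marked trees.  A set μ of edges is encoded as a subset of the node
-- labels:  i ∈ μ  means the edge between i and its parent is marked.

module _ {m n : ℕ} where

  MarkedOK : Tree m n → Subset n → Set
  MarkedOK T μ = ∀ i → i ∈ μ →
    Σ ℕ λ s → Σ (Fin n) λ j → CadetOf T i s j × (s ≡ 0 → j Fin.< i)

  -- i ~μ j : every edge on the tree path between i and j is marked.
  -- The edges of that path are the parent edges of the nodes whose path
  -- is a prefix of exactly one of path(i), path(j).
  SameBlock : Tree m n → Subset n → Fin n → Fin n → Set
  SameBlock T μ i j = ∀ p q → NodeAt T p i → NodeAt T q j →
    ∀ k r → NodeAt T r k →
    ((IsPrefix r p × ¬ IsPrefix r q) ⊎ (IsPrefix r q × ¬ IsPrefix r p)) →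
    k ∈ μ

module _ {m n : ℕ} (A : Arr m n) where

  DriftIn : Tree m n → Fin n → Fin n → Set
  DriftIn T i j = Σ Path λ p → Σ Path λ q → NodeAt T p i × NodeAt T q j ×
    InA A i j ((+ drift p) ℤ.- (+ drift q))

  AEdge : Tree m n → Subset n → Fin n → Fin n → Set
  AEdge T μ i j = SameBlock T μ i j × i ≢ j × DriftIn T i j

  AConnected : Tree m n → Subset n → Set
  AConnected T μ = ∀ i j → SameBlock T μ i j → Star (AEdge T μ) i j

  CadetCond : Tree m n → Subset n → Set
  CadetCond T μ = ∀ i s j → CadetOf T i s j → i ∉ μ →
    ((s ≡ 0) × (i Fin.< j)) ⊎
    (Σ (Fin n) λ i' → Σ (Fin n) λ j' →
       SameBlock T μ i' i × SameBlock T μ j' j × DriftIn T i' j')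

  MTree : Tree m n → Subset n → Set
  MTree T μ = ValidTree T × MarkedOK T μ × AConnected T μ × CadetCond T μ

  Φ : Tree m n → Subset n → Point n → Set
  Φ T μ x =
    (∀ i s j → i ∈ μ → ChildOf T i s j → x i ℚ.- x j ≡ ℕtoℚ s) ×
    (∀ i j s → InTr A i j s → ¬ SameBlock T μ i j →
       ∀ p q → NodeAt T p i → NodeAt T q j →
       ((p ≺ (q ++ [ s ])) → x i ℚ.- x j ℚ.< ℕtoℚ s) ×
       ((p ⪰ (q ++ [ s ])) → x i ℚ.- x j ℚ.> ℕtoℚ s))

{-# OPTIONS --safe #-}

-- Up to the order on its vertices, a tree is the same thing as a generic point: the s-child
-- of j sits just above the value x_j + s, and the order ≺ on paths is the order of these
-- values.  Conversely a marked tree has a point x_i = drift(i) + ε · rank(block of i), where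
-- the blocks are ranked by the order of the paths of their top nodes; perturbing the ranks
-- of single blocks gives the dimension of the face.
--
-- Both the connectedness and the cadet condition say the same about a cadet edge from k down
-- to h (strong transitivity is needed to recover connectedness): either it is unmarked,
-- h is the 0-cadet of k and h < k, or some hyperplane of A crosses it, joining the part of
-- the block of h below the edge to the part of the block of k above it.
--
-- Surjectivity: take a point of the face and its tree.  If a cadet edge violates this
-- condition, lowering the part of the block below the edge stays in the face and decreases
-- the number of triples of Tr with x_i - x_j ≥ s, so this terminates.
--
-- Injectivity: let p be the ≺-least path at which two trees of the same face differ, and let
-- i be the node at p in one of them.  Climbing from i in the other tree, as long as the
-- current path is above p, strong transitivity forces each step to be a 0-cadet edge with
-- increasing labels; so the climb ends at p, at a node with a label larger than i.
-- By symmetry this is absurd.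
module Submission where

open import Defs
open import Data.Bool using (true; false)
import Data.Bool.Properties as Bool
open import Data.Nat as ℕ using (ℕ; zero; suc; _+_; _*_; _∸_; _≤_; _<_; z≤n; s≤s)
import Data.Nat.Properties as ℕ
open import Data.Nat.Induction using (<-wellFounded)
open import Data.Nat.ListAction.Properties using (sum-++)
open import Data.Integer as ℤ using (ℤ; +_; -[1+_])
import Data.Integer.Properties as ℤ
import Data.Integer.Tactic.RingSolver as ℤSolver
open import Data.Rational as ℚ using (ℚ)
import Data.Rational.Properties as ℚ
import Data.Rational.Unnormalised as ℚᵘ
import Data.Rational.Unnormalised.Properties as ℚᵘ
import Data.Rational.Solver as ℚSolver
open import Data.Fin as Fin using (Fin; toℕ)
import Data.Fin.Properties as Fin
open import Data.Fin.Subset using (Subset; _∈_; _∉_; ∣_∣; ∁)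
import Data.Fin.Subset.Properties as Subset
open import Data.Vec as Vec using (Vec; []; _∷_)
import Data.Vec.Properties as Vec
open import Data.List as List using (List; []; _∷_; _++_; [_]; allFin; length; cartesianProduct)
import Data.List.Properties as List
import Data.List.Membership.Propositional as Mem
import Data.List.Membership.Propositional.Properties as Mem
open import Data.List.Relation.Unary.Any using (here; there)
open import Data.List.Relation.Unary.All as All using ([]; _∷_)
open import Data.Maybe using (just)
open import Data.Product using (Σ; _×_; _,_; proj₁; proj₂)
open import Data.Sum using (_⊎_; inj₁; inj₂; [_,_]′)
open import Data.Empty using (⊥; ⊥-elim)
open import Data.Unit using (tt)
open import Function using (_∘_; id; mk⇔)
open import Induction.WellFounded using (Acc; acc)
open import Relation.Nullary using (¬_; Dec; yes; no; does)
open import Relation.Nullary.Decidable using (_×-dec_; _⊎-dec_; ¬?; map′)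
open import Relation.Binary.Definitions using (Tri; tri<; tri≈; tri>)
open import Relation.Binary.PropositionalEquality hiding ([_])
open import Relation.Binary.Construct.Closure.ReflexiveTransitive using (Star; ε; _◅_; _◅◅_)
open import Data.List.Relation.Unary.AllPairs using ([]; _∷_)
open import Data.List.Relation.Unary.Unique.Propositional using (Unique)
import Data.List.Relation.Unary.Unique.Propositional.Properties as Unique
import Data.List.Relation.Unary.All.Properties as All
open import Data.List.Relation.Binary.Permutation.Propositional using (_↭_; ↭-sym; ↭⇒↭ₛ)
import Data.List.Relation.Binary.Permutation.Propositional.Properties as Perm
import Data.List.Relation.Binary.Permutation.Setoid.Properties as PermS
open import Data.List.Relation.Binary.BagAndSetEquality using (∼bag⇒↭)
open import Data.List.Membership.Propositional.Properties.WithK using (unique∧set⇒bag)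

-- Integer gaps between the coordinates of a point

-- A face of `A` is a union of faces of the full Catalan arrangement, each with its own marked tree;
-- exactly one of these trees passes both conditions. Hence two levels: `Compatible` places a point
-- in the Catalan face of a tree, `InΦ` only in the face of `A`, and `SameFace` compares points by
-- the hyperplanes of `A` alone. Both halves of the bijection compare points of one face whose trees
-- may differ. The obstacle is that the equation of a marked edge need not be a hyperplane of `A`.
-- Connectedness makes it a consequence of such hyperplanes, and so valid at every point of the
-- face. Ties between values are broken by letters and then by labels, both in the order on vertices
-- and in the marking rule for 0-cadets; this is why equalities of coordinates do not disturb the
-- tree.

ι : ℤ → ℚ
ι z = z ℚ./ 1

private
  toℚᵘ-ι : ∀ z → ℚ.toℚᵘ (ι z) ℚᵘ.≃ ℚᵘ.mkℚᵘ z 0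
  toℚᵘ-ι z = ℚ.toℚᵘ-fromℚᵘ (ℚᵘ.mkℚᵘ z 0)

  over-one : ∀ a b → (a ℤ.+ b) ℤ.* (+ 1) ≡ (a ℤ.* + 1 ℤ.+ b ℤ.* + 1) ℤ.* (+ 1)
  over-one = ℤSolver.solve-∀

ι-+ : ∀ a b → ι (a ℤ.+ b) ≡ ι a ℚ.+ ι b
ι-+ a b = ℚ.toℚᵘ-injective (begin
    ℚ.toℚᵘ (ι (a ℤ.+ b))                    ≈⟨ toℚᵘ-ι (a ℤ.+ b) ⟩
    ℚᵘ.mkℚᵘ (a ℤ.+ b) 0                     ≈⟨ ℚᵘ.*≡* (over-one a b) ⟩
    ℚᵘ.mkℚᵘ a 0 ℚᵘ.+ ℚᵘ.mkℚᵘ b 0            ≈⟨ ℚᵘ.+-cong (toℚᵘ-ι a) (toℚᵘ-ι b) ⟨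
    ℚ.toℚᵘ (ι a) ℚᵘ.+ ℚ.toℚᵘ (ι b)          ≈⟨ ℚ.toℚᵘ-homo-+ (ι a) (ι b) ⟨
    ℚ.toℚᵘ (ι a ℚ.+ ι b)                    ∎)
  where open import Relation.Binary.Reasoning.Setoid ℚᵘ.≃-setoid

ι-* : ∀ a b → ι (a ℤ.* b) ≡ ι a ℚ.* ι b
ι-* a b = ℚ.toℚᵘ-injective (begin
    ℚ.toℚᵘ (ι (a ℤ.* b))                    ≈⟨ toℚᵘ-ι (a ℤ.* b) ⟩
    ℚᵘ.mkℚᵘ a 0 ℚᵘ.* ℚᵘ.mkℚᵘ b 0            ≈⟨ ℚᵘ.*-cong (toℚᵘ-ι a) (toℚᵘ-ι b) ⟨
    ℚ.toℚᵘ (ι a) ℚᵘ.* ℚ.toℚᵘ (ι b)          ≈⟨ ℚ.toℚᵘ-homo-* (ι a) (ι b) ⟨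
    ℚ.toℚᵘ (ι a ℚ.* ι b)                    ∎)
  where open import Relation.Binary.Reasoning.Setoid ℚᵘ.≃-setoid

ι-neg : ∀ a → ι (ℤ.- a) ≡ ℚ.- ι a
ι-neg a = sym (ℚ.≤-antisym (ℚ.≤-reflexive h) (ℚ.≤-reflexive (sym h)))
  where
  open ≡-Reasoning
  s : ι a ℚ.+ ι (ℤ.- a) ≡ ℚ.0ℚ
  s = trans (sym (ι-+ a (ℤ.- a))) (cong ι (ℤ.+-inverseʳ a))
  h : ℚ.- ι a ≡ ι (ℤ.- a)
  h = begin
    ℚ.- ι a                                ≡⟨ ℚ.+-identityʳ _ ⟨
    ℚ.- ι a ℚ.+ ℚ.0ℚ                       ≡⟨ cong (ℚ.- ι a ℚ.+_) s ⟨
    ℚ.- ι a ℚ.+ (ι a ℚ.+ ι (ℤ.- a))        ≡⟨ ℚ.+-assoc (ℚ.- ι a) (ι a) _ ⟨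
    (ℚ.- ι a ℚ.+ ι a) ℚ.+ ι (ℤ.- a)        ≡⟨ cong (ℚ._+ ι (ℤ.- a)) (ℚ.+-inverseˡ (ι a)) ⟩
    ℚ.0ℚ ℚ.+ ι (ℤ.- a)                     ≡⟨ ℚ.+-identityˡ _ ⟩
    ι (ℤ.- a)                              ∎

ι-mono-< : ∀ {a b} → a ℤ.< b → ι a ℚ.< ι b
ι-mono-< {a} {b} a<b = ℚ.toℚᵘ-cancel-<
  (ℚᵘ.<-respˡ-≃ (ℚᵘ.≃-sym (toℚᵘ-ι a)) (ℚᵘ.<-respʳ-≃ (ℚᵘ.≃-sym (toℚᵘ-ι b))
    (ℚᵘ.*<* (subst₂ ℤ._<_ (sym (ℤ.*-identityʳ a)) (sym (ℤ.*-identityʳ b)) a<b))))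

-- Integer gaps of both signs allow `x i - x j > s` to be written `GapLt x j i (- s)`, so one strict
-- relation serves both sides of a hyperplane. As a record it lets unification recover `i`, `j` and
-- `d`, which a bare rational inequality would not. `ι (+ s)` is `ℕtoℚ s` by definition.
record GapLt {n : ℕ} (x : Point n) (i j : Fin n) (d : ℤ) : Set where
  constructor ⟪_⟫
  field gap< : x i ℚ.- x j ℚ.< ι d
open GapLt public

record GapEq {n : ℕ} (x : Point n) (i j : Fin n) (d : ℤ) : Set where
  constructor ⟪_⟫
  field gap≡ : x i ℚ.- x j ≡ ι d
open GapEq public

GapLe : {n : ℕ} → Point n → Fin n → Fin n → ℤ → Set
GapLe x i j d = GapLt x i j d ⊎ GapEq x i j d

private
  split-gap : ∀ (a b c : ℚ) → a ℚ.- c ≡ (a ℚ.- b) ℚ.+ (b ℚ.- c)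
  split-gap = solve 3 (λ a b c → a :- c := (a :- b) :+ (b :- c)) refl
    where open ℚSolver.+-*-Solver
  swap-gap : ∀ (a b : ℚ) → a ℚ.- b ≡ ℚ.- (b ℚ.- a)
  swap-gap = solve 2 (λ a b → a :- b := :- (b :- a)) refl
    where open ℚSolver.+-*-Solver

module _ {n : ℕ} {x : Point n} where

  -- The sum of the gaps enters through an equation, so that each use can choose the form of the
  -- bound and settle the integer arithmetic separately.
  lt-lt : ∀ {i j k d e f} → GapLt x i j d → GapLt x j k e → d ℤ.+ e ≡ f → GapLt x i k f
  lt-lt {i} {j} {k} {d} {e} ⟪ p ⟫ ⟪ q ⟫ refl =
    ⟪ subst₂ ℚ._<_ (sym (split-gap (x i) (x j) (x k))) (sym (ι-+ d e)) (ℚ.+-mono-< p q) ⟫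

  lt-eq : ∀ {i j k d e f} → GapLt x i j d → GapEq x j k e → d ℤ.+ e ≡ f → GapLt x i k f
  lt-eq {i} {j} {k} {d} {e} ⟪ p ⟫ ⟪ q ⟫ refl =
    ⟪ subst₂ ℚ._<_ (sym (split-gap (x i) (x j) (x k))) (sym (ι-+ d e)) (ℚ.+-mono-<-≤ p (ℚ.≤-reflexive q)) ⟫

  eq-lt : ∀ {i j k d e f} → GapEq x i j d → GapLt x j k e → d ℤ.+ e ≡ f → GapLt x i k f
  eq-lt {i} {j} {k} {d} {e} ⟪ p ⟫ ⟪ q ⟫ refl =
    ⟪ subst₂ ℚ._<_ (sym (split-gap (x i) (x j) (x k))) (sym (ι-+ d e)) (ℚ.+-mono-≤-< (ℚ.≤-reflexive p) q) ⟫

  eq-eq : ∀ {i j k d e f} → GapEq x i j d → GapEq x j k e → d ℤ.+ e ≡ f → GapEq x i k f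
  eq-eq {i} {j} {k} {d} {e} ⟪ p ⟫ ⟪ q ⟫ refl =
    ⟪ trans (split-gap (x i) (x j) (x k)) (trans (cong₂ ℚ._+_ p q) (sym (ι-+ d e))) ⟫

  lt-le : ∀ {i j k d e f} → GapLt x i j d → GapLe x j k e → d ℤ.+ e ≡ f → GapLt x i k f
  lt-le p (inj₁ q) = lt-lt p q
  lt-le p (inj₂ q) = lt-eq p q

  le-lt : ∀ {i j k d e f} → GapLe x i j d → GapLt x j k e → d ℤ.+ e ≡ f → GapLt x i k f
  le-lt (inj₁ p) q = lt-lt p q
  le-lt (inj₂ p) q = eq-lt p q

  le-le : ∀ {i j k d e f} → GapLe x i j d → GapLe x j k e → d ℤ.+ e ≡ f → GapLe x i k f
  le-le p (inj₁ q) r = inj₁ (le-lt p q r)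
  le-le (inj₁ p) (inj₂ q) r = inj₁ (lt-eq p q r)
  le-le (inj₂ p) (inj₂ q) r = inj₂ (eq-eq p q r)

  eq-swap : ∀ {i j d} → GapEq x i j d → GapEq x j i (ℤ.- d)
  eq-swap {i} {j} {d} ⟪ p ⟫ = ⟪ trans (swap-gap (x j) (x i)) (trans (cong ℚ.-_ p) (sym (ι-neg d))) ⟫

  lt-irrefl : ∀ {i j d} → GapLt x i j d → ¬ GapLe x j i (ℤ.- d)
  lt-irrefl {i} {j} {d} p q with lt-le p q (ℤ.+-inverseʳ d)
  ... | ⟪ r ⟫ = ℚ.<-irrefl refl (subst (ℚ._< ℚ.0ℚ) (ℚ.+-inverseʳ (x i)) r)

  lt⇒¬eq : ∀ {i j d} → GapLt x i j d → ¬ GapEq x i j d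
  lt⇒¬eq p q = lt-irrefl p (inj₂ (eq-swap q))

  gt⇒lt : ∀ {i j d} → x i ℚ.- x j ℚ.> ι d → GapLt x j i (ℤ.- d)
  gt⇒lt {i} {j} {d} p =
    ⟪ subst₂ ℚ._<_ (sym (swap-gap (x j) (x i))) (sym (ι-neg d)) (ℚ.neg-antimono-< p) ⟫

  lt⇒gt : ∀ {i j d} → GapLt x j i (ℤ.- d) → x i ℚ.- x j ℚ.> ι d
  lt⇒gt {i} {j} {d} ⟪ p ⟫ = subst₂ ℚ._<_
    (trans (cong ℚ.-_ (ι-neg d)) (neg-neg (ι d)))
    (sym (swap-gap (x i) (x j))) (ℚ.neg-antimono-< p)
    where
    open ℚSolver.+-*-Solver
    neg-neg : ∀ a → ℚ.- (ℚ.- a) ≡ a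
    neg-neg = solve 1 (λ a → :- (:- a) := a) refl

  lt-weaken : ∀ {i j d e} → GapLe x i j d → d ℤ.< e → GapLt x i j e
  lt-weaken (inj₁ ⟪ p ⟫) q = ⟪ ℚ.<-trans p (ι-mono-< q) ⟫
  lt-weaken (inj₂ ⟪ p ⟫) q = ⟪ subst (ℚ._< _) (sym p) (ι-mono-< q) ⟫

  eq-refl : ∀ {i} → GapEq x i i (+ 0)
  eq-refl {i} = ⟪ ℚ.+-inverseʳ (x i) ⟫

data Trichotomy {n : ℕ} (x : Point n) (i j : Fin n) (d : ℤ) : Set where
  less    : GapLt x i j d → Trichotomy x i j d
  equal   : GapEq x i j d → Trichotomy x i j d
  greater : GapLt x j i (ℤ.- d) → Trichotomy x i j d

abstract
  gap-cmp : ∀ {n} (x : Point n) i j d → Trichotomy x i j d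
  gap-cmp x i j d with ℚ.<-cmp (x i ℚ.- x j) (ι d)
  ... | tri< p _ _ = less ⟪ p ⟫
  ... | tri≈ _ p _ = equal ⟪ p ⟫
  ... | tri> _ _ p = greater (gt⇒lt p)

abstract
  gapLt? : ∀ {n} (x : Point n) i j d → Dec (GapLt x i j d)
  gapLt? x i j d = map′ ⟪_⟫ gap< ((x i ℚ.- x j) ℚ.<? ι d)

-- Counting and minimal elements in finite lists

module _ {A : Set} where

  count : {P : A → Set} → (∀ a → Dec (P a)) → List A → ℕ
  count P? []       = 0
  count P? (a ∷ as) with P? a
  ... | yes _ = suc (count P? as)
  ... | no  _ = count P? as

  module _ {P Q : A → Set} (P? : ∀ a → Dec (P a)) (Q? : ∀ a → Dec (Q a)) (P⊆Q : ∀ a → P a → Q a) where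

    count-mono : ∀ as → count P? as ≤ count Q? as
    count-mono [] = z≤n
    count-mono (a ∷ as) with P? a | Q? a
    ... | yes p | yes q = s≤s (count-mono as)
    ... | yes p | no ¬q = ⊥-elim (¬q (P⊆Q a p))
    ... | no _  | yes q = ℕ.m≤n⇒m≤1+n (count-mono as)
    ... | no _  | no _  = count-mono as

    -- Source of the strict inequalities between ranks of blocks, between numbers of preceding
    -- nodes, and between successive values of the descent measure.
    count-mono-< : ∀ {a as} → a Mem.∈ as → Q a → ¬ P a → count P? as < count Q? as
    count-mono-< {a} {b ∷ as} (here refl) q ¬p with P? a | Q? a
    ... | yes p | _     = ⊥-elim (¬p p)
    ... | no _  | yes _ = s≤s (count-mono as)
    ... | no _  | no ¬q = ⊥-elim (¬q q)
    count-mono-< {a} {b ∷ as} (there a∈) q ¬p with P? b | Q? b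
    ... | yes p | yes _ = s≤s (count-mono-< a∈ q ¬p)
    ... | yes p | no ¬q = ⊥-elim (¬q (P⊆Q b p))
    ... | no _  | yes _ = ℕ.m≤n⇒m≤1+n (count-mono-< a∈ q ¬p)
    ... | no _  | no _  = count-mono-< a∈ q ¬p

  count≤length : {P : A → Set} (P? : ∀ a → Dec (P a)) → ∀ as → count P? as ≤ length as
  count≤length P? [] = z≤n
  count≤length P? (a ∷ as) with P? a
  ... | yes _ = s≤s (count≤length P? as)
  ... | no  _ = ℕ.m≤n⇒m≤1+n (count≤length P? as)

  module _ {_⊏_ : A → A → Set} (trans⊏ : ∀ {a b c} → a ⊏ b → b ⊏ c → a ⊏ c)
           (irrefl⊏ : ∀ {a} → ¬ (a ⊏ a)) (_⊏?_ : ∀ a b → Dec (a ⊏ b))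
           {P : A → Set} (P? : ∀ a → Dec (P a)) where

    -- Used for the least path at which two trees differ and, with the order reversed, for the
    -- parent of a node in the tree of a point.
    minimal : ∀ as → (∀ a → a Mem.∈ as → ¬ P a) ⊎
              Σ A λ a → a Mem.∈ as × P a × (∀ b → b Mem.∈ as → P b → ¬ (b ⊏ a))
    minimal [] = inj₁ λ _ ()
    minimal (a ∷ as) with minimal as | P? a
    ... | inj₁ none | no ¬p = inj₁ λ { _ (here refl) → ¬p ; b (there b∈) → none b b∈ }
    ... | inj₁ none | yes p = inj₂ (a , here refl , p , λ
          { _ (here refl) _ → irrefl⊏ ; b (there b∈) q _ → none b b∈ q })
    ... | inj₂ (b , b∈ , q , min) | no ¬p = inj₂ (b , there b∈ , q , λ
          { _ (here refl) p → ⊥-elim (¬p p) ; c (there c∈) → min c c∈ })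
    ... | inj₂ (b , b∈ , q , min) | yes p with a ⊏? b
    ...   | yes a⊏b = inj₂ (a , here refl , p , λ
            { _ (here refl) _ → irrefl⊏ ; c (there c∈) r c⊏a → min c c∈ r (trans⊏ c⊏a a⊏b) })
    ...   | no ¬a⊏b = inj₂ (b , there b∈ , q , λ
            { _ (here refl) _ → ¬a⊏b ; c (there c∈) → min c c∈ })

-- The order on paths

pl-irrefl : ∀ p → ¬ prefLex p p
pl-irrefl (a ∷ p) (inj₁ a<a) = ℕ.<-irrefl refl a<a
pl-irrefl (a ∷ p) (inj₂ (_ , h)) = pl-irrefl p h

pl-trans : ∀ p q r → prefLex p q → prefLex q r → prefLex p r
pl-trans []      (_ ∷ _) (_ ∷ _) _ _ = tt
pl-trans (a ∷ p) (b ∷ q) (c ∷ r) (inj₁ h) (inj₁ k) = inj₁ (ℕ.<-trans k h)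
pl-trans (a ∷ p) (b ∷ q) (c ∷ r) (inj₁ h) (inj₂ (refl , _)) = inj₁ h
pl-trans (a ∷ p) (b ∷ q) (c ∷ r) (inj₂ (refl , _)) (inj₁ k) = inj₁ k
pl-trans (a ∷ p) (b ∷ q) (c ∷ r) (inj₂ (refl , h)) (inj₂ (refl , k)) = inj₂ (refl , pl-trans p q r h k)

pl-cmp : ∀ p q → prefLex p q ⊎ p ≡ q ⊎ prefLex q p
pl-cmp [] [] = inj₂ (inj₁ refl)
pl-cmp [] (_ ∷ _) = inj₁ tt
pl-cmp (_ ∷ _) [] = inj₂ (inj₂ tt)
pl-cmp (a ∷ p) (b ∷ q) with ℕ.<-cmp a b | pl-cmp p q
... | tri< a<b _ _ | _ = inj₂ (inj₂ (inj₁ a<b))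
... | tri> _ _ b<a | _ = inj₁ (inj₁ b<a)
... | tri≈ _ refl _ | inj₁ h = inj₁ (inj₂ (refl , h))
... | tri≈ _ refl _ | inj₂ (inj₁ refl) = inj₂ (inj₁ refl)
... | tri≈ _ refl _ | inj₂ (inj₂ h) = inj₂ (inj₂ (inj₂ (refl , h)))

pl-asym : ∀ p q → prefLex p q → ¬ prefLex q p
pl-asym p q h k = pl-irrefl p (pl-trans p q p h k)

pl? : ∀ p q → Dec (prefLex p q)
pl? p q with pl-cmp p q
... | inj₁ h = yes h
... | inj₂ (inj₁ refl) = no (pl-irrefl p)
... | inj₂ (inj₂ h) = no (λ k → pl-asym p q k h)

pl-extendʳ : ∀ p q z → prefLex p q → prefLex p (q ++ z)
pl-extendʳ [] (_ ∷ _) z _ = tt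
pl-extendʳ (a ∷ p) (b ∷ q) z (inj₁ h) = inj₁ h
pl-extendʳ (a ∷ p) (b ∷ q) z (inj₂ (e , h)) = inj₂ (e , pl-extendʳ p q z h)

pl-++ : ∀ r {a b} → prefLex a b → prefLex (r ++ a) (r ++ b)
pl-++ [] h = h
pl-++ (_ ∷ r) h = inj₂ (refl , pl-++ r h)

pl-++⁻ : ∀ r {a b} → prefLex (r ++ a) (r ++ b) → prefLex a b
pl-++⁻ [] h = h
pl-++⁻ (c ∷ r) (inj₁ h) = ⊥-elim (ℕ.<-irrefl refl h)
pl-++⁻ (_ ∷ r) (inj₂ (_ , h)) = pl-++⁻ r h

pl-prefix : ∀ q {a u} → prefLex q (q ++ a ∷ u)
pl-prefix [] = tt
pl-prefix (_ ∷ q) = inj₂ (refl , pl-prefix q)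

-- A lengthening of `p` can matter only if the comparison was decided by `p` being a proper prefix
-- of `q`.
pl-extendˡ : ∀ p q s → prefLex p q → prefLex (p ++ [ s ]) q ⊎ Σ ℕ λ a → Σ Path λ u → q ≡ p ++ a ∷ u
pl-extendˡ [] (a ∷ u) s _ = inj₂ (a , u , refl)
pl-extendˡ (a ∷ p) (b ∷ q) s (inj₁ h) = inj₁ (inj₁ h)
pl-extendˡ (a ∷ p) (b ∷ q) s (inj₂ (refl , h)) with pl-extendˡ p q s h
... | inj₁ k = inj₁ (inj₂ (refl , k))
... | inj₂ (c , u , refl) = inj₂ (c , u , refl)

drift-++ : ∀ p q → drift (p ++ q) ≡ drift p + drift q
drift-++ = sum-++

drift-snoc : ∀ p s → drift (p ++ [ s ]) ≡ drift p + s
drift-snoc p s = trans (drift-++ p [ s ]) (cong (ℕ._+_ (drift p)) (ℕ.+-identityʳ s))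

≺-irrefl : ∀ {p} → ¬ (p ≺ p)
≺-irrefl (inj₁ h) = ℕ.<-irrefl refl h
≺-irrefl {p} (inj₂ (_ , h)) = pl-irrefl p h

≺-trans : ∀ {p q r} → p ≺ q → q ≺ r → p ≺ r
≺-trans (inj₁ h) (inj₁ k) = inj₁ (ℕ.<-trans h k)
≺-trans {p} (inj₁ h) (inj₂ (e , _)) = inj₁ (subst (drift p <_) e h)
≺-trans {r = r} (inj₂ (e , _)) (inj₁ k) = inj₁ (subst (_< drift r) (sym e) k)
≺-trans {p} {q} {r} (inj₂ (e , h)) (inj₂ (f , k)) = inj₂ (trans e f , pl-trans p q r h k)

≺-cmp : ∀ p q → p ≺ q ⊎ p ≡ q ⊎ q ≺ p
≺-cmp p q with ℕ.<-cmp (drift p) (drift q) | pl-cmp p q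
... | tri< h _ _ | _ = inj₁ (inj₁ h)
... | tri> _ _ h | _ = inj₂ (inj₂ (inj₁ h))
... | tri≈ _ e _ | inj₁ h = inj₁ (inj₂ (e , h))
... | tri≈ _ e _ | inj₂ (inj₁ h) = inj₂ (inj₁ h)
... | tri≈ _ e _ | inj₂ (inj₂ h) = inj₂ (inj₂ (inj₂ (sym e , h)))

≺-asym : ∀ {p q} → p ≺ q → ¬ (q ≺ p)
≺-asym h k = ≺-irrefl (≺-trans h k)

≺⇒¬⪰ : ∀ {p q} → p ≺ q → ¬ (p ⪰ q)
≺⇒¬⪰ h (inj₁ k) = ≺-asym h k
≺⇒¬⪰ h (inj₂ refl) = ≺-irrefl h

≺-or-⪰ : ∀ p q → p ≺ q ⊎ p ⪰ q
≺-or-⪰ p q with ≺-cmp p q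
... | inj₁ h = inj₁ h
... | inj₂ (inj₁ h) = inj₂ (inj₂ h)
... | inj₂ (inj₂ h) = inj₂ (inj₁ h)

_≺?_ : ∀ p q → Dec (p ≺ q)
p ≺? q with ≺-or-⪰ p q
... | inj₁ h = yes h
... | inj₂ h = no (λ k → ≺⇒¬⪰ k h)

≺⇒drift≤ : ∀ {p q} → p ≺ q → drift p ≤ drift q
≺⇒drift≤ (inj₁ h) = ℕ.<⇒≤ h
≺⇒drift≤ (inj₂ (e , _)) = ℕ.≤-reflexive e

⪰⇒drift≥ : ∀ {p q} → p ⪰ q → drift q ≤ drift p
⪰⇒drift≥ (inj₁ h) = ≺⇒drift≤ h
⪰⇒drift≥ (inj₂ refl) = ℕ.≤-refl

≺-snoc : ∀ q s → q ≺ (q ++ [ s ])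
≺-snoc q zero = inj₂ (sym (trans (drift-snoc q 0) (ℕ.+-identityʳ _)) , pl-prefix q)
≺-snoc q (suc s) = inj₁ (subst (drift q <_) (sym (drift-snoc q (suc s))) (ℕ.m<m+n (drift q) (s≤s z≤n)))

-- q ++ [ 0 ] is the immediate successor of q.
≺-snoc0⁻ : ∀ {p} q → p ≺ (q ++ [ 0 ]) → p ≺ q ⊎ p ≡ q
≺-snoc0⁻ {p} q (inj₁ h) = inj₁ (inj₁ (subst (drift p <_) (trans (drift-snoc q 0) (ℕ.+-identityʳ _)) h))
≺-snoc0⁻ {p} q (inj₂ (e , h)) with go p q h
  where
  go : ∀ p q → prefLex p (q ++ [ 0 ]) → prefLex p q ⊎ p ≡ q ⊎ drift q < drift p
  go [] [] h = inj₂ (inj₁ refl)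
  go [] (_ ∷ _) h = inj₁ tt
  go (suc a ∷ p) [] h = inj₂ (inj₂ (s≤s z≤n))
  go (zero ∷ p) [] (inj₁ ())
  go (zero ∷ []) [] (inj₂ (_ , ()))
  go (zero ∷ _ ∷ _) [] (inj₂ (_ , ()))
  go (a ∷ p) (b ∷ q) (inj₁ h) = inj₁ (inj₁ h)
  go (a ∷ p) (b ∷ q) (inj₂ (refl , h)) with go p q h
  ... | inj₁ k = inj₁ (inj₂ (refl , k))
  ... | inj₂ (inj₁ refl) = inj₂ (inj₁ refl)
  ... | inj₂ (inj₂ k) = inj₂ (inj₂ (ℕ.+-monoʳ-< a k))
... | inj₁ k = inj₁ (inj₂ (trans e (trans (drift-snoc q 0) (ℕ.+-identityʳ _)) , k))
... | inj₂ (inj₁ k) = inj₂ k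
... | inj₂ (inj₂ k) = ⊥-elim (ℕ.<-irrefl (sym (trans e (trans (drift-snoc q 0) (ℕ.+-identityʳ _)))) k)

-- Lowering both last letters could change the lexicographic comparison only where the last letter
-- of one path meets an inner letter of the other. At equal drift that inner letter is at most the
-- lowered last letter, so the path that ends there comes first.
≺-pred-snoc : ∀ q r s t → (q ++ [ suc s ]) ≺ (r ++ [ suc t ]) → (q ++ [ s ]) ≺ (r ++ [ t ])
≺-pred-snoc q r s t h = from h
  where
  go : ∀ q r → prefLex (q ++ [ suc s ]) (r ++ [ suc t ]) → drift q + s ≡ drift r + t →
       prefLex (q ++ [ s ]) (r ++ [ t ])
  go [] [] (inj₁ (s≤s h)) e = ⊥-elim (ℕ.<-irrefl (sym e) h)
  go [] [] (inj₂ (_ , ())) e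
  go [] (b ∷ r) h e with ℕ.m≤n⇒m<n∨m≡n
      (subst (b ≤_) (sym e) (ℕ.≤-trans (ℕ.m≤m+n b (drift r)) (ℕ.m≤m+n _ t)))
  ... | inj₁ b<s = inj₁ b<s
  ... | inj₂ refl with r
  ...   | []    = inj₂ (refl , tt)
  ...   | _ ∷ _ = inj₂ (refl , tt)
  go (a ∷ q) [] h e with subst (a ≤_) e (ℕ.≤-trans (ℕ.m≤m+n a (drift q)) (ℕ.m≤m+n _ s))
  go (a ∷ q) [] (inj₁ h) e | a≤t = ⊥-elim (ℕ.<-irrefl refl (ℕ.≤-trans h (ℕ.m≤n⇒m≤1+n a≤t)))
  go (a ∷ q) [] (inj₂ (refl , h)) e | a≤t = ⊥-elim (ℕ.<-irrefl refl a≤t)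
  go (a ∷ q) (b ∷ r) (inj₁ h) e = inj₁ h
  go (a ∷ q) (b ∷ r) (inj₂ (refl , h)) e = inj₂ (refl , go q r h (ℕ.+-cancelˡ-≡ a _ _
    (trans (sym (ℕ.+-assoc a (drift q) s)) (trans e (ℕ.+-assoc a (drift r) t)))))
  dq : drift (q ++ [ suc s ]) ≡ suc (drift (q ++ [ s ]))
  dq = trans (drift-snoc q (suc s)) (trans (ℕ.+-suc _ s) (cong suc (sym (drift-snoc q s))))
  dr : drift (r ++ [ suc t ]) ≡ suc (drift (r ++ [ t ]))
  dr = trans (drift-snoc r (suc t)) (trans (ℕ.+-suc _ t) (cong suc (sym (drift-snoc r t))))
  from : (q ++ [ suc s ]) ≺ (r ++ [ suc t ]) → (q ++ [ s ]) ≺ (r ++ [ t ])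
  from (inj₁ h) = inj₁ (ℕ.s≤s⁻¹ (subst₂ _<_ dq dr h))
  from (inj₂ (e , h)) = inj₂ (e' , go q r h (trans (sym (drift-snoc q s)) (trans e' (drift-snoc r t))))
    where
    e' : drift (q ++ [ s ]) ≡ drift (r ++ [ t ])
    e' = ℕ.suc-injective (trans (sym dq) (trans e dr))

-- Where `p` extends `q`, the drift bounds its next letter by `s`, so it lacks the larger letter
-- that would put it before `q ++ [ s ]`.
pl-child : ∀ q p s → prefLex q p → drift p ≡ drift q + s → ¬ prefLex p (q ++ [ s ])
pl-child [] (a ∷ p) s _ e (inj₁ s<a) =
  ℕ.<-irrefl refl (ℕ.<-≤-trans s<a (subst (a ≤_) e (ℕ.m≤m+n a (drift p))))
pl-child [] (a ∷ []) s _ e (inj₂ (_ , ()))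
pl-child [] (a ∷ _ ∷ _) s _ e (inj₂ (_ , ()))
pl-child (a ∷ q) (b ∷ p) s (inj₁ b<a) e (inj₁ a<b) = ℕ.<-asym a<b b<a
pl-child (a ∷ q) (b ∷ p) s (inj₁ b<a) e (inj₂ (refl , _)) = ℕ.<-irrefl refl b<a
pl-child (a ∷ q) (b ∷ p) s (inj₂ (refl , h)) e (inj₁ a<b) = ℕ.<-irrefl refl a<b
pl-child (a ∷ q) (b ∷ p) s (inj₂ (refl , h)) e (inj₂ (_ , k)) =
  pl-child q p s h (ℕ.+-cancelˡ-≡ a _ _ (trans e (ℕ.+-assoc a (drift q) s))) k

-- Last letters and prefixes of paths

snoc-injective : ∀ {p q : Path} {s t} → p ++ [ s ] ≡ q ++ [ t ] → p ≡ q × s ≡ t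
snoc-injective {p} {q} e = List.∷ʳ-injective p q e

snoc≢[] : ∀ {p : Path} {s} → p ++ [ s ] ≢ []
snoc≢[] {[]} ()
snoc≢[] {_ ∷ _} ()

snoc-view : ∀ (p : Path) → p ≡ [] ⊎ Σ Path λ q → Σ ℕ λ s → p ≡ q ++ [ s ]
snoc-view [] = inj₁ refl
snoc-view (a ∷ p) with snoc-view p
... | inj₁ refl = inj₂ ([] , a , refl)
... | inj₂ (q , s , refl) = inj₂ (a ∷ q , s , refl)

length-snoc : ∀ (p : Path) s → length (p ++ [ s ]) ≡ suc (length p)
length-snoc p s = trans (List.length-++ p) (ℕ.+-comm _ 1)

prefix-refl : ∀ {p} → IsPrefix p p
prefix-refl {p} = [] , List.++-identityʳ p

prefix-trans : ∀ {p q r} → IsPrefix p q → IsPrefix q r → IsPrefix p r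
prefix-trans {p} (u , refl) (v , refl) = u ++ v , sym (List.++-assoc p u v)

prefix-[] : ∀ {r} → IsPrefix r [] → r ≡ []
prefix-[] {[]} _ = refl
prefix-[] {_ ∷ _} (_ , ())

prefix-snoc⁻ : ∀ {r} q {s} → IsPrefix r (q ++ [ s ]) → r ≡ q ++ [ s ] ⊎ IsPrefix r q
prefix-snoc⁻ {r} q (u , e) with snoc-view u
... | inj₁ refl = inj₁ (trans (sym (List.++-identityʳ r)) e)
... | inj₂ (u' , s' , refl) =
  inj₂ (u' , proj₁ (snoc-injective {r ++ u'} {q} (trans (List.++-assoc r u' [ s' ]) e)))

prefix-snoc : ∀ q {s} → IsPrefix q (q ++ [ s ])
prefix-snoc q {s} = [ s ] , refl

prefix-antisym : ∀ {p q} → IsPrefix p q → IsPrefix q p → p ≡ q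
prefix-antisym {[]} {[]} _ _ = refl
prefix-antisym {[]} {_ ∷ _} _ (_ , ())
prefix-antisym {_ ∷ _} {[]} (_ , ()) _
prefix-antisym {a ∷ p} {b ∷ q} (u , e) (v , f) =
  cong₂ _∷_ (List.∷-injectiveˡ e) (prefix-antisym (u , List.∷-injectiveʳ e) (v , List.∷-injectiveʳ f))

prefix-linear : ∀ {r r' p} → IsPrefix r p → IsPrefix r' p → IsPrefix r r' ⊎ IsPrefix r' r
prefix-linear {[]} {r'} _ _ = inj₁ (r' , refl)
prefix-linear {_ ∷ _} {[]} _ _ = inj₂ (_ , refl)
prefix-linear {a ∷ r} {b ∷ r'} {c ∷ p} (u , e) (v , f)
  with prefix-linear {r} {r'} {p} (u , List.∷-injectiveʳ e) (v , List.∷-injectiveʳ f)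
     | trans (List.∷-injectiveˡ e) (sym (List.∷-injectiveˡ f))
... | inj₁ (w , g) | refl = inj₁ (w , cong (a ∷_) g)
... | inj₂ (w , g) | refl = inj₂ (w , cong (a ∷_) g)
prefix-linear {_ ∷ _} {_ ∷ _} {[]} (_ , ()) _

prefix? : ∀ r p → Dec (IsPrefix r p)
prefix? [] p = yes (p , refl)
prefix? (_ ∷ _) [] = no λ ()
prefix? (a ∷ r) (b ∷ p) with a ℕ.≟ b | prefix? r p
... | yes refl | yes (u , e) = yes (u , cong (a ∷_) e)
... | yes refl | no ¬h = no λ { (u , e) → ¬h (u , List.∷-injectiveʳ e) }
... | no a≢b | _ = no λ { (u , e) → a≢b (List.∷-injectiveˡ e) }

prefix-drift : ∀ {r p} → IsPrefix r p → drift r ≤ drift p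
prefix-drift {r} (u , refl) = subst (drift r ≤_) (sym (drift-++ r u)) (ℕ.m≤m+n _ _)

infix 4 _≟ᵖ_
_≟ᵖ_ : (p q : Path) → Dec (p ≡ q)
_≟ᵖ_ = List.≡-dec ℕ._≟_

-- Trees as prefix-closed systems of paths

module _ {m n : ℕ} where

  atV-lookup : ∀ {k} (cs : Vec (Tree m n) k) (f : Fin k) p → atV cs (toℕ f) p ≡ at (Vec.lookup cs f) p
  atV-lookup (c ∷ cs) Fin.zero p = refl
  atV-lookup (c ∷ cs) (Fin.suc f) p = atV-lookup cs f p

  atV-index : ∀ {k} (cs : Vec (Tree m n) k) s p {t} → atV cs s p ≡ just t → Σ (Fin k) λ f → toℕ f ≡ s
  atV-index (c ∷ cs) zero p _ = Fin.zero , refl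
  atV-index (c ∷ cs) (suc s) p e with atV-index cs s p e
  ... | f , refl = Fin.suc f , refl

  at-prefix : ∀ (T : Tree m n) r u {t} → at T (r ++ u) ≡ just t →
              Σ (Tree m n) λ T' → at T r ≡ just T' × at T' u ≡ just t
  at-prefix T [] u e = T , refl , e
  at-prefix (node i cs) (s ∷ r) u e with atV-index cs s (r ++ u) e
  ... | f , refl with at-prefix (Vec.lookup cs f) r u (trans (sym (atV-lookup cs f (r ++ u))) e)
  ...   | T' , e1 , e2 = T' , trans (atV-lookup cs f r) e1 , e2

  at-++ : ∀ (T : Tree m n) r u {T' t} → at T r ≡ just T' → at T' u ≡ just t → at T (r ++ u) ≡ just t
  at-++ T [] u refl e = e
  at-++ (node i cs) (s ∷ r) u e1 e2 with atV-index cs s r e1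
  ... | f , refl = trans (atV-lookup cs f (r ++ u))
                         (at-++ (Vec.lookup cs f) r u (trans (sym (atV-lookup cs f r)) e1) e2)

  node-above : ∀ {T : Tree m n} {i} r u → NodeAt T (r ++ u) i → Σ (Fin n) λ k → NodeAt T r k
  node-above {T} r u (cs , e) with at-prefix T r u e
  ... | node k cs' , e1 , _ = k , cs' , e1
  node-above {T} r [] (cs , e) | leaf , e1 , ()
  node-above {T} r (_ ∷ _) (cs , e) | leaf , e1 , ()

  node-index : ∀ {T : Tree m n} {i} q s → NodeAt T (q ++ [ s ]) i → s ≤ m
  node-index {T} q s (cs , e) with at-prefix T q [ s ] e
  ... | node k cs' , _ , e2 with atV-index cs' s [] e2
  ...   | f , refl = Fin.toℕ≤pred[n] f

  node-label : ∀ {T : Tree m n} {p i j} → NodeAt T p i → NodeAt T p j → i ≡ j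
  node-label (_ , e) (_ , f) with trans (sym e) f
  ... | refl = refl

  child-vertex : ∀ {T : Tree m n} {q j} t → NodeAt T q j → t ≤ m →
                 LeafAt T (q ++ [ t ]) ⊎ Σ (Fin n) λ l → NodeAt T (q ++ [ t ]) l
  child-vertex {T} {q} t (cs , e) t≤m with Fin.fromℕ< (s≤s t≤m) | Fin.toℕ-fromℕ< (s≤s t≤m)
  ... | f | refl with Vec.lookup cs f | atV-lookup cs f []
  ...   | leaf | e' = inj₁ (at-++ T q [ toℕ f ] e e')
  ...   | node l ds | e' = inj₂ (l , ds , at-++ T q [ toℕ f ] e e')

  leaf⇒¬node : ∀ {T : Tree m n} {p i} → LeafAt T p → ¬ NodeAt T p i
  leaf⇒¬node e (_ , f) with trans (sym e) f
  ... | ()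

  node⇒label : ∀ (T : Tree m n) {p i} → NodeAt T p i → i Mem.∈ labels T
  node⇒labelV : ∀ {k} (cs : Vec (Tree m n) k) f {p i} → NodeAt (Vec.lookup cs f) p i → i Mem.∈ labelsV cs
  node⇒label (node i cs) {[]} (_ , refl) = here refl
  node⇒label (node j cs) {s ∷ p} (ds , e) with atV-index cs s p e
  ... | f , refl = there (node⇒labelV cs f {p} (ds , trans (sym (atV-lookup cs f p)) e))
  node⇒labelV (c ∷ cs) Fin.zero {p} h = Mem.∈-++⁺ˡ (node⇒label c {p} h)
  node⇒labelV (c ∷ cs) (Fin.suc f) {p} h = Mem.∈-++⁺ʳ (labels c) (node⇒labelV cs f {p} h)

  node-child : ∀ {j} (cs : Vec (Tree m n) (suc m)) f {p i} → NodeAt (Vec.lookup cs f) p i →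
               NodeAt (node j cs) (toℕ f ∷ p) i
  node-child cs f {p} (ds , e) = ds , trans (atV-lookup cs f p) e

  node-child⁻ : ∀ {j} (cs : Vec (Tree m n) (suc m)) {s p i} → NodeAt (node j cs) (s ∷ p) i →
                Σ (Fin (suc m)) λ f → s ≡ toℕ f × NodeAt (Vec.lookup cs f) p i
  node-child⁻ cs {s} {p} (ds , e) with atV-index cs s p e
  ... | f , refl = f , refl , ds , trans (sym (atV-lookup cs f p)) e

  label⇒node : ∀ (T : Tree m n) {i} → i Mem.∈ labels T → Σ Path λ p → NodeAt T p i
  label⇒nodeV : ∀ {k} (cs : Vec (Tree m n) k) {i} → i Mem.∈ labelsV cs →
                Σ (Fin k) λ f → Σ Path λ p → NodeAt (Vec.lookup cs f) p i
  label⇒node (node i cs) (here refl) = [] , cs , refl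
  label⇒node (node j cs) (there h) with label⇒nodeV cs h
  ... | f , p , k = toℕ f ∷ p , node-child {j} cs f {p} k
  label⇒nodeV (c ∷ cs) h with Mem.∈-++⁻ (labels c) h
  ... | inj₁ h' with label⇒node c h'
  ...   | p , k = Fin.zero , p , k
  label⇒nodeV (c ∷ cs) h | inj₂ h' with label⇒nodeV cs h'
  ...   | f , p , k = Fin.suc f , p , k

private
  unique-++⁻ : ∀ {A : Set} (xs : List A) {ys} → Unique (xs ++ ys) →
               Unique xs × Unique ys × (∀ {a} → a Mem.∈ xs → ¬ (a Mem.∈ ys))
  unique-++⁻ [] u = [] , u , λ ()
  unique-++⁻ (x ∷ xs) (x∉ ∷ u) with unique-++⁻ xs u
  ... | u₁ , u₂ , disj = All.++⁻ˡ xs x∉ ∷ u₁ , u₂ , λ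
    { (here refl) a∈ys → All.lookup (All.++⁻ʳ xs x∉) a∈ys refl
    ; (there a∈xs) → disj a∈xs }

module _ {m n : ℕ} where

  unique⇒node-unique : (T : Tree m n) → Unique (labels T) → ∀ {i p q} → NodeAt T p i → NodeAt T q i → p ≡ q
  unique⇒node-uniqueV : ∀ {k} (cs : Vec (Tree m n) k) → Unique (labelsV cs) → ∀ {i p q} f g →
    NodeAt (Vec.lookup cs f) p i → NodeAt (Vec.lookup cs g) q i → f ≡ g × p ≡ q
  unique⇒node-unique (node j cs) u {p = []} {[]} _ _ = refl
  unique⇒node-unique (node j cs) (j∉ ∷ u) {p = []} {_ ∷ q} (_ , refl) h with node-child⁻ {j = j} cs h
  ... | g , refl , h' = ⊥-elim (All.lookup j∉ (node⇒labelV cs g {q} h') refl)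
  unique⇒node-unique (node j cs) (j∉ ∷ u) {p = _ ∷ p} {[]} h (_ , refl) with node-child⁻ {j = j} cs h
  ... | g , refl , h' = ⊥-elim (All.lookup j∉ (node⇒labelV cs g {p} h') refl)
  unique⇒node-unique (node j cs) (_ ∷ u) {p = _ ∷ p} {_ ∷ q} h k with node-child⁻ {j = j} cs h | node-child⁻ {j = j} cs k
  ... | f , refl , h' | g , refl , k' with unique⇒node-uniqueV cs u {_} {p} {q} f g h' k'
  ...   | refl , refl = refl
  unique⇒node-uniqueV (c ∷ cs) u {_} {p} {q} Fin.zero Fin.zero h k =
    refl , unique⇒node-unique c (proj₁ (unique-++⁻ (labels c) u)) {_} {p} {q} h k
  unique⇒node-uniqueV (c ∷ cs) u {_} {p} {q} Fin.zero (Fin.suc g) h k =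
    ⊥-elim (proj₂ (proj₂ (unique-++⁻ (labels c) u)) (node⇒label c {p} h) (node⇒labelV cs g {q} k))
  unique⇒node-uniqueV (c ∷ cs) u {_} {p} {q} (Fin.suc f) Fin.zero h k =
    ⊥-elim (proj₂ (proj₂ (unique-++⁻ (labels c) u)) (node⇒label c {q} k) (node⇒labelV cs f {p} h))
  unique⇒node-uniqueV (c ∷ cs) u {_} {p} {q} (Fin.suc f) (Fin.suc g) h k
    with unique⇒node-uniqueV cs (proj₁ (proj₂ (unique-++⁻ (labels c) u))) {_} {p} {q} f g h k
  ... | refl , e = refl , e

  node-unique⇒unique : (T : Tree m n) → (∀ {i} p q → NodeAt T p i → NodeAt T q i → p ≡ q) → Unique (labels T)
  node-unique⇒uniqueV : ∀ {k} (cs : Vec (Tree m n) k) →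
    (∀ {i} p q f g → NodeAt (Vec.lookup cs f) p i → NodeAt (Vec.lookup cs g) q i → f ≡ g × p ≡ q) →
    Unique (labelsV cs)
  node-unique⇒unique leaf u = []
  node-unique⇒unique (node j cs) u = All.tabulate j∉ ∷ node-unique⇒uniqueV cs v
    where
    j∉ : ∀ {i} → i Mem.∈ labelsV cs → j ≢ i
    j∉ i∈ refl with label⇒nodeV cs i∈
    ... | f , p , h with u [] (toℕ f ∷ p) (cs , refl) (node-child {j = j} cs f {p} h)
    ...   | ()
    v : ∀ {i} p q f g → NodeAt (Vec.lookup cs f) p i → NodeAt (Vec.lookup cs g) q i → f ≡ g × p ≡ q
    v p q f g h k with u (toℕ f ∷ p) (toℕ g ∷ q) (node-child {j = j} cs f {p} h) (node-child {j = j} cs g {q} k)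
    ... | e = Fin.toℕ-injective (List.∷-injectiveˡ e) , List.∷-injectiveʳ e
  node-unique⇒uniqueV [] u = []
  node-unique⇒uniqueV (c ∷ cs) u = Unique.++⁺
    (node-unique⇒unique c λ p q h k → proj₂ (u p q Fin.zero Fin.zero h k))
    (node-unique⇒uniqueV cs λ p q f g h k → let e = u p q (Fin.suc f) (Fin.suc g) h k in Fin.suc-injective (proj₁ e) , proj₂ e)
    λ { (a∈ , b∈) → disj a∈ b∈ }
    where
    disj : ∀ {a} → a Mem.∈ labels c → ¬ (a Mem.∈ labelsV cs)
    disj a∈ b∈ with label⇒node c a∈ | label⇒nodeV cs b∈
    ... | p , h | g , q , k with u p q Fin.zero (Fin.suc g) h k
    ...   | () , _

  -- Leaves need no comparison: the arity is fixed, so the nodes determine all vertices, and a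
  -- vertex that is not a node is a leaf.
  tree-ext : (T T' : Tree m n) → (∀ p {i} → NodeAt T p i → NodeAt T' p i) →
             (∀ p {i} → NodeAt T' p i → NodeAt T p i) → T ≡ T'
  vec-ext : ∀ {k} (cs ds : Vec (Tree m n) k) →
             (∀ f p {i} → NodeAt (Vec.lookup cs f) p i → NodeAt (Vec.lookup ds f) p i) →
             (∀ f p {i} → NodeAt (Vec.lookup ds f) p i → NodeAt (Vec.lookup cs f) p i) → cs ≡ ds
  tree-ext leaf leaf _ _ = refl
  tree-ext leaf (node i cs) _ from with from [] (cs , refl)
  ... | _ , ()
  tree-ext (node i cs) leaf to _ with to [] (cs , refl)
  ... | _ , ()
  tree-ext (node i cs) (node j ds) to from with to [] (cs , refl)
  ... | _ , refl = cong (node i) (vec-ext cs ds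
          (λ f p h → let (g , e , k) = node-child⁻ {j = i} ds (to (toℕ f ∷ p) (node-child {j = i} cs f {p} h))
                   in subst (λ f → NodeAt (Vec.lookup ds f) p _) (sym (Fin.toℕ-injective e)) k)
          (λ f p h → let (g , e , k) = node-child⁻ {j = i} cs (from (toℕ f ∷ p) (node-child {j = i} ds f {p} h))
                   in subst (λ f → NodeAt (Vec.lookup cs f) p _) (sym (Fin.toℕ-injective e)) k))
  vec-ext [] [] _ _ = refl
  vec-ext (c ∷ cs) (d ∷ ds) to from = cong₂ _∷_
    (tree-ext c d (to Fin.zero) (from Fin.zero)) (vec-ext cs ds (to ∘ Fin.suc) (from ∘ Fin.suc))

-- A valid tree with its leaves forgotten. The combinatorial arguments see only the paths of the
-- labels; `Represents` carries the results back to trees.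
record PathSystem (m n : ℕ) : Set where
  field
    path           : Fin n → Path
    path-injective : ∀ {i j} → path i ≡ path j → i ≡ j
    prefix-closed  : ∀ {r} i → IsPrefix r (path i) → Σ (Fin n) λ k → path k ≡ r
    path-bound     : ∀ {i q s} → path i ≡ q ++ [ s ] → s ≤ m

record Represents {m n : ℕ} (T : Tree m n) (S : PathSystem m n) : Set where
  open PathSystem S
  field
    node-path : ∀ p {i} → NodeAt T p i → p ≡ path i
    path-node : ∀ i → NodeAt T (path i) i

module _ {m n : ℕ} where

  tree⇒pathSystem : (T : Tree m n) → ValidTree T → Σ (PathSystem m n) (Represents T)
  tree⇒pathSystem T v = S , record { node-path = λ p {i} h → uniq p _ h (nodeOf i) ; path-node = nodeOf }
    where
    uniq : ∀ {i} p q → NodeAt T p i → NodeAt T q i → p ≡ q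
    uniq p q = unique⇒node-unique T (PermS.Unique-resp-↭ (setoid _) (↭⇒↭ₛ (↭-sym v)) (Unique.allFin⁺ n)) {_} {p} {q}
    pathOf : ∀ i → Σ Path λ p → NodeAt T p i
    pathOf i = label⇒node T (Perm.∈-resp-↭ (↭-sym v) (Mem.∈-allFin i))
    nodeOf : ∀ i → NodeAt T (proj₁ (pathOf i)) i
    nodeOf i = proj₂ (pathOf i)
    S : PathSystem m n
    S = record
      { path = proj₁ ∘ pathOf
      ; path-injective = λ {i} {j} e → node-label {p = proj₁ (pathOf i)} (nodeOf i) (subst (λ p → NodeAt T p j) (sym e) (nodeOf j))
      ; prefix-closed = closed
      ; path-bound = λ {i} {q} {s} e → node-index q s (subst (λ p → NodeAt T p i) e (nodeOf i))
      }
      where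
      closed : ∀ {r} i → IsPrefix r (proj₁ (pathOf i)) → Σ (Fin n) λ k → proj₁ (pathOf k) ≡ r
      closed {r} i (u , e) with node-above r u (subst (λ p → NodeAt T p i) (sym e) (nodeOf i))
      ... | k , h = k , uniq _ r (nodeOf k) h

  represents-injective : ∀ {T T' : Tree m n} {S S'} → Represents T S → Represents T' S' →
    (∀ i → PathSystem.path S i ≡ PathSystem.path S' i) → T ≡ T'
  represents-injective {T} {T'} R R' e = tree-ext T T'
    (λ p {i} h → subst (λ p → NodeAt T' p i) (trans (sym (e i)) (sym (R.node-path p h))) (R'.path-node i))
    (λ p {i} h → subst (λ p → NodeAt T p i) (trans (e i) (sym (R'.node-path p h))) (R.path-node i))
    where
    module R = Represents R
    module R' = Represents R'

upper-bound : ∀ {n} (f : Fin n → ℕ) → Σ ℕ λ N → ∀ i → f i < N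
upper-bound {zero} f = 0 , λ ()
upper-bound {suc n} f with upper-bound (f ∘ Fin.suc)
... | N , h = suc (f Fin.zero + N) , λ
  { Fin.zero → s≤s (ℕ.m≤m+n _ N)
  ; (Fin.suc i) → ℕ.<-≤-trans (h i) (ℕ.m≤n⇒m≤1+n (ℕ.m≤n+m N _)) }

module _ {m n : ℕ} (S : PathSystem m n) where
  open PathSystem S

  private
    -- The number is fuel: the subtree at `r`, cut off at that depth. A strict bound on the lengths
    -- of all paths makes the cut harmless.
    sub : ℕ → Path → Tree m n
    sub-at : ℕ → (r : Path) → Dec (Σ (Fin n) λ k → path k ≡ r) → Tree m n
    sub zero r = leaf
    sub (suc f) r = sub-at f r (Fin.any? λ k → path k ≟ᵖ r)
    sub-at f r (yes (k , _)) = node k (Vec.tabulate λ s → sub f (r ++ [ toℕ s ]))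
    sub-at f r (no _) = leaf

    bound-index : ∀ {i r s p} → path i ≡ r ++ s ∷ p → s ≤ m
    bound-index {i} {r} {s} {p} e with prefix-closed {r ++ [ s ]} i (p , trans (List.++-assoc r [ s ] p) (sym e))
    ... | k , e' = path-bound e'

    sub-node : ∀ f {r p i} → path i ≡ r ++ p → length p < f → NodeAt (sub f r) p i
    sub-node (suc f) {r} {p} {i} e _ with Fin.any? (λ k → path k ≟ᵖ r)
    sub-node (suc f) {r} {p} {i} e _ | no ¬h = ⊥-elim (¬h (prefix-closed i (p , sym e)))
    sub-node (suc f) {r} {[]} {i} e _ | yes (k , e')
      with path-injective (trans e (trans (List.++-identityʳ r) (sym e')))
    ... | refl = _ , refl
    sub-node (suc f) {r} {s ∷ p} {i} e (s≤s l) | yes (k , e')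
      with Fin.fromℕ< (s≤s (bound-index {i} {r} e)) | Fin.toℕ-fromℕ< (s≤s (bound-index {i} {r} e))
    ... | g | refl = node-child {j = k} (Vec.tabulate λ s → sub f (r ++ [ toℕ s ])) g {p} (subst (λ c → NodeAt c p i)
          (sym (Vec.lookup∘tabulate (λ s → sub f (r ++ [ toℕ s ])) g))
          (sub-node f {r ++ [ toℕ g ]} {p} (trans e (sym (List.++-assoc r [ toℕ g ] p))) l))

    sub-node⁻ : ∀ f {r p i} → NodeAt (sub f r) p i → path i ≡ r ++ p
    sub-node⁻ zero {p = []} (_ , ())
    sub-node⁻ zero {p = _ ∷ _} (_ , ())
    sub-node⁻ (suc f) {r} {p} {i} h with Fin.any? (λ k → path k ≟ᵖ r)
    sub-node⁻ (suc f) {r} {[]} (_ , ()) | no _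
    sub-node⁻ (suc f) {r} {_ ∷ _} (_ , ()) | no _
    sub-node⁻ (suc f) {r} {[]} (_ , refl) | yes (k , e) = trans e (sym (List.++-identityʳ r))
    sub-node⁻ (suc f) {r} {s ∷ p} {i} h | yes (k , e) with node-child⁻ {j = k} (Vec.tabulate λ s → sub f (r ++ [ toℕ s ])) {s} {p} h
    ... | g , refl , h' = trans (sub-node⁻ f {p = p} (subst (λ c → NodeAt c p i)
          (Vec.lookup∘tabulate (λ s → sub f (r ++ [ toℕ s ])) g) h')) (List.++-assoc r [ toℕ g ] p)

  pathSystem⇒tree : Σ (Tree m n) λ T → ValidTree T × Represents T S
  pathSystem⇒tree with upper-bound (length ∘ path)
  ... | F , len< = sub F [] , valid , record { node-path = λ p h → sym (sub-node⁻ F {p = p} h) ; path-node = λ i → sub-node F {[]} {path i} refl (len< i) }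
    where
    valid : labels (sub F []) ↭ allFin n
    valid = ∼bag⇒↭ (unique∧set⇒bag
      (node-unique⇒unique (sub F []) λ p q h k → trans (sym (sub-node⁻ F {p = p} h)) (sub-node⁻ F {p = q} k))
      (Unique.allFin⁺ n)
      (λ {i} → mk⇔ (λ _ → Mem.∈-allFin i) (λ _ → node⇒label (sub F []) {path i} (sub-node F {[]} {path i} refl (len< i)))))

-- Blocks of a marked tree

module _ {m n : ℕ} (S : PathSystem m n) where
  open PathSystem S

  Child : Fin n → ℕ → Fin n → Set
  Child i s k = path i ≡ path k ++ [ s ]

  Cadet : Fin n → ℕ → Fin n → Set
  Cadet i s k = Child i s k × (∀ t l → s < t → ¬ Child l t k)

  Marking : Subset n → Set
  Marking μ = ∀ i → i ∈ μ → Σ ℕ λ s → Σ (Fin n) λ k → Cadet i s k × (s ≡ 0 → k Fin.< i)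

  height : Fin n → ℕ
  height i = drift (path i)

  child-unique : ∀ {i s k s' k'} → Child i s k → Child i s' k' → s ≡ s' × k ≡ k'
  child-unique {i} {s} {k} {s'} {k'} e f with snoc-injective {path k} {path k'} (trans (sym e) f)
  ... | g , h = h , path-injective g

  child-height : ∀ {i s k} → Child i s k → height i ≡ height k + s
  child-height {k = k} e = trans (cong drift e) (drift-snoc (path k) _)

  data Descends (μ : Subset n) (k : Fin n) : Fin n → Set where
    stay : Descends μ k k
    down : ∀ {j i s} → Descends μ k j → i ∈ μ → Child i s j → Descends μ k i

module Blocks {m n : ℕ} (S : PathSystem m n) {μ : Subset n} (M : Marking S μ) where
  open PathSystem S

  infix 4 _↓_ _~_
  -- Marked edges are cadet edges and a node has at most one cadet, so marked edges never fork
  -- downwards. A block is therefore a chain, and of two nodes in it one is above the other.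
  _↓_ _~_ : Fin n → Fin n → Set
  k ↓ i = Descends S μ k i
  i ~ j = i ↓ j ⊎ j ↓ i

  ↓-trans : ∀ {i j k} → i ↓ j → j ↓ k → i ↓ k
  ↓-trans p stay = p
  ↓-trans p (down q i∈ c) = down (↓-trans p q) i∈ c

  ↓-prefix : ∀ {k i} → k ↓ i → IsPrefix (path k) (path i)
  ↓-prefix stay = prefix-refl
  ↓-prefix (down {j} p _ c) = prefix-trans (↓-prefix p) ([ _ ] , sym c)

  ↓-height : ∀ {k i} → k ↓ i → height S k ≤ height S i
  ↓-height p = prefix-drift (↓-prefix p)

  ↓-front : ∀ {k i} → k ↓ i → k ≡ i ⊎ Σ (Fin n) λ c → Σ ℕ λ s → c ∈ μ × Child S c s k × c ↓ i
  ↓-front stay = inj₁ refl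
  ↓-front (down p i∈ c) with ↓-front p
  ... | inj₁ refl = inj₂ (_ , _ , i∈ , c , stay)
  ... | inj₂ (b , s , b∈ , e , q) = inj₂ (b , s , b∈ , e , down q i∈ c)

  marked-cadet : ∀ {i s k} → i ∈ μ → Child S i s k → Cadet S i s k × (s ≡ 0 → k Fin.< i)
  marked-cadet {i} i∈ c with M i i∈
  ... | s , k , (c' , last) , zero-label with child-unique S c c'
  ...   | refl , refl = (c' , last) , zero-label

  marked-child-unique : ∀ {c c' s s' k} → c ∈ μ → Child S c s k → c' ∈ μ → Child S c' s' k → c ≡ c'
  marked-child-unique {c} {c'} {s} {s'} c∈ e c'∈ e' with ℕ.<-cmp s s'
  ... | tri< h _ _ = ⊥-elim (proj₂ (proj₁ (marked-cadet c∈ e)) s' c' h e')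
  ... | tri≈ _ refl _ = path-injective (trans e (sym e'))
  ... | tri> _ _ h = ⊥-elim (proj₂ (proj₁ (marked-cadet c'∈ e')) s c h e)

  ↓-fork : ∀ {u i j} → u ↓ i → u ↓ j → i ↓ j ⊎ j ↓ i
  ↓-fork p stay = inj₂ p
  ↓-fork p (down {j} q i∈ c) with ↓-fork p q
  ... | inj₁ r = inj₁ (down r i∈ c)
  ... | inj₂ r with ↓-front r
  ...   | inj₁ refl = inj₁ (down stay i∈ c)
  ...   | inj₂ (b , s , b∈ , e , r') with marked-child-unique i∈ c b∈ e
  ...     | refl = inj₂ r'

  ↓-linear : ∀ {u v i} → u ↓ i → v ↓ i → u ↓ v ⊎ v ↓ u
  ↓-linear p stay = inj₁ p
  ↓-linear stay q = inj₂ q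
  ↓-linear (down p i∈ c) (down q _ c') with child-unique S c c'
  ... | refl , refl = ↓-linear p q

  ↓-between : ∀ {k v i} → k ↓ i → IsPrefix (path k) (path v) → IsPrefix (path v) (path i) → k ↓ v × v ↓ i
  ↓-between stay k⊑v v⊑i with path-injective (prefix-antisym k⊑v v⊑i)
  ... | refl = stay , stay
  ↓-between {v = v} (down {j} p i∈ c) k⊑v v⊑i
    with prefix-snoc⁻ (path j) (subst (IsPrefix (path v)) c v⊑i)
  ... | inj₁ e with path-injective (trans e (sym c))
  ...   | refl = down p i∈ c , stay
  ↓-between (down p i∈ c) k⊑v v⊑i | inj₂ v⊑j with ↓-between p k⊑v v⊑j
  ... | q , r = q , down r i∈ c

  unmarked-↓ : ∀ {k i} → k ↓ i → i ∉ μ → k ≡ i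
  unmarked-↓ stay _ = refl
  unmarked-↓ (down _ i∈ _) i∉ = ⊥-elim (i∉ i∈)

  -- A descent that gains no height uses only marked 0-cadet edges, and the marking rule makes
  -- labels increase along those.
  ↓-label : ∀ {k i} → k ↓ i → height S k ≡ height S i → k Fin.≤ i
  ↓-label stay _ = ℕ.≤-refl
  ↓-label {k} (down {j} {i} {zero} p i∈ c) e = ℕ.≤-trans
    (↓-label p (trans e (trans (child-height S c) (ℕ.+-identityʳ _))))
    (ℕ.<⇒≤ (proj₂ (marked-cadet i∈ c) refl))
  ↓-label (down {j} {i} {suc s} p i∈ c) e = ⊥-elim (ℕ.<-irrefl e (ℕ.≤-<-trans (↓-height p)
    (subst (height S j <_) (sym (child-height S c)) (ℕ.m<m+n _ (s≤s z≤n)))))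

  abstract
    topmost : ∀ i → Σ (Fin n) λ t → t ∉ μ × t ↓ i
    topmost i = go i (<-wellFounded _)
      where
      go : ∀ i → Acc _<_ (length (path i)) → Σ (Fin n) λ t → t ∉ μ × t ↓ i
      go i (acc rec) with i Subset.∈? μ
      ... | no i∉ = i , i∉ , stay
      ... | yes i∈ with M i i∈
      ...   | s , k , (c , _) , _ with go k (rec (subst (length (path k) <_)
                (sym (trans (cong length c) (length-snoc (path k) s))) ℕ.≤-refl))
      ...     | t , t∉ , p = t , t∉ , down p i∈ c

  top : Fin n → Fin n
  top i = proj₁ (topmost i)

  top-unmarked : ∀ i → top i ∉ μ
  top-unmarked i = proj₁ (proj₂ (topmost i))

  top-↓ : ∀ i → top i ↓ i
  top-↓ i = proj₂ (proj₂ (topmost i))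

  top-unique : ∀ {t i} → t ∉ μ → t ↓ i → t ≡ top i
  top-unique {i = i} t∉ p with ↓-linear p (top-↓ i)
  ... | inj₁ q = unmarked-↓ q (top-unmarked i)
  ... | inj₂ q = sym (unmarked-↓ q t∉)

  top-fix : ∀ {i} → i ∉ μ → top i ≡ i
  top-fix i∉ = sym (top-unique i∉ stay)

  ↓⇒top≡ : ∀ {i j} → i ↓ j → top i ≡ top j
  ↓⇒top≡ {i} p = top-unique (top-unmarked i) (↓-trans (top-↓ i) p)

  ~⇒top≡ : ∀ {i j} → i ~ j → top i ≡ top j
  ~⇒top≡ (inj₁ p) = ↓⇒top≡ p
  ~⇒top≡ (inj₂ p) = sym (↓⇒top≡ p)

  top≡⇒~ : ∀ {i j} → top i ≡ top j → i ~ j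
  top≡⇒~ {i} {j} e = ↓-fork (top-↓ i) (subst (_↓ j) (sym e) (top-↓ j))

  ~-sym : ∀ {i j} → i ~ j → j ~ i
  ~-sym (inj₁ p) = inj₂ p
  ~-sym (inj₂ p) = inj₁ p

  ~-trans : ∀ {i j k} → i ~ j → j ~ k → i ~ k
  ~-trans p q = top≡⇒~ (trans (~⇒top≡ p) (~⇒top≡ q))

  _~?_ : ∀ i j → Dec (i ~ j)
  i ~? j = map′ top≡⇒~ ~⇒top≡ (top i Fin.≟ top j)

  ~∧prefix⇒↓ : ∀ {i j} → i ~ j → IsPrefix (path i) (path j) → i ↓ j
  ~∧prefix⇒↓ (inj₁ p) _ = p
  ~∧prefix⇒↓ (inj₂ p) h with path-injective (prefix-antisym h (↓-prefix p))
  ... | refl = stay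

  _↓?_ : ∀ i j → Dec (i ↓ j)
  i ↓? j = map′ (λ { (p , h) → ~∧prefix⇒↓ p h }) (λ p → inj₁ p , ↓-prefix p)
                (i ~? j ×-dec prefix? (path i) (path j))

  -- A block hangs below its top node through cadets, so every node to the right of the
  -- path to the top of another block is to the right of the whole block.
  ↓-right : ∀ {t i t'} → t ↓ i → t' ∉ μ → prefLex (path t) (path t') → prefLex (path i) (path t')
  ↓-right stay _ h = h
  ↓-right {t' = t'} (down {j} {i} {s} p i∈ c) t'∉ h with pl-extendˡ (path j) (path t') s (↓-right p t'∉ h)
  ... | inj₁ k = subst (λ q → prefLex q (path t')) (sym c) k
  ... | inj₂ (a , u , e) with prefix-closed {path j ++ [ a ]} t' (u , trans (List.++-assoc (path j) [ a ] u) (sym e))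
  ...   | l , e' = subst₂ prefLex (sym c) (sym e) (pl-++ (path j) (below u e))
    where
    a≤s : a ≤ s
    a≤s = ℕ.≮⇒≥ λ s<a → proj₂ (proj₁ (marked-cadet i∈ c)) a l s<a e'
    below : ∀ u → path t' ≡ path j ++ a ∷ u → prefLex [ s ] (a ∷ u)
    below u e with ℕ.m≤n⇒m<n∨m≡n a≤s
    ... | inj₁ a<s = inj₁ a<s
    below [] e | inj₂ refl with path-injective (trans e (sym c))
    ... | refl = ⊥-elim (t'∉ i∈)
    below (_ ∷ _) e | inj₂ refl = inj₂ (refl , tt)

  -- All nodes are counted, not only tops: the values have gaps, but their order is the same and
  -- they are at most `n`. `prefLex` ignores drift because ranks only decide ties between integer
  -- heights.
  rank : Fin n → ℕ
  rank i = count (λ l → pl? (path l) (path (top i))) (allFin n)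

  rank-mono : ∀ {i j} → prefLex (path (top i)) (path (top j)) → rank i < rank j
  rank-mono {i} {j} h = count-mono-< _ _ (λ l k → pl-trans (path l) _ _ k h)
    (Mem.∈-allFin (top i)) h (pl-irrefl (path (top i)))

  rank-~ : ∀ {i j} → i ~ j → rank i ≡ rank j
  rank-~ p rewrite ~⇒top≡ p = refl

  rank-reflects : ∀ {i j} → rank i < rank j → prefLex (path (top i)) (path (top j))
  rank-reflects {i} {j} h with pl-cmp (path (top i)) (path (top j))
  ... | inj₁ k = k
  ... | inj₂ (inj₁ e) = ⊥-elim (ℕ.<-irrefl (rank-~ (top≡⇒~ (path-injective e))) h)
  ... | inj₂ (inj₂ k) = ⊥-elim (ℕ.<-asym h (rank-mono {j} {i} k))

  rank≡⇒~ : ∀ {i j} → rank i ≡ rank j → i ~ j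
  rank≡⇒~ {i} {j} e with pl-cmp (path (top i)) (path (top j))
  ... | inj₁ k = ⊥-elim (ℕ.<-irrefl e (rank-mono {i} {j} k))
  ... | inj₂ (inj₁ k) = top≡⇒~ (path-injective k)
  ... | inj₂ (inj₂ k) = ⊥-elim (ℕ.<-irrefl (sym e) (rank-mono {j} {i} k))

  -- This is why one weight per block suffices. At equal drift the comparison is lexicographic, and
  -- by `↓-right` the block whose top comes first precedes the whole other block; `pl-child` handles
  -- the `s`-child of `j`. The tops are comparable, so it is enough to derive the order of the nodes
  -- from the order of the tops.
  order-by-tops : ∀ {i j s} → height S i ≡ height S j + s → ¬ (i ~ j) →
    (path i ≺ (path j ++ [ s ]) → prefLex (path (top i)) (path (top j))) ×
    (path i ⪰ (path j ++ [ s ]) → prefLex (path (top j)) (path (top i)))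
  order-by-tops {i} {j} {s} e ¬p = before , after
    where
    P Q : Path
    P = path (top i)
    Q = path (top j)
    e' : drift (path i) ≡ drift (path j ++ [ s ])
    e' = trans e (sym (drift-snoc (path j) s))
    lemma-before : prefLex P Q → path i ≺ (path j ++ [ s ])
    lemma-before h with ↓-prefix (top-↓ j)
    ... | u , u≡ = inj₂ (e' , subst (prefLex (path i)) (trans (sym (List.++-assoc Q u [ s ])) (cong (_++ [ s ]) u≡))
      (pl-extendʳ (path i) Q (u ++ [ s ]) (↓-right (top-↓ i) (top-unmarked j) h)))
    lemma-after : prefLex Q P → ¬ (path i ≺ (path j ++ [ s ]))
    lemma-after h (inj₁ k) = ℕ.<-irrefl e' k
    lemma-after h (inj₂ (_ , k)) with ↓-prefix (top-↓ i)
    ... | u , u≡ = pl-child (path j) (path i) s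
      (subst (prefLex (path j)) u≡ (pl-extendʳ (path j) P u (↓-right (top-↓ j) (top-unmarked i) h))) e k
    cmp : prefLex P Q ⊎ prefLex Q P
    cmp with pl-cmp P Q
    ... | inj₁ h = inj₁ h
    ... | inj₂ (inj₁ h) = ⊥-elim (¬p (top≡⇒~ (path-injective h)))
    ... | inj₂ (inj₂ h) = inj₂ h
    before : path i ≺ (path j ++ [ s ]) → prefLex P Q
    before k with cmp
    ... | inj₁ h = h
    ... | inj₂ h = ⊥-elim (lemma-after h k)
    after : path i ⪰ (path j ++ [ s ]) → prefLex Q P
    after k with cmp
    ... | inj₁ h = ⊥-elim (≺⇒¬⪰ (lemma-before h) k)
    ... | inj₂ h = h

-- Faces

module _ {m n : ℕ} {T : Tree m n} {S : PathSystem m n} (R : Represents T S) where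
  open PathSystem S
  open Represents R

  childOf⇒child : ∀ {i s j} → ChildOf T i s j → Child S i s j
  childOf⇒child {i} {s} {j} (q , h , k) =
    trans (sym (node-path (q ++ [ s ]) k)) (cong (_++ [ s ]) (node-path q h))

  child⇒childOf : ∀ {i s j} → Child S i s j → ChildOf T i s j
  child⇒childOf {i} {s} {j} c = path j , path-node j , subst (λ p → NodeAt T p i) c (path-node i)

  cadetOf⇒cadet : ∀ {i s j} → CadetOf T i s j → Cadet S i s j
  cadetOf⇒cadet {i} {s} {j} (h , last) = childOf⇒child h , λ t l s<t c →
    leaf⇒¬node {p = path j ++ [ t ]} (last t s<t (path-bound c) (path j) (path-node j))
               (subst (λ p → NodeAt T p l) c (path-node l))

  cadet⇒cadetOf : ∀ {i s j} → Cadet S i s j → CadetOf T i s j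
  cadet⇒cadetOf {i} {s} {j} (c , last) = child⇒childOf c , λ t s<t t≤m q h → lem t s<t t≤m q h
    where
    lem : ∀ t → s < t → t ≤ m → ∀ q → NodeAt T q j → LeafAt T (q ++ [ t ])
    lem t s<t t≤m q h with child-vertex {T = T} {q} t h t≤m
    ... | inj₁ e = e
    ... | inj₂ (l , k) = ⊥-elim (last t l s<t
      (trans (sym (node-path (q ++ [ t ]) k)) (cong (_++ [ t ]) (node-path q h))))

  markedOK⇒marking : ∀ {μ} → MarkedOK T μ → Marking S μ
  markedOK⇒marking mok i i∈ with mok i i∈
  ... | s , k , c , z = s , k , cadetOf⇒cadet c , z

  marking⇒markedOK : ∀ {μ} → Marking S μ → MarkedOK T μ
  marking⇒markedOK M i i∈ with M i i∈
  ... | s , k , c , z = s , k , cadet⇒cadetOf c , z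

  module _ {μ : Subset n} (M : Marking S μ) where
    open Blocks S M

    -- If the top of `i` were not above `j`, its parent edge would lie on the path between `i` and
    -- `j` and hence be marked. So each top is above both nodes, and two unmarked nodes in that
    -- position coincide.
    sameBlock⇒~ : ∀ {i j} → SameBlock T μ i j → i ~ j
    sameBlock⇒~ {i} {j} h = top≡⇒~ (tops≡ (common i j (λ k r e → h (path i) (path j) (path-node i) (path-node j) k r e))
      (common j i (λ k r e x → h (path i) (path j) (path-node i) (path-node j) k r e (swap x))))
      where
      swap : ∀ {A B : Set} → A ⊎ B → B ⊎ A
      swap (inj₁ a) = inj₂ a
      swap (inj₂ b) = inj₁ b
      common : ∀ i j → (∀ k r → NodeAt T r k →
        ((IsPrefix r (path i) × ¬ IsPrefix r (path j)) ⊎ (IsPrefix r (path j) × ¬ IsPrefix r (path i))) → k ∈ μ) →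
        IsPrefix (path (top i)) (path j)
      common i j h with prefix? (path (top i)) (path j)
      ... | yes p = p
      ... | no ¬p = ⊥-elim (top-unmarked i (h (top i) (path (top i)) (path-node (top i)) (inj₁ (↓-prefix (top-↓ i) , ¬p))))
      tops≡ : IsPrefix (path (top i)) (path j) → IsPrefix (path (top j)) (path i) → top i ≡ top j
      tops≡ p q with prefix-linear p (↓-prefix (top-↓ j))
      ... | inj₁ l = unmarked-↓ (proj₁ (↓-between (top-↓ i) l q)) (top-unmarked j)
      ... | inj₂ l = sym (unmarked-↓ (proj₁ (↓-between (top-↓ j) l p)) (top-unmarked i))

    ↓⇒marked : ∀ {i j l} → i ↓ j → IsPrefix (path l) (path j) → ¬ IsPrefix (path l) (path i) → l ∈ μ
    ↓⇒marked {i} {j} {l} p l⊑j l⋢i with prefix-linear (↓-prefix p) l⊑j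
    ... | inj₂ l⊑i = ⊥-elim (l⋢i l⊑i)
    ... | inj₁ i⊑l with l Subset.∈? μ
    ...   | yes l∈ = l∈
    ...   | no l∉ with unmarked-↓ (proj₁ (↓-between p i⊑l l⊑j)) l∉
    ...     | refl = ⊥-elim (l⋢i prefix-refl)

    ~⇒sameBlock : ∀ {i j} → i ~ j → SameBlock T μ i j
    ~⇒sameBlock {i} {j} i~j p q hp hq l r hr h
      with node-path p hp | node-path q hq | node-path r hr
    ... | refl | refl | refl = lem i~j h
      where
      lem : i ~ j → ((IsPrefix (path l) (path i) × ¬ IsPrefix (path l) (path j)) ⊎
                     (IsPrefix (path l) (path j) × ¬ IsPrefix (path l) (path i))) → l ∈ μ
      lem (inj₁ d) (inj₁ (a , ¬b)) = ⊥-elim (¬b (prefix-trans a (↓-prefix d)))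
      lem (inj₁ d) (inj₂ (a , ¬b)) = ↓⇒marked d a ¬b
      lem (inj₂ d) (inj₁ (a , ¬b)) = ↓⇒marked d a ¬b
      lem (inj₂ d) (inj₂ (a , ¬b)) = ⊥-elim (¬b (prefix-trans a (↓-prefix d)))

module _ {m n : ℕ} (S : PathSystem m n) where

  heightGap : Fin n → Fin n → ℤ
  heightGap i j = + height S i ℤ.- + height S j

driftIn⇒inA : ∀ {m n} (A : Arr m n) {T : Tree m n} {S} → Represents T S → ∀ {i j} →
              DriftIn A T i j → InA A i j (heightGap S i j)
driftIn⇒inA A R {i} {j} (p , q , hp , hq , a) with Represents.node-path R p hp | Represents.node-path R q hq
... | refl | refl = a

inA⇒driftIn : ∀ {m n} (A : Arr m n) {T : Tree m n} {S} → Represents T S → ∀ {i j} →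
              InA A i j (heightGap S i j) → DriftIn A T i j
inA⇒driftIn A {S = S} R {i} {j} a =
  PathSystem.path S i , PathSystem.path S j , Represents.path-node R i , Represents.path-node R j , a

abstract
  telescope : ∀ a b c → (a ℤ.- b) ℤ.+ (b ℤ.- c) ≡ a ℤ.- c
  telescope = ℤSolver.solve-∀

  neg-minus : ∀ a b → ℤ.- (a ℤ.- b) ≡ b ℤ.- a
  neg-minus = ℤSolver.solve-∀

  m+s-m : ∀ a b {c} → c ≡ a + b → + c ℤ.- + a ≡ + b
  m+s-m a b refl = lem (+ a) (+ b)
    where
    lem : ∀ a b → (a ℤ.+ b) ℤ.- a ≡ b
    lem = ℤSolver.solve-∀

module _ {n : ℕ} where

  gap-transfer : ∀ {x y : Point n} {i j d e} → GapEq x i j d → GapEq y i j d → GapLt x i j e → GapLt y i j e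
  gap-transfer ⟪ p ⟫ ⟪ q ⟫ ⟪ r ⟫ = ⟪ subst (ℚ._< _) (trans p (sym q)) r ⟫

-- Points in the same face of the arrangement

module _ {m n : ℕ} (A : Arr m n) where
  open Arr A

  inA-swap : ∀ {i j d} → InA A i j d → InA A j i (ℤ.- d)
  inA-swap {i} {j} {d} a = trans (sym (mem-sym i j d)) a

  inA-≢ : ∀ {i j d} → InA A i j d → i ≢ j
  inA-≢ {i} {_} {d} a refl with trans (sym (mem-irrefl i d)) a
  ... | ()

  InTriple : Fin n → Fin n → ℤ → Set
  InTriple i j d = (Σ ℕ λ s → d ≡ + s × InTr A i j s) ⊎ (Σ ℕ λ s → d ≡ ℤ.- (+ s) × InTr A j i s)

  inA⇒triple : ∀ {i j d} → InA A i j d → InTriple i j d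
  inA⇒triple {i} {j} {+ suc s} a = inj₁ (suc s , refl , inA-≢ a , mem-bound i j _ a , inj₁ (s≤s z≤n) , a)
  inA⇒triple {i} {j} { -[1+ s ] } a =
    inj₂ (suc s , refl , inA-≢ (inA-swap a) , mem-bound j i _ (inA-swap a) , inj₁ (s≤s z≤n) , inA-swap a)
  -- At `d = 0` both orientations name the same hyperplane; the labels decide which of them is a
  -- triple of `Tr`.
  inA⇒triple {i} {j} {+ zero} a with ℕ.<-cmp (toℕ i) (toℕ j)
  ... | tri< i<j _ _ = inj₂ (0 , refl , inA-≢ (inA-swap a) , z≤n , inj₂ i<j , inA-swap a)
  ... | tri≈ _ e _ = ⊥-elim (inA-≢ a (Fin.toℕ-injective e))
  ... | tri> _ _ j<i = inj₁ (0 , refl , inA-≢ a , z≤n , inj₂ j<i , a)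

  triple⇒inA : ∀ {i j s} → InTr A i j s → InA A i j (+ s)
  triple⇒inA (_ , _ , _ , a) = a

  -- As `d` is an integer and `A` is symmetric, this covers both open sides of each hyperplane. When
  -- it holds in both directions, trichotomy yields the equalities as well (`sameFace-eq`).
  Refines : Point n → Point n → Set
  Refines x y = ∀ {i j d} → InA A i j d → GapLt x i j d → GapLt y i j d

  SameFace : Point n → Point n → Set
  SameFace x y = Refines x y × Refines y x

  refines-trans : ∀ {x y z} → Refines x y → Refines y z → Refines x z
  refines-trans r r' a h = r' a (r a h)

  sameFace-sym : ∀ {x y} → SameFace x y → SameFace y x
  sameFace-sym (a , b) = b , a

  sameFace-trans : ∀ {x y z} → SameFace x y → SameFace y z → SameFace x z
  sameFace-trans {x} {y} {z} (a , b) (c , d) = refines-trans {x} {y} {z} a c , refines-trans {z} {y} {x} d b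

  sameFace-eq : ∀ {x y i j d} → SameFace x y → InA A i j d → GapEq x i j d → GapEq y i j d
  sameFace-eq {x} {y} {i} {j} {d} sf a h with gap-cmp y i j d
  ... | less p = ⊥-elim (lt⇒¬eq (proj₂ sf a p) h)
  ... | equal p = p
  ... | greater p = ⊥-elim (lt-irrefl (proj₂ sf (inA-swap a) p) (inj₂ (eq-swap (eq-swap h))))

  sameFace-le : ∀ {x y i j d} → SameFace x y → InA A i j d → GapLe x i j d → GapLe y i j d
  sameFace-le sf a (inj₁ h) = inj₁ (proj₁ sf a h)
  sameFace-le sf a (inj₂ h) = inj₂ (sameFace-eq sf a h)

  triples⇒refines : ∀ {x y} → (∀ {i j s} → InTr A i j s →
    (GapLt x i j (+ s) → GapLt y i j (+ s)) × (GapLt x j i (ℤ.- + s) → GapLt y j i (ℤ.- + s))) → Refines x y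
  triples⇒refines h a with inA⇒triple a
  ... | inj₁ (s , refl , t) = proj₁ (h t)
  ... | inj₂ (s , refl , t) = proj₂ (h t)

  private
    holds-lt : ∀ {i j s} {x y : Point n} σ → holds σ (x i ℚ.- x j) (ℕtoℚ s) → holds σ (y i ℚ.- y j) (ℕtoℚ s) →
               GapLt x i j (+ s) → GapLt y i j (+ s)
    holds-lt lt p q _ = ⟪ q ⟫
    holds-lt {i} {j} {s} {x} eq p q h = ⊥-elim (lt⇒¬eq {x = x} h ⟪ p ⟫)
    holds-lt {i} {j} {s} {x} gt p q h = ⊥-elim (lt-irrefl {x = x} h (inj₁ (gt⇒lt p)))
    holds-gt : ∀ {i j s} {x y : Point n} σ → holds σ (x i ℚ.- x j) (ℕtoℚ s) → holds σ (y i ℚ.- y j) (ℕtoℚ s) →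
               GapLt x j i (ℤ.- + s) → GapLt y j i (ℤ.- + s)
    holds-gt {i} {j} {s} {x} lt p q h = ⊥-elim (lt-irrefl {x = x} {d = + s} ⟪ p ⟫ (inj₁ h))
    holds-gt {i} {j} {s} {x} eq p q h = ⊥-elim (lt⇒¬eq {x = x} h (eq-swap ⟪ p ⟫))
    holds-gt gt p q h = gt⇒lt q

  faceSet⇒refines : ∀ {σ x y} → FaceSet A σ x → FaceSet A σ y → Refines x y
  faceSet⇒refines {σ} {x} {y} fx fy = triples⇒refines {x} {y} λ {i} {j} {s} t →
    holds-lt {i} {j} {s} {x} {y} (σ i j s) (fx i j s t) (fy i j s t) ,
    holds-gt {i} {j} {s} {x} {y} (σ i j s) (fx i j s t) (fy i j s t)

  sameFace⇒faceSet : ∀ {σ x y} → SameFace x y → FaceSet A σ y → FaceSet A σ x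
  sameFace⇒faceSet {σ} {x} {y} sf fy i j s t = go (σ i j s) (fy i j s t)
    where
    go : ∀ s' → holds s' (y i ℚ.- y j) (ℕtoℚ s) → holds s' (x i ℚ.- x j) (ℕtoℚ s)
    go lt p = gap< (proj₂ sf (triple⇒inA t) ⟪ p ⟫)
    go eq p = gap≡ (sameFace-eq {y} {x} (sameFace-sym {x} {y} sf) (triple⇒inA t) ⟪ p ⟫)
    go gt p = lt⇒gt (proj₂ sf (inA-swap (triple⇒inA t)) (gt⇒lt p))

  signs : Point n → Fin n → Fin n → ℕ → Sign
  signs x i j s with gap-cmp x i j (+ s)
  ... | less _    = lt
  ... | equal _   = eq
  ... | greater _ = gt

  signs-self : ∀ x → FaceSet A (signs x) x
  signs-self x i j s t with gap-cmp x i j (+ s)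
  ... | less p    = gap< p
  ... | equal p   = gap≡ p
  ... | greater p = lt⇒gt p

-- The point of a marked tree

module _ {m n : ℕ} (S : PathSystem m n) {μ : Subset n} (M : Marking S μ) where
  open PathSystem S
  open Blocks S M

  -- `InΦ` for the full Catalan arrangement: membership in `A` is replaced by `s ≤ m`. It says that
  -- `S` and `μ` describe the Catalan face of `x`.
  record Compatible (x : Point n) : Set where
    field
      edge-gap : ∀ {i s j} → i ∈ μ → Child S i s j → GapEq x i j (+ s)
      before   : ∀ {i j s} → s ≤ m → ¬ (i ~ j) → path i ≺ (path j ++ [ s ]) → GapLt x i j (+ s)
      after    : ∀ {i j s} → s ≤ m → ¬ (i ~ j) → path i ⪰ (path j ++ [ s ]) → GapLt x j i (ℤ.- + s)

  record InΦ (A : Arr m n) (x : Point n) : Set where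
    field
      edge-gap : ∀ {i s j} → i ∈ μ → Child S i s j → GapEq x i j (+ s)
      before   : ∀ {i j s} → InTr A i j s → ¬ (i ~ j) → path i ≺ (path j ++ [ s ]) → GapLt x i j (+ s)
      after    : ∀ {i j s} → InTr A i j s → ¬ (i ~ j) → path i ⪰ (path j ++ [ s ]) → GapLt x j i (ℤ.- + s)

  Linked : Arr m n → Fin n → Fin n → Set
  Linked A i j = i ~ j × InA A i j (heightGap S i j)

  Connected : Arr m n → Set
  Connected A = ∀ {i j} → i ~ j → Star (Linked A) i j

module _ {m n : ℕ} {S : PathSystem m n} {μ : Subset n} {M : Marking S μ} where
  open PathSystem S
  open Blocks S M

  compatible⇒inΦ : ∀ {A x} → Compatible S M x → InΦ S M A x
  compatible⇒inΦ C = record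
    { edge-gap = edge-gap
    ; before = λ { (_ , s≤m , _) → before s≤m }
    ; after = λ { (_ , s≤m , _) → after s≤m }
    } where open Compatible C

  module _ {x : Point n} (edge-gap : ∀ {i s j} → i ∈ μ → Child S i s j → GapEq x i j (+ s)) where

    ↓-gap : ∀ {i j} → i ↓ j → GapEq x j i (heightGap S j i)
    ↓-gap {i} stay = subst (GapEq x i i) (sym (ℤ.+-inverseʳ (+ height S i))) eq-refl
    ↓-gap {i} (down {j} {k} {s} p k∈ c) = eq-eq (edge-gap k∈ c) (↓-gap p)
      (trans (cong (ℤ._+ heightGap S j i) (sym (m+s-m (height S j) s (child-height S c))))
             (telescope (+ height S k) (+ height S j) (+ height S i)))

    block-gap : ∀ {i j} → i ~ j → GapEq x i j (heightGap S i j)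
    block-gap {i} {j} (inj₁ p) = subst (GapEq x i j) (neg-minus (+ height S j) (+ height S i)) (eq-swap (↓-gap p))
    block-gap (inj₂ p) = ↓-gap p

  inΦ⇒refines : ∀ {A x y} → InΦ S M A x → InΦ S M A y → Refines A x y
  inΦ⇒refines {A} {x} {y} P Q = triples⇒refines A {x} {y} λ t → lt-case t , gt-case t
    where
    module P = InΦ P
    module Q = InΦ Q
    lt-case : ∀ {i j s} → InTr A i j s → GapLt x i j (+ s) → GapLt y i j (+ s)
    lt-case {i} {j} {s} t h with i ~? j
    ... | yes p = gap-transfer (block-gap P.edge-gap p) (block-gap Q.edge-gap p) h
    ... | no ¬p with ≺-or-⪰ (path i) (path j ++ [ s ])
    ...   | inj₁ k = Q.before t ¬p k
    ...   | inj₂ k = ⊥-elim (lt-irrefl h (inj₁ (P.after t ¬p k)))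
    gt-case : ∀ {i j s} → InTr A i j s → GapLt x j i (ℤ.- + s) → GapLt y j i (ℤ.- + s)
    gt-case {i} {j} {s} t h with i ~? j
    ... | yes p = gap-transfer (block-gap P.edge-gap (~-sym p)) (block-gap Q.edge-gap (~-sym p)) h
    ... | no ¬p with ≺-or-⪰ (path i) (path j ++ [ s ])
    ...   | inj₁ k = ⊥-elim (lt-irrefl (P.before t ¬p k) (inj₁ h))
    ...   | inj₂ k = Q.after t ¬p k

  inΦ⇒sameFace : ∀ {A x y} → InΦ S M A x → InΦ S M A y → SameFace A x y
  inΦ⇒sameFace {A} {x} {y} P Q = inΦ⇒refines {A} {x} {y} P Q , inΦ⇒refines {A} {y} {x} Q P

  -- The place where connectedness is used: the gap along a marked edge telescopes along a walk of
  -- hyperplanes of `A` on which `y` lies, and those equalities pass to `x`.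
  sameFace⇒inΦ : ∀ {A x y} → Connected S M A → SameFace A x y → InΦ S M A y → InΦ S M A x
  sameFace⇒inΦ {A} {x} {y} conn sf Q = record
    { edge-gap = λ {i} {s} {j} i∈ c → subst (GapEq x i j) (m+s-m (height S j) s (child-height S c))
        (star-gap (conn (inj₂ (down stay i∈ c))))
    ; before = λ t ¬p h → proj₂ sf (triple⇒inA A t) (Q.before t ¬p h)
    ; after = λ t ¬p h → proj₂ sf (inA-swap A (triple⇒inA A t)) (Q.after t ¬p h)
    }
    where
    module Q = InΦ Q
    star-gap : ∀ {i j} → Star (Linked S M A) i j → GapEq x i j (heightGap S i j)
    star-gap {i} ε = subst (GapEq x i i) (sym (ℤ.+-inverseʳ (+ height S i))) eq-refl
    star-gap {i} {k} (_◅_ {j = j} (p , a) ls) = eq-eq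
      (sameFace-eq A {y} {x} (sameFace-sym A {x} {y} sf) a (block-gap Q.edge-gap p)) (star-gap ls) (telescope (+ height S i) (+ height S j) (+ height S k))

  module _ {T : Tree m n} (R : Represents T S) {A : Arr m n} where

    Φ⇒inΦ : ∀ {x} → Φ A T μ x → InΦ S M A x
    Φ⇒inΦ (marked , unmarked) = record
      { edge-gap = λ {i} {s} {j} i∈ c → ⟪ marked i s j i∈ (child⇒childOf R c) ⟫
      ; before = λ {i} {j} {s} t ¬p h → ⟪ proj₁ (gaps t ¬p) h ⟫
      ; after = λ {i} {j} {s} t ¬p h → gt⇒lt (proj₂ (gaps t ¬p) h)
      }
      where
      open Represents R
      gaps : ∀ {i j s} → InTr A i j s → ¬ (i ~ j) → _
      gaps {i} {j} {s} t ¬p = unmarked i j s t (¬p ∘ sameBlock⇒~ R M) (path i) (path j) (path-node i) (path-node j)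

    inΦ⇒Φ : ∀ {x} → InΦ S M A x → Φ A T μ x
    inΦ⇒Φ {x} P = (λ i s j i∈ c → gap≡ (edge-gap i∈ (childOf⇒child R c))) , unmarked
      where
      open InΦ P
      open Represents R
      unmarked : ∀ i j s → InTr A i j s → ¬ SameBlock T μ i j → ∀ p q → NodeAt T p i → NodeAt T q j →
        ((p ≺ (q ++ [ s ])) → x i ℚ.- x j ℚ.< ℕtoℚ s) × ((p ⪰ (q ++ [ s ])) → x i ℚ.- x j ℚ.> ℕtoℚ s)
      unmarked i j s t ¬sb p q hp hq with node-path p hp | node-path q hq
      ... | refl | refl = (λ h → gap< (before t ¬p h)) , (λ h → lt⇒gt (after t ¬p h))
        where
        ¬p : ¬ (i ~ j)
        ¬p = ¬sb ∘ ~⇒sameBlock R M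

aConnected⇒connected : ∀ {m n} (A : Arr m n) {T : Tree m n} {S} (R : Represents T S) {μ} (M : Marking S μ) →
                       AConnected A T μ → Connected S M A
aConnected⇒connected A R M ac {i} {j} p = go (ac i j (~⇒sameBlock R M p))
  where
  go : ∀ {i j} → Star (AEdge A _ _) i j → Star (Linked _ M A) i j
  go ε = ε
  go ((sb , _ , d) ◅ ls) = (sameBlock⇒~ R M sb , driftIn⇒inA A R d) ◅ go ls

connected⇒aConnected : ∀ {m n} (A : Arr m n) {T : Tree m n} {S} (R : Represents T S) {μ} (M : Marking S μ) →
                       Connected S M A → AConnected A T μ
connected⇒aConnected A R M conn i j sb = go (conn (sameBlock⇒~ R M sb))
  where
  go : ∀ {i j} → Star (Linked _ M A) i j → Star (AEdge A _ _) i j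
  go ε = ε
  go ((p , a) ◅ ls) = (~⇒sameBlock R M p , inA-≢ A a , inA⇒driftIn A R a) ◅ go ls

-- Integer heights with small rational perturbations

module _ (N' : ℕ) where

  scale : ℚ
  scale = + 1 ℚ./ suc N'

  private
    N : ℤ
    N = + suc N'
    r : ℚ
    r = scale
    N*r≡1 : ι N ℚ.* r ≡ ℚ.1ℚ
    N*r≡1 = ℚ.toℚᵘ-injective (begin
        ℚ.toℚᵘ (ι N ℚ.* r)                    ≈⟨ ℚ.toℚᵘ-homo-* (ι N) r ⟩
        ℚ.toℚᵘ (ι N) ℚᵘ.* ℚ.toℚᵘ r            ≈⟨ ℚᵘ.*-cong (ℚ.toℚᵘ-fromℚᵘ (ℚᵘ.mkℚᵘ N 0)) (ℚ.toℚᵘ-fromℚᵘ (ℚᵘ.mkℚᵘ (+ 1) N')) ⟩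
        ℚᵘ.mkℚᵘ N 0 ℚᵘ.* ℚᵘ.mkℚᵘ (+ 1) N'     ≈⟨ ℚᵘ.*≡* (lem N) ⟩
        ℚᵘ.1ℚᵘ                                ∎)
      where
      open import Relation.Binary.Reasoning.Setoid ℚᵘ.≃-setoid
      lem : ∀ N → (N ℤ.* + 1) ℤ.* + 1 ≡ + 1 ℤ.* (+ 1 ℤ.* N)
      lem = ℤSolver.solve-∀
    instance
      r-positive : ℚ.Positive r
      r-positive = ℚ.normalize-pos 1 (suc N')
    unscale : ∀ b → ι b ≡ ι (b ℤ.* N) ℚ.* r
    unscale b = sym (begin
      ι (b ℤ.* N) ℚ.* r      ≡⟨ cong (ℚ._* r) (ι-* b N) ⟩
      (ι b ℚ.* ι N) ℚ.* r    ≡⟨ ℚ.*-assoc (ι b) (ι N) r ⟩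
      ι b ℚ.* (ι N ℚ.* r)    ≡⟨ cong (ι b ℚ.*_) N*r≡1 ⟩
      ι b ℚ.* ℚ.1ℚ           ≡⟨ ℚ.*-identityʳ (ι b) ⟩
      ι b                    ∎)
      where open ≡-Reasoning
    scaled-minus : ∀ a b → ι a ℚ.* r ℚ.- ι b ℚ.* r ≡ ι (a ℤ.- b) ℚ.* r
    scaled-minus a b = trans (lem (ι a) (ι b) r)
      (cong (ℚ._* r) (sym (trans (ι-+ a (ℤ.- b)) (cong (ι a ℚ.+_) (ι-neg b)))))
      where
      open ℚSolver.+-*-Solver
      lem : ∀ a b r → a ℚ.* r ℚ.- b ℚ.* r ≡ (a ℚ.- b) ℚ.* r
      lem = solve 3 (λ a b r → a :* r :- b :* r := (a :- b) :* r) refl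
    scaled-< : ∀ a b d → a ℤ.- b ℤ.< d ℤ.* N → ι a ℚ.* r ℚ.- ι b ℚ.* r ℚ.< ι d
    scaled-< a b d h = subst₂ ℚ._<_ (sym (scaled-minus a b)) (sym (unscale d)) (ℚ.*-monoˡ-<-pos r (ι-mono-< h))
    scaled-≡ : ∀ a b d → a ℤ.- b ≡ d ℤ.* N → ι a ℚ.* r ℚ.- ι b ℚ.* r ≡ ι d
    scaled-≡ a b d h = trans (scaled-minus a b) (trans (cong (λ z → ι z ℚ.* r) h) (sym (unscale d)))
    regroup : ∀ h h' w w' N → (h ℤ.* N ℤ.+ w) ℤ.- (h' ℤ.* N ℤ.+ w') ≡ (h ℤ.- h') ℤ.* N ℤ.+ (w ℤ.- w')
    regroup = ℤSolver.solve-∀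

  abstract
    -- x_i = h i + w i / (N' + 1), so that w only breaks ties between integer heights when w ≤ N'.
    perturbed : ∀ {n} → (h w : Fin n → ℕ) → Point n
    perturbed h w i = ι (+ h i ℤ.* N ℤ.+ + w i) ℚ.* r

    perturbed-diff : ∀ {n} (h w w' : Fin n → ℕ) i →
      perturbed h w' i ℚ.- perturbed h w i ≡ ι (+ w' i ℤ.- + w i) ℚ.* scale
    perturbed-diff h w w' i = trans (scaled-minus (+ h i ℤ.* N ℤ.+ + w' i) (+ h i ℤ.* N ℤ.+ + w i))
      (cong (λ z → ι z ℚ.* r) (lem (+ h i ℤ.* N) (+ w' i) (+ w i)))
      where
      lem : ∀ a b c → (a ℤ.+ b) ℤ.- (a ℤ.+ c) ≡ b ℤ.- c
      lem = ℤSolver.solve-∀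

  scale-cancel : ∀ (q : ℚ) → q ℚ.* scale ≡ ℚ.0ℚ → q ≡ ℚ.0ℚ
  scale-cancel q e = begin
    q                      ≡⟨ ℚ.*-identityʳ q ⟨
    q ℚ.* ℚ.1ℚ             ≡⟨ cong (q ℚ.*_) (trans (sym N*r≡1) (ℚ.*-comm (ι N) r)) ⟩
    q ℚ.* (r ℚ.* ι N)      ≡⟨ ℚ.*-assoc q r (ι N) ⟨
    q ℚ.* r ℚ.* ι N        ≡⟨ cong (ℚ._* ι N) e ⟩
    ℚ.0ℚ ℚ.* ι N           ≡⟨ ℚ.*-zeroˡ (ι N) ⟩
    ℚ.0ℚ                   ∎
    where open ≡-Reasoning

  module _ {n : ℕ} (h : Fin n → ℕ) {w : Fin n → ℕ} (w< : ∀ i → w i < suc N') where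

    private
      x : Point n
      x = perturbed h w
      H : Fin n → Fin n → ℤ
      H i j = + h i ℤ.- + h j
      W : Fin n → Fin n → ℤ
      W i j = + w i ℤ.- + w j

    abstract
      -- Integers `H i j < d` differ by at least one, while a difference of weights stays below `N`
      -- and so contributes less than one after scaling.
      perturbed-< : ∀ {i j d} → H i j ℤ.< d → GapLt x i j d
      perturbed-< {i} {j} {d} h< = ⟪ scaled-< (+ h i ℤ.* N ℤ.+ + w i) (+ h j ℤ.* N ℤ.+ + w j) d (subst (ℤ._< d ℤ.* N)
          (sym (regroup (+ h i) (+ h j) (+ w i) (+ w j) N))
          (ℤ.<-≤-trans (ℤ.+-monoʳ-< (H i j ℤ.* N) W<N) le)) ⟫
        where
        W<N : W i j ℤ.< N
        W<N = ℤ.≤-<-trans (ℤ.i≤j⇒i-k≤j (+ w j) ℤ.≤-refl) (ℤ.+<+ (w< i))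
        le : H i j ℤ.* N ℤ.+ N ℤ.≤ d ℤ.* N
        le = subst (ℤ._≤ d ℤ.* N) (lem (H i j) N) (ℤ.*-monoʳ-≤-nonNeg N (ℤ.i<j⇒suc[i]≤j h<))
          where
          lem : ∀ a b → (+ 1 ℤ.+ a) ℤ.* b ≡ a ℤ.* b ℤ.+ b
          lem = ℤSolver.solve-∀

      perturbed-tie< : ∀ {i j d} → H i j ≡ d → w i < w j → GapLt x i j d
      perturbed-tie< {i} {j} refl h< = ⟪ scaled-< (+ h i ℤ.* N ℤ.+ + w i) (+ h j ℤ.* N ℤ.+ + w j) (H i j) (subst (ℤ._< H i j ℤ.* N)
          (sym (regroup (+ h i) (+ h j) (+ w i) (+ w j) N))
          (subst ((H i j ℤ.* N ℤ.+ W i j) ℤ.<_) (ℤ.+-identityʳ (H i j ℤ.* N)) (ℤ.+-monoʳ-< (H i j ℤ.* N)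
            (subst (W i j ℤ.<_) (ℤ.+-inverseʳ (+ w j)) (ℤ.+-monoˡ-< (ℤ.- + w j) (ℤ.+<+ h<)))))) ⟫

      perturbed-tie≡ : ∀ {i j d} → H i j ≡ d → w i ≡ w j → GapEq x i j d
      perturbed-tie≡ {i} {j} refl e = ⟪ scaled-≡ (+ h i ℤ.* N ℤ.+ + w i) (+ h j ℤ.* N ℤ.+ + w j) (H i j)
          (trans (regroup (+ h i) (+ h j) (+ w i) (+ w j) N)
            (trans (cong (λ z → H i j ℤ.* N ℤ.+ (+ z ℤ.- + w j)) e)
              (trans (cong (λ z → H i j ℤ.* N ℤ.+ z) (ℤ.+-inverseʳ (+ w j))) (ℤ.+-identityʳ (H i j ℤ.* N))))) ⟫

module _ {m n : ℕ} (S : PathSystem m n) {μ : Subset n} (M : Marking S μ) where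
  open PathSystem S
  open Blocks S M

  -- Isolates what `rank` must satisfy, since the dimension count needs a whole family of such
  -- functions.
  record Weight (w : Fin n → ℕ) : Set where
    field
      weight-~     : ∀ {i j} → i ~ j → w i ≡ w j
      weight-right : ∀ {i j} → prefLex (path (top i)) (path (top j)) → w i < w j

  rank-weight : Weight rank
  rank-weight = record { weight-~ = rank-~ ; weight-right = λ {i} {j} → rank-mono {i} {j} }

  weight⇒compatible : ∀ {w} N' → (∀ i → w i < suc N') → Weight w → Compatible S M (perturbed N' (height S) w)
  weight⇒compatible {w} N' w< W = record
    { edge-gap = λ {i} {s} {j} i∈ c → perturbed-tie≡ N' (height S) w< (m+s-m (height S j) s (child-height S c))
        (weight-~ (inj₂ (down stay i∈ c)))
    ; before = λ {i} {j} {s} _ → before {i} {j} {s}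
    ; after = λ {i} {j} {s} _ → after {i} {j} {s}
    }
    where
    open Weight W
    x : Point n
    x = perturbed N' (height S) w
    tie : ∀ {i j s} → height S i ≡ height S j + s → heightGap S i j ≡ + s
    tie {i} {j} {s} e = m+s-m (height S j) s e
    before : ∀ {i j s} → ¬ (i ~ j) → path i ≺ (path j ++ [ s ]) → GapLt x i j (+ s)
    before {i} {j} {s} ¬p (inj₁ h) = perturbed-< N' (height S) w< (subst (heightGap S i j ℤ.<_) (lem (+ height S j) (+ s))
      (ℤ.+-monoˡ-< (ℤ.- + height S j) (ℤ.+<+ (subst (height S i <_) (drift-snoc (path j) s) h))))
      where
      lem : ∀ a b → (a ℤ.+ b) ℤ.- a ≡ b
      lem = ℤSolver.solve-∀
    before {i} {j} {s} ¬p k@(inj₂ (e , h)) = perturbed-tie< N' (height S) w< (tie {i} {j} e')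
      (weight-right {i} {j} (proj₁ (order-by-tops e' ¬p) k))
      where
      e' : height S i ≡ height S j + s
      e' = trans e (drift-snoc (path j) s)
    after : ∀ {i j s} → ¬ (i ~ j) → path i ⪰ (path j ++ [ s ]) → GapLt x j i (ℤ.- + s)
    after {i} {j} {s} ¬p k with ℕ.m≤n⇒m<n∨m≡n (subst (_≤ height S i) (drift-snoc (path j) s) (⪰⇒drift≥ k))
    ... | inj₁ h = perturbed-< N' (height S) w< (subst (heightGap S j i ℤ.<_) (lem (+ height S j) (+ s))
      (ℤ.+-monoʳ-< (+ height S j) (ℤ.neg-mono-< (ℤ.+<+ h))))
      where
      lem : ∀ a b → a ℤ.- (a ℤ.+ b) ≡ ℤ.- b
      lem = ℤSolver.solve-∀
    ... | inj₂ e = perturbed-tie< N' (height S) w< (trans (sym (neg-minus (+ height S i) (+ height S j)))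
          (cong ℤ.-_ (tie {i} {j} (sym e)))) (weight-right {j} {i} (proj₂ (order-by-tops (sym e) ¬p) k))

  rank<n : ∀ i → rank i < suc n
  rank<n i = s≤s (subst (rank i ≤_) (List.length-tabulate id) (count≤length (λ l → pl? (path l) (path (top i))) (allFin n)))

  treePoint : Point n
  treePoint = perturbed n (height S) rank

  treePoint-compatible : Compatible S M treePoint
  treePoint-compatible = weight⇒compatible n rank<n rank-weight

-- Dimension

module _ where
  open ≡-Reasoning

  sumℚ-cong : ∀ k {f g : Fin k → ℚ} → (∀ i → f i ≡ g i) → sumℚ k f ≡ sumℚ k g
  sumℚ-cong zero e = refl
  sumℚ-cong (suc k) e = cong₂ ℚ._+_ (e Fin.zero) (sumℚ-cong k (e ∘ Fin.suc))

  sumℚ-zero : ∀ k {f : Fin k → ℚ} → (∀ i → f i ≡ ℚ.0ℚ) → sumℚ k f ≡ ℚ.0ℚ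
  sumℚ-zero zero e = refl
  sumℚ-zero (suc k) e = cong₂ ℚ._+_ (e Fin.zero) (sumℚ-zero k (e ∘ Fin.suc))

  sumℚ-single : ∀ k {f : Fin k → ℚ} i → (∀ j → j ≢ i → f j ≡ ℚ.0ℚ) → sumℚ k f ≡ f i
  sumℚ-single (suc k) {f} Fin.zero e = trans (cong (f Fin.zero ℚ.+_) (sumℚ-zero k λ j → e (Fin.suc j) λ ())) (ℚ.+-identityʳ _)
  sumℚ-single (suc k) {f} (Fin.suc i) e = trans (cong₂ ℚ._+_ (e Fin.zero λ ())
    (sumℚ-single k i λ j j≢i → e (Fin.suc j) (j≢i ∘ Fin.suc-injective))) (ℚ.+-identityˡ _)

  -- The coefficient given to the pivot `b` is the one that turns a relation between the reduced
  -- vectors into a relation between the original ones.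
  sumℚ-eliminate : ∀ k (c a v : Fin k → ℚ) b →
    ℚ.- sumℚ k (λ j → c j ℚ.* a j) ℚ.* b ℚ.+ sumℚ k (λ j → c j ℚ.* v j) ≡ sumℚ k (λ j → c j ℚ.* (v j ℚ.- a j ℚ.* b))
  sumℚ-eliminate zero c a v b = trans (cong (ℚ._+ ℚ.0ℚ) (ℚ.*-zeroˡ b)) refl
  sumℚ-eliminate (suc k) c a v b = trans
    (lem (c Fin.zero) (a Fin.zero) (v Fin.zero) b (sumℚ k (λ j → c (Fin.suc j) ℚ.* a (Fin.suc j))) (sumℚ k (λ j → c (Fin.suc j) ℚ.* v (Fin.suc j))))
    (cong (c Fin.zero ℚ.* (v Fin.zero ℚ.- a Fin.zero ℚ.* b) ℚ.+_) (sumℚ-eliminate k (c ∘ Fin.suc) (a ∘ Fin.suc) (v ∘ Fin.suc) b))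
    where
    open ℚSolver.+-*-Solver
    lem : ∀ c a v b s t → ℚ.- (c ℚ.* a ℚ.+ s) ℚ.* b ℚ.+ (c ℚ.* v ℚ.+ t) ≡ c ℚ.* (v ℚ.- a ℚ.* b) ℚ.+ (ℚ.- s ℚ.* b ℚ.+ t)
    lem = solve 6 (λ c a v b s t → (:- (c :* a :+ s)) :* b :+ (c :* v :+ t) := c :* (v :- a :* b) :+ ((:- s) :* b :+ t)) refl

  -- Gaussian elimination with the first vector as pivot, unless that vector is zero.
  dependent : ∀ d (u : Fin (suc d) → Fin d → ℚ) → Σ (Fin (suc d) → ℚ) λ c →
    (Σ (Fin (suc d)) λ i → c i ≢ ℚ.0ℚ) × (∀ k → sumℚ (suc d) (λ l → c l ℚ.* u l k) ≡ ℚ.0ℚ)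
  dependent zero u = (λ _ → ℚ.1ℚ) , (Fin.zero , λ ()) , λ ()
  dependent (suc d) u with Fin.any? (λ k → ¬? (u Fin.zero k ℚ.≟ ℚ.0ℚ))
  ... | no none = unit , (Fin.zero , λ ()) , λ k → trans (sumℚ-single (suc (suc d)) Fin.zero (others k)) (first k)
    where
    unit : Fin (suc (suc d)) → ℚ
    unit Fin.zero = ℚ.1ℚ
    unit (Fin.suc _) = ℚ.0ℚ
    others : ∀ k j → j ≢ Fin.zero → unit j ℚ.* u j k ≡ ℚ.0ℚ
    others k Fin.zero h = ⊥-elim (h refl)
    others k (Fin.suc j) _ = ℚ.*-zeroˡ (u (Fin.suc j) k)
    first : ∀ k → ℚ.1ℚ ℚ.* u Fin.zero k ≡ ℚ.0ℚ
    first k with u Fin.zero k ℚ.≟ ℚ.0ℚ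
    ... | yes e = trans (ℚ.*-identityˡ _) e
    ... | no ne = ⊥-elim (none (k , ne))
  ... | yes (k , u≢0) = extend (dependent d reduced)
    where
    instance
      pivot-nonZero : ℚ.NonZero (u Fin.zero k)
      pivot-nonZero = ℚ.≢-nonZero u≢0
    a : Fin (suc d) → ℚ
    a j = u (Fin.suc j) k ℚ.* (ℚ.1/ u Fin.zero k)
    reduced : Fin (suc d) → Fin d → ℚ
    reduced j κ = u (Fin.suc j) (Fin.punchIn k κ) ℚ.- a j ℚ.* u Fin.zero (Fin.punchIn k κ)
    pivot : ∀ j → u (Fin.suc j) k ℚ.- a j ℚ.* u Fin.zero k ≡ ℚ.0ℚ
    pivot j = begin
      u (Fin.suc j) k ℚ.- a j ℚ.* u Fin.zero k   ≡⟨ cong (λ z → u (Fin.suc j) k ℚ.- z) (ℚ.*-assoc (u (Fin.suc j) k) _ _) ⟩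
      u (Fin.suc j) k ℚ.- u (Fin.suc j) k ℚ.* ((ℚ.1/ u Fin.zero k) ℚ.* u Fin.zero k)
        ≡⟨ cong (λ z → u (Fin.suc j) k ℚ.- u (Fin.suc j) k ℚ.* z) (ℚ.*-inverseˡ (u Fin.zero k)) ⟩
      u (Fin.suc j) k ℚ.- u (Fin.suc j) k ℚ.* ℚ.1ℚ  ≡⟨ cong (λ z → u (Fin.suc j) k ℚ.- z) (ℚ.*-identityʳ _) ⟩
      u (Fin.suc j) k ℚ.- u (Fin.suc j) k        ≡⟨ ℚ.+-inverseʳ (u (Fin.suc j) k) ⟩
      ℚ.0ℚ                                       ∎
    extend : (Σ (Fin (suc d) → ℚ) λ c → (Σ (Fin (suc d)) λ i → c i ≢ ℚ.0ℚ) ×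
               (∀ κ → sumℚ (suc d) (λ l → c l ℚ.* reduced l κ) ≡ ℚ.0ℚ)) →
             Σ (Fin (suc (suc d)) → ℚ) λ c → (Σ (Fin (suc (suc d))) λ i → c i ≢ ℚ.0ℚ) ×
               (∀ κ → sumℚ (suc (suc d)) (λ l → c l ℚ.* u l κ) ≡ ℚ.0ℚ)
    extend (c , (i , ci≢0) , zero-sum) = c⁺ , (Fin.suc i , ci≢0) , λ κ →
        trans (sumℚ-eliminate (suc d) c a (λ j → u (Fin.suc j) κ) (u Fin.zero κ)) (coordinate κ)
      where
      c⁺ : Fin (suc (suc d)) → ℚ
      c⁺ Fin.zero = ℚ.- sumℚ (suc d) (λ j → c j ℚ.* a j)
      c⁺ (Fin.suc j) = c j
      coordinate : ∀ κ → sumℚ (suc d) (λ j → c j ℚ.* (u (Fin.suc j) κ ℚ.- a j ℚ.* u Fin.zero κ)) ≡ ℚ.0ℚ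
      coordinate κ with k Fin.≟ κ
      ... | yes refl = sumℚ-zero (suc d) λ j → trans (cong (c j ℚ.*_) (pivot j)) (ℚ.*-zeroʳ (c j))
      ... | no k≢κ = subst (λ κ → sumℚ (suc d) (λ j → c j ℚ.* (u (Fin.suc j) κ ℚ.- a j ℚ.* u Fin.zero κ)) ≡ ℚ.0ℚ)
                       (Fin.punchIn-punchOut k≢κ) (zero-sum (Fin.punchOut k≢κ))

enumerate : ∀ {n} (p : Subset n) → Fin ∣ p ∣ → Fin n
enumerate (true ∷ p) Fin.zero = Fin.zero
enumerate (true ∷ p) (Fin.suc k) = Fin.suc (enumerate p k)
enumerate (false ∷ p) k = Fin.suc (enumerate p k)

enumerate-∈ : ∀ {n} (p : Subset n) k → enumerate p k ∈ p
enumerate-∈ (true ∷ p) Fin.zero = Vec.here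
enumerate-∈ (true ∷ p) (Fin.suc k) = Vec.there (enumerate-∈ p k)
enumerate-∈ (false ∷ p) k = Vec.there (enumerate-∈ p k)

enumerate-injective : ∀ {n} (p : Subset n) {k l} → enumerate p k ≡ enumerate p l → k ≡ l
enumerate-injective (true ∷ p) {Fin.zero} {Fin.zero} e = refl
enumerate-injective (true ∷ p) {Fin.suc k} {Fin.suc l} e = cong Fin.suc (enumerate-injective p (Fin.suc-injective e))
enumerate-injective (false ∷ p) e = enumerate-injective p (Fin.suc-injective e)

enumerate-surjective : ∀ {n} (p : Subset n) {i} → i ∈ p → Σ (Fin ∣ p ∣) λ k → enumerate p k ≡ i
enumerate-surjective (true ∷ p) Vec.here = Fin.zero , refl
enumerate-surjective (true ∷ p) (Vec.there i∈) with enumerate-surjective p i∈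
... | k , refl = Fin.suc k , refl
enumerate-surjective (false ∷ p) (Vec.there i∈) with enumerate-surjective p i∈
... | k , refl = k , refl

module _ {m n : ℕ} (S : PathSystem m n) {μ : Subset n} (M : Marking S μ) where
  open PathSystem S
  open Blocks S M

  private
    d : ℕ
    d = ∣ ∁ μ ∣

    e : Fin d → Fin n
    e = enumerate (∁ μ)

    e-unmarked : ∀ k → e k ∉ μ
    e-unmarked k = Subset.x∈∁p⇒x∉p (enumerate-∈ (∁ μ) k)

    indicator : ∀ {A : Set} → Dec A → ℕ
    indicator (yes _) = 1
    indicator (no _) = 0

    indicator≤1 : ∀ {A : Set} (a : Dec A) → indicator a ≤ 1
    indicator≤1 (yes _) = ℕ.≤-refl
    indicator≤1 (no _) = z≤n

    -- Doubled ranks leave room to add 1 on a single block without reaching the next one. Since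
    -- ranks are at most `n`, the raised values are at most `suc (2 * n)`, which is the choice of
    -- `N`.
    base : Fin n → ℕ
    base i = 2 * rank i

    raised : Fin d → Fin n → ℕ
    raised k i = indicator (top i Fin.≟ e k) + base i

    base<raised : ∀ k {i j} → rank i < rank j → raised k i < raised k j
    base<raised k {i} {j} h = ℕ.<-≤-trans
      (s≤s (ℕ.+-monoˡ-≤ (base i) (indicator≤1 (top i Fin.≟ e k))))
      (ℕ.≤-trans (subst (_≤ base j) (ℕ.*-suc 2 (rank i)) (ℕ.*-monoʳ-≤ 2 h)) (ℕ.m≤n+m (base j) (indicator (top j Fin.≟ e k))))

    base-weight : Weight S M base
    base-weight = record
      { weight-~ = λ p → cong (2 *_) (rank-~ p)
      ; weight-right = λ {i} {j} h → ℕ.*-monoʳ-< 2 (rank-mono {i} {j} h) }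

    raised-weight : ∀ k → Weight S M (raised k)
    raised-weight k = record
      { weight-~ = λ {i} {j} p → cong₂ _+_ (cong (λ t → indicator (t Fin.≟ e k)) (~⇒top≡ p)) (cong (2 *_) (rank-~ p))
      ; weight-right = λ {i} {j} h → base<raised k {i} {j} (rank-mono {i} {j} h) }

    N : ℕ
    N = suc (2 * n)

    base< : ∀ i → base i < suc N
    base< i = s≤s (ℕ.m≤n⇒m≤1+n (ℕ.*-monoʳ-≤ 2 (ℕ.s≤s⁻¹ (rank<n S M i))))

    raised< : ∀ k i → raised k i < suc N
    raised< k i = s≤s (ℕ.+-mono-≤ (indicator≤1 (top i Fin.≟ e k)) (ℕ.*-monoʳ-≤ 2 (ℕ.s≤s⁻¹ (rank<n S M i))))

    P : Fin (suc d) → Point n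
    P Fin.zero = perturbed N (height S) base
    P (Fin.suc k) = perturbed N (height S) (raised k)

    P-diff : ∀ k i → P (Fin.suc k) i ℚ.- P Fin.zero i ≡ ι (+ indicator (top i Fin.≟ e k)) ℚ.* scale N
    P-diff k i = trans (perturbed-diff N (height S) base (raised k) i)
      (cong (λ z → ι z ℚ.* scale N) (lem (+ indicator (top i Fin.≟ e k)) (+ base i)))
      where
      lem : ∀ a b → (a ℤ.+ b) ℤ.- b ≡ a
      lem = ℤSolver.solve-∀

    indicator-self : ∀ k → indicator (top (e k) Fin.≟ e k) ≡ 1
    indicator-self k with top (e k) Fin.≟ e k
    ... | yes _ = refl
    ... | no ne = ⊥-elim (ne (top-fix (e-unmarked k)))

    indicator-other : ∀ k l → l ≢ k → indicator (top (e k) Fin.≟ e l) ≡ 0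
    indicator-other k l l≢k with top (e k) Fin.≟ e l
    ... | no _ = refl
    ... | yes h = ⊥-elim (l≢k (enumerate-injective (∁ μ) (trans (sym h) (top-fix (e-unmarked k)))))

  -- The unmarked nodes are the tops of the blocks. Raising one block at a time gives difference
  -- vectors which, read at the coordinates of the tops, form `scale N` times the identity matrix.
  compatible-points : Σ (Fin (suc ∣ ∁ μ ∣) → Point n) λ p → (∀ i → Compatible S M (p i)) × AffIndep ∣ ∁ μ ∣ p
  compatible-points = P , (λ { Fin.zero → weight⇒compatible S M N base< base-weight
                             ; (Fin.suc k) → weight⇒compatible S M N (raised< k) (raised-weight k) }) , independent
    where
    independent : AffIndep d P
    independent c vanish k = scale-cancel N (c k) (begin
      c k ℚ.* scale N                                   ≡⟨ cong (c k ℚ.*_) (ℚ.*-identityˡ (scale N)) ⟨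
      c k ℚ.* (ι (+ 1) ℚ.* scale N)                     ≡⟨ cong (λ z → c k ℚ.* (ι (+ z) ℚ.* scale N)) (indicator-self k) ⟨
      c k ℚ.* (ι (+ indicator (top (e k) Fin.≟ e k)) ℚ.* scale N)   ≡⟨ cong (c k ℚ.*_) (P-diff k (e k)) ⟨
      c k ℚ.* (P (Fin.suc k) (e k) ℚ.- P Fin.zero (e k))            ≡⟨ sumℚ-single d k others ⟨
      sumℚ d (λ l → c l ℚ.* (P (Fin.suc l) (e k) ℚ.- P Fin.zero (e k)))    ≡⟨ vanish (e k) ⟩
      ℚ.0ℚ                                              ∎)
      where
      open ≡-Reasoning
      others : ∀ l → l ≢ k → c l ℚ.* (P (Fin.suc l) (e k) ℚ.- P Fin.zero (e k)) ≡ ℚ.0ℚ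
      others l l≢k = begin
        c l ℚ.* (P (Fin.suc l) (e k) ℚ.- P Fin.zero (e k))  ≡⟨ cong (c l ℚ.*_) (P-diff l (e k)) ⟩
        c l ℚ.* (ι (+ indicator (top (e k) Fin.≟ e l)) ℚ.* scale N)
          ≡⟨ cong (λ z → c l ℚ.* (ι (+ z) ℚ.* scale N)) (indicator-other k l l≢k) ⟩
        c l ℚ.* (ι (+ 0) ℚ.* scale N)                       ≡⟨ cong (c l ℚ.*_) (ℚ.*-zeroˡ (scale N)) ⟩
        c l ℚ.* ℚ.0ℚ                                        ≡⟨ ℚ.*-zeroʳ (c l) ⟩
        ℚ.0ℚ                                                ∎

  -- Gaps inside a block are fixed, so a difference of two points is determined by its coordinates
  -- at the tops. There is one more difference vector than there are tops, and `dependent` supplies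
  -- a relation.
  blocks-dependent : (p : Fin (suc (suc ∣ ∁ μ ∣)) → Point n) →
    (∀ l {i j} → i ~ j → GapEq (p l) i j (heightGap S i j)) → ¬ AffIndep (suc ∣ ∁ μ ∣) p
  blocks-dependent p gaps indep with dependent d (λ l k → p (Fin.suc l) (e k) ℚ.- p Fin.zero (e k))
  ... | c , (i , ci≢0) , vanish = ci≢0 (indep c everywhere i)
    where
    same-diff : ∀ l r → p (Fin.suc l) r ℚ.- p Fin.zero r ≡ p (Fin.suc l) (top r) ℚ.- p Fin.zero (top r)
    same-diff l r = begin
      a ℚ.- b                                    ≡⟨ regroup a b a' b' ⟩
      ((a ℚ.- a') ℚ.- (b ℚ.- b')) ℚ.+ (a' ℚ.- b')  ≡⟨ cong (λ z → (z ℚ.- (b ℚ.- b')) ℚ.+ (a' ℚ.- b'))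
                                                     (trans (gap≡ (gaps (Fin.suc l) t~r)) (sym (gap≡ (gaps Fin.zero t~r)))) ⟩
      ((b ℚ.- b') ℚ.- (b ℚ.- b')) ℚ.+ (a' ℚ.- b')  ≡⟨ cong (ℚ._+ (a' ℚ.- b')) (ℚ.+-inverseʳ (b ℚ.- b')) ⟩
      ℚ.0ℚ ℚ.+ (a' ℚ.- b')                         ≡⟨ ℚ.+-identityˡ _ ⟩
      a' ℚ.- b'                                  ∎
      where
      open ≡-Reasoning
      t~r : r ~ top r
      t~r = inj₂ (top-↓ r)
      a b a' b' : ℚ
      a = p (Fin.suc l) r
      b = p Fin.zero r
      a' = p (Fin.suc l) (top r)
      b' = p Fin.zero (top r)
      regroup : ∀ a b a' b' → a ℚ.- b ≡ ((a ℚ.- a') ℚ.- (b ℚ.- b')) ℚ.+ (a' ℚ.- b')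
      regroup = solve 4 (λ a b a' b' → a :- b := ((a :- a') :- (b :- b')) :+ (a' :- b')) refl
        where open ℚSolver.+-*-Solver
    everywhere : ∀ r → sumℚ (suc d) (λ l → c l ℚ.* (p (Fin.suc l) r ℚ.- p Fin.zero r)) ≡ ℚ.0ℚ
    everywhere r with enumerate-surjective (∁ μ) (Subset.x∉p⇒x∈∁p (top-unmarked r))
    ... | k , ek≡ = trans (sumℚ-cong (suc d) λ l → cong (c l ℚ.*_)
            (trans (same-diff l r) (cong (λ t → p (Fin.suc l) t ℚ.- p Fin.zero t) (sym ek≡)))) (vanish k)

module _ {m n : ℕ} (A : Arr m n) {T : Tree m n} {S : PathSystem m n} (R : Represents T S) {μ : Subset n} (M : Marking S μ) where

  Φ-codim : Codim (Φ A T μ) ∣ μ ∣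
  Φ-codim = ∣ ∁ μ ∣ ,
    ((let (p , comp , indep) = compatible-points S M in p , (λ i → inΦ⇒Φ R (compatible⇒inΦ {M = M} {A} (comp i))) , indep) ,
     λ p inF → blocks-dependent S M p λ l → block-gap {M = M} (InΦ.edge-gap (Φ⇒inΦ {M = M} R {A} (inF l)))) ,
    trans (cong (ℕ._+_ ∣ μ ∣) (Subset.∣∁p∣≡n∸∣p∣ μ)) (ℕ.m+[n∸m]≡n (Subset.∣p∣≤n μ))

-- Crossing hyperplanes

abstract
  +m-n : ∀ {a b} → b ≤ a → + a ℤ.- + b ≡ + (a ∸ b)
  +m-n {a} {b} b≤a = trans (cong (λ z → + z ℤ.- + b) (sym (ℕ.m+[n∸m]≡n b≤a))) (lem (+ b) (+ (a ∸ b)))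
    where
    lem : ∀ b c → (b ℤ.+ c) ℤ.- b ≡ c
    lem = ℤSolver.solve-∀

inA? : ∀ {m n} (A : Arr m n) i j d → Dec (InA A i j d)
inA? A i j d = Arr.mem A i j d Bool.≟ true

module _ {m n : ℕ} {S : PathSystem m n} where
  open PathSystem S

  -- Strong transitivity read contrapositively. The heights must decrease from `i` over `j` to `k`,
  -- because it speaks only of natural gaps.
  split-inA : ∀ (A : Arr m n) → StronglyTransitive A → ∀ {i j k} → i ≢ j → j ≢ k →
    height S j ≤ height S i → height S k ≤ height S j → InA A i k (heightGap S i k) →
    InA A i j (heightGap S i j) ⊎ InA A j k (heightGap S j k)
  split-inA A st {i} {j} {k} i≢j j≢k j≤i k≤j a
    with inA? A i j (heightGap S i j) | inA? A j k (heightGap S j k)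
  ... | yes b | _ = inj₁ b
  ... | no _ | yes b = inj₂ b
  ... | no ¬b | no ¬c = ⊥-elim (st i j k i≢j j≢k (inA-≢ A a) (height S i ∸ height S j) (height S j ∸ height S k)
      (¬b ∘ subst (InA A i j) (sym (+m-n j≤i))) (¬c ∘ subst (InA A j k) (sym (+m-n k≤j)))
      (subst (InA A i k) (trans (sym (telescope (+ height S i) (+ height S j) (+ height S k)))
        (cong₂ ℤ._+_ (+m-n j≤i) (+m-n k≤j))) a))

  child-longer : ∀ {i s k} → Child S i s k → length (path k) < length (path i)
  child-longer {i} {s} {k} c = subst (length (path k) <_)
    (sym (trans (cong length c) (length-snoc (path k) s))) ℕ.≤-refl

  child-prefix : ∀ {i s k} → Child S i s k → IsPrefix (path k) (path i)
  child-prefix c = [ _ ] , sym c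

  child-not-above : ∀ {i s k} → Child S i s k → ¬ IsPrefix (path i) (path k)
  child-not-above {i} {s} {k} c h =
    ℕ.<-irrefl (cong length (prefix-antisym (child-prefix c) h)) (child-longer c)

  cadet-unique : ∀ {i j s t k} → Cadet S i s k → Cadet S j t k → i ≡ j
  cadet-unique {i} {j} {s} {t} (c , last) (c' , last') with ℕ.<-cmp s t
  ... | tri< h _ _ = ⊥-elim (last t j h c')
  ... | tri≈ _ refl _ = path-injective (trans c (sym c'))
  ... | tri> _ _ h = ⊥-elim (last' s i h c)

  cadet-beyond : ∀ {i s k} → Child S i s k → Σ (Fin n) λ c → Σ ℕ λ t → s ≤ t × Cadet S c t k
  cadet-beyond {i} {s} {k} = go i s (<-wellFounded (m ∸ s))
    where
    child? : ∀ t l → Dec (Child S l t k)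
    child? t l = path l ≟ᵖ (path k ++ [ t ])
    go : ∀ i s → Acc _<_ (m ∸ s) → Child S i s k → Σ (Fin n) λ c → Σ ℕ λ t → s ≤ t × Cadet S c t k
    go i s (acc rec) c with Fin.any? {n = suc m} (λ f → (s ℕ.<? toℕ f) ×-dec Fin.any? (child? (toℕ f)))
    ... | yes (f , s<t , l , c') with go l (toℕ f) (rec (ℕ.∸-monoʳ-< s<t (Fin.toℕ≤pred[n] f))) c'
    ...   | b , t , le , cad = b , t , ℕ.≤-trans (ℕ.<⇒≤ s<t) le , cad
    go i s (acc rec) c | no none = i , s , ℕ.≤-refl , c , λ t l s<t c' →
      none (Fin.fromℕ< (s≤s (path-bound c')) ,
        subst (λ t → s < t × Σ (Fin n) λ l → Child S l t k) (sym (Fin.toℕ-fromℕ< (s≤s (path-bound c')))) (s<t , l , c'))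

module _ {m n : ℕ} {S : PathSystem m n} {μ : Subset n} (M : Marking S μ) where
  open Blocks S M

  unmarked-child : ∀ {i s k} → i ∉ μ → Child S i s k → ¬ (i ~ k)
  unmarked-child i∉ c (inj₁ p) = child-not-above {S = S} c (↓-prefix p)
  unmarked-child i∉ c (inj₂ p) with unmarked-↓ p i∉
  ... | refl = child-not-above {S = S} c prefix-refl

module _ {m n : ℕ} (S : PathSystem m n) {μ : Subset n} (M : Marking S μ) (A : Arr m n) where
  open PathSystem S
  open Blocks S M

  Crossing : Fin n → Fin n → Set
  Crossing h k = Σ (Fin n) λ s → Σ (Fin n) λ u → h ↓ s × u ↓ k × InA A s u (heightGap S s u)

  Crossed : Set
  Crossed = ∀ {h t k} → Cadet S h t k → (t ≡ 0 × h Fin.< k × h ∉ μ) ⊎ Crossing h k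

module _ {m n : ℕ} {A : Arr m n} {T : Tree m n} {S : PathSystem m n} (R : Represents T S)
         {μ : Subset n} (M : Marking S μ) where
  open PathSystem S
  open Blocks S M

  -- For a marked edge, a walk of links from `h` to `k` must leave the part of the block below `h`,
  -- and the link by which it leaves is the crossing. For an unmarked edge, `h` is the top of its
  -- block and `k` the bottom of its own, its only cadet being `h`; so the witnesses of the cadet
  -- condition already lie on the right sides.
  mtree⇒crossed : AConnected A T μ → CadetCond A T μ → Crossed S M A
  mtree⇒crossed ac cc {h} {t} {k} cad with h Subset.∈? μ
  ... | yes h∈ = inj₂ (cross stay (aConnected⇒connected A R M ac (inj₂ (down stay h∈ (proj₁ cad)))))
    where
    cross : ∀ {a} → h ↓ a → Star (Linked S M A) a k → Crossing S M A h k
    cross p ε = ⊥-elim (child-not-above {S = S} (proj₁ cad) (↓-prefix p))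
    cross {a} p (_◅_ {j = b} (a~b , l) ls) with h ↓? b
    ... | yes q = cross q ls
    ... | no ¬q with ~-trans (inj₁ p) a~b
    ...   | inj₁ q = ⊥-elim (¬q q)
    ...   | inj₂ stay = ⊥-elim (¬q stay)
    ...   | inj₂ (down q _ c) with child-unique S c (proj₁ cad)
    ...     | refl , refl = a , b , p , q , l
  ... | no h∉ with cc h t k (cadet⇒cadetOf R cad) h∉
  ...   | inj₁ (e , h<k) = inj₁ (e , h<k , h∉)
  ...   | inj₂ (s , u , bs , bu , d) = inj₂ (s , u , below , above (sameBlock⇒~ R M bu) , driftIn⇒inA A R d)
    where
    below : h ↓ s
    below = subst (_↓ s) (trans (~⇒top≡ (sameBlock⇒~ R M bs)) (top-fix h∉)) (top-↓ s)
    above : u ~ k → u ↓ k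
    above (inj₁ q) = q
    above (inj₂ q) with ↓-front q
    ... | inj₁ refl = stay
    ... | inj₂ (c , _ , c∈ , e , _) with cadet-unique {S = S} cad (proj₁ (marked-cadet c∈ e))
    ...   | refl = ⊥-elim (h∉ c∈)

  crossed⇒cadetCond : Crossed S M A → CadetCond A T μ
  crossed⇒cadetCond cr i s j cad i∉ with cr (cadetOf⇒cadet R cad)
  ... | inj₁ (e , i<j , _) = inj₁ (e , i<j)
  ... | inj₂ (a , b , p , q , l) =
    inj₂ (a , b , ~⇒sameBlock R M (inj₂ p) , ~⇒sameBlock R M (inj₁ q) , inA⇒driftIn A R l)

  linked-sym : ∀ {i j} → Linked S M A i j → Linked S M A j i
  linked-sym {i} {j} (p , a) = ~-sym p , subst (InA A j i) (neg-minus (+ height S i) (+ height S j)) (inA-swap A a)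

  linked-reverse : ∀ {i j} → Star (Linked S M A) i j → Star (Linked S M A) j i
  linked-reverse ε = ε
  linked-reverse (l ◅ ls) = linked-reverse ls ◅◅ (linked-sym l ◅ ε)

  -- A crossing links some `s` below a marked edge to some `u` above it. By strong transitivity
  -- every node of the chain between them is linked to `s` or to `u`; this holds for both ends of
  -- the edge, so they are connected through `s`.
  crossed⇒connected : StronglyTransitive A → Crossed S M A → Connected S M A
  crossed⇒connected st cr (inj₁ p) = linked-reverse (descend p)
    where
    between : ∀ {s c u} → u ↓ c → c ↓ s → InA A s u (heightGap S s u) → Star (Linked S M A) c s
    between {s} {c} {u} p q a with c Fin.≟ s | c Fin.≟ u
    ... | yes refl | _ = ε
    ... | no _ | yes refl = linked-sym (inj₂ q , a) ◅ ε
    ... | no c≢s | no c≢u with split-inA {S = S} A st (c≢s ∘ sym) c≢u (↓-height q) (↓-height p) a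
    ...   | inj₁ b = linked-sym (inj₂ q , b) ◅ ε
    ...   | inj₂ b = (inj₂ p , b) ◅ linked-sym (inj₂ (↓-trans p q) , a) ◅ ε
    edge : ∀ {i s j} → i ∈ μ → Child S i s j → Star (Linked S M A) i j
    edge i∈ c with marked-cadet i∈ c
    ... | cad , zero-label with cr cad
    ...   | inj₁ (_ , _ , i∉) = ⊥-elim (i∉ i∈)
    ...   | inj₂ (s , u , p , q , a) = between (down q i∈ c) p a ◅◅ linked-reverse (between q (↓-trans (down stay i∈ c) p) a)
    descend : ∀ {i j} → i ↓ j → Star (Linked S M A) j i
    descend stay = ε
    descend (down p i∈ c) = edge i∈ c ◅◅ descend p
  crossed⇒connected st cr (inj₂ p) = linked-reverse (crossed⇒connected st cr (inj₁ p))

prefix⇒⪰ : ∀ {p q} → IsPrefix q p → drift q ≡ drift p → p ⪰ q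
prefix⇒⪰ {p} {q} ([] , e) d = inj₂ (trans (sym e) (List.++-identityʳ q))
prefix⇒⪰ {p} {q} (a ∷ u , refl) d = inj₁ (inj₂ (d , pl-prefix q))

prefix⇒pl : ∀ {p q} → IsPrefix p q → p ≢ q → prefLex p q
prefix⇒pl {p} ([] , e) p≢q = ⊥-elim (p≢q (trans (sym (List.++-identityʳ p)) e))
prefix⇒pl {p} (a ∷ u , refl) p≢q = pl-prefix p

-- Injectivity

module Divergence {m n : ℕ} (A : Arr m n) (st : StronglyTransitive A)
    (S : PathSystem m n) {μ : Subset n} (M : Marking S μ)
    (S' : PathSystem m n) {μ' : Subset n} (M' : Marking S' μ')
    {x y : Point n} (sf : SameFace A x y) (C : Compatible S M x) (C' : Compatible S' M' y)
    (conn' : Connected S' M' A) (cr' : Crossed S' M' A) where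

  open PathSystem S using (path; path-injective)
  open Blocks S M using (_~_; _~?_; ↓-prefix; ↓-height; ↓-label)
  open PathSystem S' using () renaming (path to path')
  open Blocks S' M' using () renaming (_↓_ to _↓'_; _~_ to _~'_)
  private
    module S' = PathSystem S'
    module B' = Blocks S' M'
    module C = Compatible C
    module C' = Compatible C'
    H H' : Fin n → Fin n → ℤ
    H = heightGap S
    H' = heightGap S'
    h' : Fin n → ℕ
    h' = height S'

    -- `x` is compatible only with the unprimed tree, but it lies in the face of `y`, so
    -- connectedness makes the primed blocks rigid at `x` too.
    gap-x : ∀ {i j} → i ~' j → GapEq x i j (H' i j)
    gap-x = block-gap {M = M'} (InΦ.edge-gap (sameFace⇒inΦ {M = M'} {A} {x} {y} conn' sf (compatible⇒inΦ {M = M'} {A} C')))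

    gap-y : ∀ {i j} → i ~' j → GapEq y i j (H' i j)
    gap-y = block-gap {M = M'} C'.edge-gap

    H'-child : ∀ {i k t} → h' i ≡ h' k + t → H' i k ≡ + t
    H'-child {i} {k} {t} e = m+s-m (h' k) t e

    H'-swap : ∀ i j → ℤ.- H' i j ≡ H' j i
    H'-swap i j = neg-minus (+ h' i) (+ h' j)

    H'-sum : ∀ i j k → H' i j ℤ.+ H' j k ≡ H' i k
    H'-sum i j k = telescope (+ h' i) (+ h' j) (+ h' k)

  -- In the primed tree, i lies on the chain of 0-children below h, and h is a child of k.
  -- If x puts i below the place the primed tree gives it, h must be an unmarked 0-cadet
  -- with a smaller label: otherwise the hyperplane crossing the cadet edge of k splits at i,
  -- by strong transitivity, into two hyperplanes that cannot be in A.
  step : ∀ {i h k t} → Child S' h t k → IsPrefix (path' h) (path' i) → h' h ≡ h' i →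
         ¬ (i ~' k) → GapLe x i k (+ t) → t ≡ 0 × h Fin.< k
  step {i} {h} {k} {t} c h⊑i hi ¬i~k x-ik = from-crossing (cadet-beyond {S = S'} c)
    where
    hik : h' i ≡ h' k + t
    hik = trans (sym hi) (child-height S' c)
    t≤m : t ≤ m
    t≤m = S'.path-bound c
    y-ki : GapLt y k i (H' k i)
    y-ki = subst (GapLt y k i) (trans (cong ℤ.-_ (sym (H'-child hik))) (H'-swap i k))
      (C'.after t≤m ¬i~k (subst (path' i ⪰_) c (prefix⇒⪰ h⊑i hi)))
    from-crossing : (Σ (Fin n) λ k₁ → Σ ℕ λ t₁ → t ≤ t₁ × Cadet S' k₁ t₁ k) → t ≡ 0 × h Fin.< k
    from-crossing (k₁ , t₁ , t≤t₁ , cad) with cr' cad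
    ... | inj₁ (refl , k₁<k , _) = t≡0 , subst (Fin._< k) (S'.path-injective (trans (proj₁ cad)
            (trans (cong (λ z → path' k ++ [ z ]) (sym t≡0)) (sym c)))) k₁<k
      where
      t≡0 : t ≡ 0
      t≡0 = ℕ.n≤0⇒n≡0 t≤t₁
    from-crossing (k₁ , t₁ , t≤t₁ , cad) | inj₂ (s , u , k₁↓s , u↓k , a) = ⊥-elim (contradiction' (i B'.~? k₁))
      where
      hk₁ : h' k₁ ≡ h' k + t₁
      hk₁ = child-height S' (proj₁ cad)
      x-iu : GapLe x i u (H' i u)
      x-iu = le-le (subst (GapLe x i k) (sym (H'-child hik)) x-ik) (inj₂ (gap-x (inj₂ u↓k))) (H'-sum i k u)
      y-k₁i : ¬ (i ~' k₁) → GapLt y k₁ i (H' k₁ i)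
      y-k₁i ¬i~k₁ = subst (GapLt y k₁ i) (sym (m+s-m (h' i) (t₁ ∸ t) e))
        (C'.before (ℕ.≤-trans (ℕ.m∸n≤m t₁ t) (S'.path-bound (proj₁ cad))) (¬i~k₁ ∘ B'.~-sym) ord)
        where
        e : h' k₁ ≡ h' i + (t₁ ∸ t)
        e = trans hk₁ (trans (cong (ℕ._+_ (h' k)) (sym (ℕ.m+[n∸m]≡n t≤t₁)))
          (trans (sym (ℕ.+-assoc (h' k) t _)) (cong (_+ (t₁ ∸ t)) (sym hik))))
        -- The drifts agree. Lexicographically, either `k₁` has the larger letter `t₁` where the
        -- path to `i` has `t`, or `k₁` sits at `h` and its path is a prefix of that of `i`.
        ord : path' k₁ ≺ (path' i ++ [ t₁ ∸ t ])
        ord with ℕ.m≤n⇒m<n∨m≡n t≤t₁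
        ... | inj₁ t<t₁ = inj₂ (trans e (sym (drift-snoc (path' i) _)) ,
              subst₂ prefLex (sym (proj₁ cad)) (trans (sym (List.++-assoc (path' k) [ t ] (v ++ [ t₁ ∸ t ])))
                (trans (cong (_++ (v ++ [ t₁ ∸ t ])) (sym c))
                  (trans (sym (List.++-assoc (path' h) v _)) (cong (_++ [ t₁ ∸ t ]) (proj₂ h⊑i)))))
              (pl-++ (path' k) {[ t₁ ]} {t ∷ v ++ [ t₁ ∸ t ]} (inj₁ t<t₁)))
          where
          v : Path
          v = proj₁ h⊑i
        ... | inj₂ t≡t₁ = inj₂ (trans e (sym (drift-snoc (path' i) _)) ,
              prefix⇒pl (prefix-trans k₁⊑i (prefix-snoc (path' i))) λ q →
                ¬snoc⊑ (subst (λ r → IsPrefix r (path' i)) q k₁⊑i))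
          where
          k₁⊑i : IsPrefix (path' k₁) (path' i)
          k₁⊑i = subst (λ r → IsPrefix r (path' i))
            (trans c (trans (cong (λ z → path' k ++ [ z ]) t≡t₁) (sym (proj₁ cad)))) h⊑i
          ¬snoc⊑ : ¬ IsPrefix (path' i ++ [ t₁ ∸ t ]) (path' i)
          ¬snoc⊑ r = ℕ.<-irrefl (cong length (prefix-antisym (prefix-snoc (path' i)) r))
            (subst (length (path' i) <_) (sym (length-snoc (path' i) _)) ℕ.≤-refl)
      y-kk₁ : GapLe y k k₁ (H' k k₁)
      y-kk₁ with k₁ Subset.∈? μ'
      ... | yes k₁∈ = inj₂ (gap-y (inj₁ (down stay k₁∈ (proj₁ cad))))
      ... | no k₁∉ = inj₁ (subst (GapLt y k k₁) (trans (cong ℤ.-_ (sym (H'-child hk₁))) (H'-swap k₁ k))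
        (C'.after (S'.path-bound (proj₁ cad)) (unmarked-child M' k₁∉ (proj₁ cad)) (inj₂ (proj₁ cad))))
      y-us : GapLe y u s (H' u s)
      y-us = le-le (le-le (inj₂ (gap-y (inj₁ u↓k))) y-kk₁ (H'-sum u k k₁)) (inj₂ (gap-y (inj₁ k₁↓s))) (H'-sum u k₁ s)
      a-us : InA A u s (H' u s)
      a-us = subst (InA A u s) (H'-swap s u) (inA-swap A a)
      x-us : GapLe x u s (H' u s)
      x-us = sameFace-le A {y} {x} (sameFace-sym A {x} {y} sf) a-us y-us
      absurd-ui : GapLt x u i (H' u i) → ⊥
      absurd-ui g = lt-irrefl g (subst (GapLe x i u) (sym (H'-swap u i)) x-iu)
      contradiction' : Dec (i ~' k₁) → ⊥
      -- Here `i` is in the block of `s`. The strict gap from `k` to `i` at `y` becomes a strict gap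
      -- from `u` to `s`, which the crossing hyperplane carries to `x`.
      contradiction' (yes p) = absurd-ui (lt-eq (proj₂ sf a-us y-us<) (gap-x (B'.~-sym i~s)) (H'-sum u s i))
        where
        i~s : i ~' s
        i~s = B'.~-trans p (inj₁ k₁↓s)
        y-us< : GapLt y u s (H' u s)
        y-us< = lt-eq (eq-lt (gap-y (inj₁ u↓k)) y-ki (H'-sum u k i)) (gap-y i~s) (H'-sum u i s)
      -- The height of `i` is between those of `s` and `u`, so the crossing splits at `i`. Either
      -- part transfers a strict inequality from `y` to `x`, which contradicts `x-iu`.
      contradiction' (no ¬p) with split-inA {S = S'} A st s≢i i≢u
          (ℕ.≤-trans (subst₂ _≤_ (sym hik) (sym hk₁) (ℕ.+-monoʳ-≤ (h' k) t≤t₁)) (B'.↓-height k₁↓s))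
          (ℕ.≤-trans (B'.↓-height u↓k) (subst (h' k ≤_) (sym hik) (ℕ.m≤m+n _ t))) a
        where
        s≢i : s ≢ i
        s≢i refl = ¬p (inj₂ k₁↓s)
        i≢u : i ≢ u
        i≢u refl = ¬i~k (inj₁ u↓k)
      ... | inj₁ b = absurd-ui (le-lt x-us (proj₂ sf b
              (eq-lt (gap-y (inj₂ k₁↓s)) (y-k₁i ¬p) (H'-sum s k₁ i))) (H'-sum u s i))
      ... | inj₂ b = absurd-ui (proj₂ sf (subst (InA A u i) (H'-swap i u) (inA-swap A b))
              (eq-lt (gap-y (inj₁ u↓k)) y-ki (H'-sum u k i)))

  module _ {p : Path} (least : ∀ l → path l ≢ path' l → ¬ (path l ≺ p) × ¬ (path' l ≺ p))
           {i : Fin n} (pi : path i ≡ p) (pi' : path' i ≢ p) where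

    private
      climb : ∀ h → Acc _<_ (length (path' h)) → IsPrefix (path' h) (path' i) → h' h ≡ h' i → i Fin.≤ h →
              ¬ (path' h ≺ p) → Σ (Fin n) λ j → path' j ≡ p × i Fin.< j
      climb h (acc rec) h⊑i hi i≤h ¬h≺p with ≺-cmp p (path' h)
      ... | inj₂ (inj₂ k) = ⊥-elim (¬h≺p k)
      ... | inj₂ (inj₁ e) with ℕ.m≤n⇒m<n∨m≡n i≤h
      ...   | inj₁ i<h = h , sym e , i<h
      ...   | inj₂ i≡h with Fin.toℕ-injective i≡h
      ...     | refl = ⊥-elim (pi' (sym e))
      climb h (acc rec) h⊑i hi i≤h ¬h≺p | inj₁ p≺h with snoc-view (path' h)
      ... | inj₁ e = ⊥-elim (nothing≺[] (subst (p ≺_) e p≺h))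
        where
        nothing≺[] : ∀ {p} → ¬ (p ≺ [])
        nothing≺[] (inj₁ ())
        nothing≺[] {[]} (inj₂ (_ , ()))
        nothing≺[] {_ ∷ _} (inj₂ (_ , ()))
      ... | inj₂ (w , t , e) with S'.prefix-closed {w} h ([ t ] , sym e)
      ...   | k , refl = finish (step e h⊑i hi ¬i~k x-ik)
        where
        hik : h' i ≡ h' k + t
        hik = trans (sym hi) (child-height S' e)
        i≢k : i ≢ k
        i≢k refl = child-not-above {S = S'} e h⊑i
        -- What is known concerns the primed position of `k`. If `k` sits elsewhere in the other
        -- tree, leastness of `p` still keeps `path k` from preceding `p`.
        p≺kt : path i ≺ (path k ++ [ t ])
        p≺kt with path k ≟ᵖ path' k
        ... | yes q = subst₂ _≺_ (sym pi) (trans e (cong (_++ [ t ]) (sym q))) p≺h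
        ... | no q with ≺-cmp p (path k)
        ...   | inj₁ r = subst (_≺ (path k ++ [ t ])) (sym pi) (≺-trans {p} r (≺-snoc (path k) t))
        ...   | inj₂ (inj₁ r) = ⊥-elim (i≢k (path-injective (trans pi r)))
        ...   | inj₂ (inj₂ r) = ⊥-elim (proj₁ (least k q) r)
        x-ik : GapLe x i k (+ t)
        x-ik with i ~? k
        ... | no ¬p = inj₁ (C.before (S'.path-bound e) ¬p p≺kt)
        ... | yes q with ℕ.m≤n⇒m<n∨m≡n (subst (height S i ≤_) (drift-snoc (path k) t) (≺⇒drift≤ p≺kt))
        ...   | inj₂ r = inj₂ (subst (GapEq x i k) (m+s-m (height S k) t r) (block-gap {M = M} C.edge-gap q))
        ...   | inj₁ r = inj₁ (lt-weaken (inj₂ (block-gap {M = M} C.edge-gap q)) (subst (H i k ℤ.<_)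
                  (m+s-m (height S k) t refl) (ℤ.+-monoˡ-< (ℤ.- + height S k) (ℤ.+<+ r))))
        ¬i~k : ¬ (i ~' k)
        ¬i~k q with i ~? k
        ... | no ¬p = lt⇒¬eq (C.before (S'.path-bound e) ¬p p≺kt) (subst (GapEq x i k) (H'-child hik) (gap-x q))
        ... | yes r with ℕ.m≤n⇒m<n∨m≡n (subst (height S i ≤_) (drift-snoc (path k) t) (≺⇒drift≤ p≺kt))
        ...   | inj₁ l = ⊥-elim (lt⇒¬eq (lt-weaken (inj₂ (block-gap {M = M} C.edge-gap r)) (subst (H i k ℤ.<_)
                  (m+s-m (height S k) t refl) (ℤ.+-monoˡ-< (ℤ.- + height S k) (ℤ.+<+ l))))
                  (subst (GapEq x i k) (H'-child hik) (gap-x q)))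
        ...   | inj₂ l = same-height r (lexicographic p≺kt)
          where
          lexicographic : path i ≺ (path k ++ [ t ]) → prefLex (path i) (path k ++ [ t ])
          lexicographic (inj₁ d) = ⊥-elim (ℕ.<-irrefl (trans l (sym (drift-snoc (path k) t))) d)
          lexicographic (inj₂ (_ , d)) = d
          k↓i : k ↓' i
          k↓i = B'.~∧prefix⇒↓ (B'.~-sym q) (prefix-trans (child-prefix {S = S'} e) h⊑i)
          -- If `k` is above `i` in the unprimed tree, `p≺kt` contradicts `pl-child`. If `i` is
          -- above `k`, then `t` is 0 and labels increase from `i` to `k` in one block and from `k`
          -- to `i` in the other.
          same-height : i ~ k → prefLex (path i) (path k ++ [ t ]) → ⊥
          same-height (inj₂ d) lex = pl-child (path k) (path i) t
            (prefix⇒pl (↓-prefix d) (i≢k ∘ sym ∘ path-injective)) l lex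
          same-height (inj₁ d) _ = i≢k (Fin.toℕ-injective (ℕ.≤-antisym (↓-label d hik₀)
            (B'.↓-label k↓i (trans (sym (ℕ.+-identityʳ _)) (trans (cong (ℕ._+_ (h' k)) (sym t≡0)) (sym hik))))))
            where
            t≡0 : t ≡ 0
            t≡0 = ℕ.n≤0⇒n≡0 (ℕ.+-cancelˡ-≤ (height S k) _ _ (subst₂ _≤_ l (sym (ℕ.+-identityʳ _)) (↓-height d)))
            hik₀ : height S i ≡ height S k
            hik₀ = trans l (trans (cong (ℕ._+_ (height S k)) t≡0) (ℕ.+-identityʳ _))
        finish : t ≡ 0 × h Fin.< k → Σ (Fin n) λ j → path' j ≡ p × i Fin.< j
        finish (refl , h<k) = climb k (rec (child-longer {S = S'} e)) (prefix-trans (child-prefix {S = S'} e) h⊑i)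
          (trans (sym (ℕ.+-identityʳ _)) (trans (sym (child-height S' e)) hi)) (ℕ.≤-trans i≤h (ℕ.<⇒≤ h<k)) ¬k≺p
          where
          -- With `t = 0`, `path' h` is the immediate successor of `path' k`, so the climb cannot
          -- jump over `p`.
          ¬k≺p : ¬ (path' k ≺ p)
          ¬k≺p r with ≺-snoc0⁻ (path' k) (subst (p ≺_) e p≺h)
          ... | inj₁ s = ≺-asym r s
          ... | inj₂ refl = ≺-irrefl r

    larger-label : Σ (Fin n) λ j → path' j ≡ p × i Fin.< j
    larger-label = climb i (<-wellFounded _) prefix-refl refl ℕ.≤-refl
      (proj₂ (least i λ e → pi' (trans (sym e) pi)))

module _ {m n : ℕ} {A : Arr m n} (st : StronglyTransitive A)
    {S : PathSystem m n} {μ : Subset n} {M : Marking S μ}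
    {S' : PathSystem m n} {μ' : Subset n} {M' : Marking S' μ'}
    {x y : Point n} (sf : SameFace A x y) (C : Compatible S M x) (C' : Compatible S' M' y)
    (conn : Connected S M A) (cr : Crossed S M A) (conn' : Connected S' M' A) (cr' : Crossed S' M' A) where

  open PathSystem S using (path; path-injective)
  open PathSystem S' using () renaming (path to path'; path-injective to path'-injective)
  private
    module D = Divergence A st S M S' M' {x} {y} sf C C' conn' cr'
    module D' = Divergence A st S' M' S M {y} {x} (sameFace-sym A {x} {y} sf) C' C conn cr
    module B = Blocks S M
    module B' = Blocks S' M'

    Differs : Path → Set
    Differs p = Σ (Fin n) λ i → path i ≢ path' i × (path i ≡ p ⊎ path' i ≡ p)

    differs? : ∀ p → Dec (Differs p)
    differs? p = Fin.any? λ i → ¬? (path i ≟ᵖ path' i) ×-dec ((path i ≟ᵖ p) ⊎-dec (path' i ≟ᵖ p))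

    candidates : List Path
    candidates = List.map path (allFin n) ++ List.map path' (allFin n)

  same-paths : ∀ i → path i ≡ path' i
  same-paths i with minimal {_⊏_ = _≺_} (λ {a} → ≺-trans {a}) (λ {a} → ≺-irrefl {a}) _≺?_ differs? candidates
  ... | inj₁ none with path i ≟ᵖ path' i
  ...   | yes e = e
  ...   | no ne = ⊥-elim (none (path i) (Mem.∈-++⁺ˡ (Mem.∈-map⁺ path (Mem.∈-allFin i))) (i , ne , inj₁ refl))
  same-paths i | inj₂ (p , _ , (j , ne , e) , min) = ⊥-elim (go e)
    where
    least : ∀ l → path l ≢ path' l → ¬ (path l ≺ p) × ¬ (path' l ≺ p)
    least l d = min (path l) (Mem.∈-++⁺ˡ (Mem.∈-map⁺ path (Mem.∈-allFin l))) (l , d , inj₁ refl)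
              , min (path' l) (Mem.∈-++⁺ʳ (List.map path (allFin n)) (Mem.∈-map⁺ path' (Mem.∈-allFin l))) (l , d , inj₂ refl)
    least' : ∀ l → path' l ≢ path l → ¬ (path' l ≺ p) × ¬ (path l ≺ p)
    least' l d = let (a , b) = least l (d ∘ sym) in b , a
    go : path j ≡ p ⊎ path' j ≡ p → ⊥
    -- Each application passes to the node at `p` in the other tree and raises the label. Two of
    -- them return to the node `j` with a label larger than its own.
    go (inj₁ e) with D.larger-label least e (ne ∘ trans e ∘ sym)
    ... | k , e' , j<k with D'.larger-label least' e' (λ f → Fin.<⇒≢ j<k (path-injective (trans e (sym f))))
    ...   | l , f , k<l with path-injective (trans e (sym f))
    ...     | refl = ℕ.<-asym j<k k<l
    go (inj₂ e) with D'.larger-label least' e (λ f → ne (trans f (sym e)))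
    ... | k , e' , j<k with D.larger-label least e' (λ f → Fin.<⇒≢ j<k (path'-injective (trans e (sym f))))
    ...   | l , f , k<l with path'-injective (trans e (sym f))
    ...     | refl = ℕ.<-asym j<k k<l

-- The tree of a point

abstract
  gapEq? : ∀ {n} (x : Point n) i j d → Dec (GapEq x i j d)
  gapEq? x i j d = map′ ⟪_⟫ gap≡ ((x i ℚ.- x j) ℚ.≟ ι d)

decSubset : ∀ {n} {P : Fin n → Set} → (∀ i → Dec (P i)) → Σ (Subset n) λ μ → (∀ {i} → i ∈ μ → P i) × (∀ {i} → P i → i ∈ μ)
decSubset {n} {P} P? = Vec.tabulate (does ∘ P?) , out , into
  where
  out : ∀ {i} → i ∈ Vec.tabulate (does ∘ P?) → P i
  out {i} i∈ with P? i | trans (sym (Vec.lookup∘tabulate (does ∘ P?) i)) (Vec.[]=⇒lookup i∈)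
  ... | yes p | _ = p
  ... | no _  | ()
  into : ∀ {i} → P i → i ∈ Vec.tabulate (does ∘ P?)
  into {i} p = Vec.lookup⇒[]= i _ (trans (Vec.lookup∘tabulate (does ∘ P?) i) (isYes (P? i)))
    where
    isYes : (d : Dec (P i)) → does d ≡ true
    isYes (yes _) = refl
    isYes (no ¬p) = ⊥-elim (¬p p)

module PointTree {n : ℕ} (m : ℕ) (x : Point n) where

  Vertex : Set
  Vertex = Fin n × ℕ

  infix 4 _⊏_
  -- The vertex (i , s) has value x i + s.  Ties are broken towards larger x, that is
  -- smaller s, and then towards larger labels.
  _⊏_ : Vertex → Vertex → Set
  (i , s) ⊏ (j , t) = GapLt x i j (+ t ℤ.- + s) ⊎ (GapEq x i j (+ t ℤ.- + s) × (t < s ⊎ (s ≡ t × i Fin.< j)))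

  abstract
    shift-sum : ∀ s t u → (t ℤ.- s) ℤ.+ (u ℤ.- t) ≡ u ℤ.- s
    shift-sum = ℤSolver.solve-∀

  ⊏-trans : ∀ {a b c} → a ⊏ b → b ⊏ c → a ⊏ c
  ⊏-trans {_ , s} {_ , t} {_ , u} (inj₁ p) (inj₁ q) = inj₁ (lt-lt p q (shift-sum (+ s) (+ t) (+ u)))
  ⊏-trans {_ , s} {_ , t} {_ , u} (inj₁ p) (inj₂ (q , _)) = inj₁ (lt-eq p q (shift-sum (+ s) (+ t) (+ u)))
  ⊏-trans {_ , s} {_ , t} {_ , u} (inj₂ (p , _)) (inj₁ q) = inj₁ (eq-lt p q (shift-sum (+ s) (+ t) (+ u)))
  ⊏-trans {_ , s} {_ , t} {_ , u} (inj₂ (p , a)) (inj₂ (q , b)) = inj₂ (eq-eq p q (shift-sum (+ s) (+ t) (+ u)) , tie a b)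
    where
    tie : ∀ {s t u i j k} → t < s ⊎ (s ≡ t × i Fin.< j) → u < t ⊎ (t ≡ u × j Fin.< k) → u < s ⊎ (s ≡ u × i Fin.< k)
    tie (inj₁ h) (inj₁ k) = inj₁ (ℕ.<-trans k h)
    tie (inj₁ h) (inj₂ (refl , _)) = inj₁ h
    tie (inj₂ (refl , _)) (inj₁ k) = inj₁ k
    tie (inj₂ (refl , h)) (inj₂ (refl , k)) = inj₂ (refl , ℕ.<-trans h k)

  ⊏-irrefl : ∀ {a} → ¬ (a ⊏ a)
  ⊏-irrefl {i , s} (inj₁ p) = lt⇒¬eq p (subst (GapEq x i i) (sym (ℤ.+-inverseʳ (+ s))) eq-refl)
  ⊏-irrefl (inj₂ (_ , inj₁ h)) = ℕ.<-irrefl refl h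
  ⊏-irrefl (inj₂ (_ , inj₂ (_ , h))) = ℕ.<-irrefl refl h

  ⊏-cmp : ∀ a b → a ⊏ b ⊎ a ≡ b ⊎ b ⊏ a
  ⊏-cmp (i , s) (j , t) with gap-cmp x i j (+ t ℤ.- + s)
  ... | less p = inj₁ (inj₁ p)
  ... | greater p = inj₂ (inj₂ (inj₁ (subst (GapLt x j i) (neg-minus (+ t) (+ s)) p)))
  ... | equal p = tie (ℕ.<-cmp s t) (ℕ.<-cmp (toℕ i) (toℕ j))
    where
    q : GapEq x j i (+ s ℤ.- + t)
    q = subst (GapEq x j i) (neg-minus (+ t) (+ s)) (eq-swap p)
    tie : Tri (s < t) (s ≡ t) (t < s) → Tri (i Fin.< j) (toℕ i ≡ toℕ j) (j Fin.< i) →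
          (i , s) ⊏ (j , t) ⊎ (i , s) ≡ (j , t) ⊎ (j , t) ⊏ (i , s)
    tie (tri< s<t _ _) _ = inj₂ (inj₂ (inj₂ (q , inj₁ s<t)))
    tie (tri> _ _ t<s) _ = inj₁ (inj₂ (p , inj₁ t<s))
    tie (tri≈ _ e _) (tri< i<j _ _) = inj₁ (inj₂ (p , inj₂ (e , i<j)))
    tie (tri≈ _ refl _) (tri≈ _ e _) = inj₂ (inj₁ (cong (_, s) (Fin.toℕ-injective e)))
    tie (tri≈ _ e _) (tri> _ _ j<i) = inj₂ (inj₂ (inj₂ (q , inj₂ (sym e , j<i))))

  _⊏?_ : ∀ a b → Dec (a ⊏ b)
  a ⊏? b with ⊏-cmp a b
  ... | inj₁ h = yes h
  ... | inj₂ (inj₁ refl) = no (λ h → ⊏-irrefl {a} h)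
  ... | inj₂ (inj₂ h) = no (λ k → ⊏-irrefl {a} (⊏-trans {a} {b} {a} k h))

  ⊏-gap : ∀ {i s j t} → (i , s) ⊏ (j , t) → GapLe x i j (+ t ℤ.- + s)
  ⊏-gap (inj₁ p) = inj₁ p
  ⊏-gap (inj₂ (p , _)) = inj₂ p

  ⊏-suc : ∀ {i s j t} → (i , s) ⊏ (j , t) → (i , suc s) ⊏ (j , suc t)
  ⊏-suc {i} {s} {j} {t} (inj₁ p) = inj₁ (subst (GapLt x i j) (lem (+ t) (+ s)) p)
    where
    lem : ∀ t s → t ℤ.- s ≡ (+ 1 ℤ.+ t) ℤ.- (+ 1 ℤ.+ s)
    lem = ℤSolver.solve-∀
  ⊏-suc {i} {s} {j} {t} (inj₂ (p , tie)) = inj₂ (subst (GapEq x i j) (lem (+ t) (+ s)) p , up tie)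
    where
    lem : ∀ t s → t ℤ.- s ≡ (+ 1 ℤ.+ t) ℤ.- (+ 1 ℤ.+ s)
    lem = ℤSolver.solve-∀
    up : t < s ⊎ (s ≡ t × i Fin.< j) → suc t < suc s ⊎ (suc s ≡ suc t × i Fin.< j)
    up (inj₁ h) = inj₁ (s≤s h)
    up (inj₂ (e , h)) = inj₂ (cong suc e , h)

  ⊏-later : ∀ {i s b} → (i , s) ⊏ b → (i , 0) ⊏ b
  ⊏-later {i} {zero} h = h
  ⊏-later {i} {suc s} {b} h = ⊏-trans {i , 0} {i , suc s} {b}
    (inj₁ (lt-weaken (inj₂ eq-refl) (ℤ.+<+ (s≤s z≤n)))) h

  -- `(i , 0)` stands for the value of `i` itself: node `i` is grafted at the last child position
  -- that comes before this value.
  Parent : Fin n → Vertex → Set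
  Parent i (k , t) = t ≤ m × (k , t) ⊏ (i , 0) × (∀ l u → u ≤ m → (l , u) ⊏ (i , 0) → ¬ ((k , t) ⊏ (l , u)))

  IsRoot : Fin n → Set
  IsRoot i = ∀ l u → u ≤ m → ¬ ((l , u) ⊏ (i , 0))

  private
    vertices : List Vertex
    vertices = cartesianProduct (allFin n) (List.upTo (suc m))
    ∈-vertices : ∀ l {u} → u ≤ m → (l , u) Mem.∈ vertices
    ∈-vertices l u≤m = Mem.∈-cartesianProduct⁺ (Mem.∈-allFin l) (Mem.∈-upTo⁺ (s≤s u≤m))
    vertices-bound : ∀ {l u} → (l , u) Mem.∈ vertices → u ≤ m
    vertices-bound h = ℕ.s≤s⁻¹ (Mem.∈-upTo⁻ (proj₂ (Mem.∈-cartesianProduct⁻ (allFin n) (List.upTo (suc m)) h)))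

  parent? : ∀ i → IsRoot i ⊎ Σ Vertex (Parent i)
  parent? i with minimal {_⊏_ = λ a b → b ⊏ a} (λ {a} {b} {c} p q → ⊏-trans {c} {b} {a} q p) (λ {a} → ⊏-irrefl {a})
                         (λ a b → b ⊏? a) (λ v → v ⊏? (i , 0)) vertices
  ... | inj₁ none = inj₁ λ l u u≤m → none (l , u) (∈-vertices l u≤m)
  ... | inj₂ ((k , t) , v∈ , v⊏ , max) = inj₂ ((k , t) , vertices-bound v∈ , v⊏ , λ l u u≤m → max (l , u) (∈-vertices l u≤m))

  parent-unique : ∀ {i v w} → Parent i v → Parent i w → v ≡ w
  parent-unique {i} {v} {w} (t≤ , v⊏ , maxv) (u≤ , w⊏ , maxw) with ⊏-cmp v w
  ... | inj₁ h = ⊥-elim (maxv _ _ u≤ w⊏ h)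
  ... | inj₂ (inj₁ e) = e
  ... | inj₂ (inj₂ h) = ⊥-elim (maxw _ _ t≤ v⊏ h)

  -- If `(i , 0)` came before `(j , 0)`, it would be a later vertex before `j` than the common
  -- parent position `v`.
  parent-injective : ∀ {i j v} → Parent i v → Parent j v → i ≡ j
  parent-injective {i} {j} {v} (_ , vi , maxi) (_ , vj , maxj) with ⊏-cmp (i , 0) (j , 0)
  ... | inj₁ h = ⊥-elim (maxj i 0 z≤n h vi)
  ... | inj₂ (inj₁ refl) = refl
  ... | inj₂ (inj₂ h) = ⊥-elim (maxi j 0 z≤n h vj)

  -- The recursion measure for passing to the parent, as rational coordinates provide none
  -- themselves.
  precedes : Fin n → ℕ
  precedes i = count (λ l → (l , 0) ⊏? (i , 0)) (allFin n)

  parent-precedes : ∀ {i k t} → (k , t) ⊏ (i , 0) → precedes k < precedes i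
  parent-precedes {i} {k} {t} h = count-mono-< _ _ (λ l h' → ⊏-trans {l , 0} {k , 0} {i , 0} h' k⊏i) (Mem.∈-allFin k) k⊏i (⊏-irrefl {k , 0})
    where
    k⊏i : (k , 0) ⊏ (i , 0)
    k⊏i = ⊏-later {k} {t} {i , 0} h

  -- A relation, so that uniqueness and injectivity go by induction on derivations, apart from the
  -- recursion that computes the path.
  data Position : Fin n → Path → Set where
    root  : ∀ {i} → IsRoot i → Position i []
    below : ∀ {i k t p} → Parent i (k , t) → Position k p → Position i (p ++ [ t ])

  abstract
    position : ∀ i → Σ Path (Position i)
    position i = go i (<-wellFounded (precedes i))
      where
      go : ∀ i → Acc _<_ (precedes i) → Σ Path (Position i)
      go i (acc rec) with parent? i
      ... | inj₁ r = [] , root r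
      ... | inj₂ ((k , t) , P) with go k (rec (parent-precedes (proj₁ (proj₂ P))))
      ...   | p , pos = p ++ [ t ] , below P pos

  position-unique : ∀ {i p q} → Position i p → Position i q → p ≡ q
  position-unique (root _) (root _) = refl
  position-unique (root r) (below (t≤m , h , _) _) = ⊥-elim (r _ _ t≤m h)
  position-unique (below (t≤m , h , _) _) (root r) = ⊥-elim (r _ _ t≤m h)
  position-unique (below P pos) (below Q pos') with parent-unique P Q
  ... | refl = cong (_++ [ _ ]) (position-unique pos pos')

  position-injective : ∀ {i j p q} → Position i p → Position j q → p ≡ q → i ≡ j
  position-injective {i} {j} (root r) (root r') _ with ⊏-cmp (i , 0) (j , 0)
  ... | inj₁ h = ⊥-elim (r' i 0 z≤n h)
  ... | inj₂ (inj₁ refl) = refl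
  ... | inj₂ (inj₂ h) = ⊥-elim (r j 0 z≤n h)
  position-injective (root _) (below _ _) e = ⊥-elim (snoc≢[] (sym e))
  position-injective (below _ _) (root _) e = ⊥-elim (snoc≢[] e)
  position-injective (below {p = p} P pos) (below {p = q} Q pos') e with snoc-injective {p} {q} e
  ... | refl , refl with position-injective pos pos' refl
  ...   | refl = parent-injective P Q

  private
    closed : ∀ {r i p} → Position i p → IsPrefix r p → Σ (Fin n) λ k → Position k r
    closed {r} {i} (root R) h with prefix-[] h
    ... | refl = i , root R
    closed {r} {i} (below {p = p} P pos) h with prefix-snoc⁻ p h
    ... | inj₁ refl = i , below P pos
    ... | inj₂ h' = closed pos h'

    bounded : ∀ {i p q s} → Position i p → p ≡ q ++ [ s ] → s ≤ m
    bounded (root _) e = ⊥-elim (snoc≢[] (sym e))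
    bounded {q = q} (below {p = p} (t≤m , _) _) e with snoc-injective {p} {q} e
    ... | _ , refl = t≤m

  system : PathSystem m n
  system = record
    { path = λ i → proj₁ (position i)
    ; path-injective = λ {i} {j} → position-injective (proj₂ (position i)) (proj₂ (position j))
    ; prefix-closed = λ i h → let (k , pos) = closed (proj₂ (position i)) h in k , position-unique (proj₂ (position k)) pos
    ; path-bound = λ {i} → bounded (proj₂ (position i))
    }

  open PathSystem system

  child⇒parent : ∀ {i s k} → Child system i s k → Parent i (k , s)
  child⇒parent {i} {s} {k} c = go (proj₂ (position i)) c
    where
    go : ∀ {p} → Position i p → p ≡ path k ++ [ s ] → Parent i (k , s)
    go (root _) e = ⊥-elim (snoc≢[] (sym e))
    go (below {p = p} P pos) e with snoc-injective {p} {path k} e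
    ... | e' , refl with position-injective pos (proj₂ (position k)) e'
    ...   | refl = P

  parent⇒child : ∀ {i s k} → Parent i (k , s) → Child system i s k
  parent⇒child {i} {s} {k} P = position-unique (proj₂ (position i)) (below P (proj₂ (position k)))

  root-path : ∀ {i} → IsRoot i → path i ≡ []
  root-path {i} r = position-unique (proj₂ (position i)) (root r)

  private
    -- Drops by one when a positive last letter is lowered and also when a last letter 0 is removed,
    -- the two moves of the induction in `order-acc`.
    size : Path → ℕ
    size p = drift p + length p

    size-snoc0 : ∀ p → size (p ++ [ 0 ]) ≡ suc (size p)
    size-snoc0 p = trans (cong₂ _+_ (trans (drift-snoc p 0) (ℕ.+-identityʳ _)) (length-snoc p 0)) (ℕ.+-suc _ _)

    size-suc : ∀ p s → size (p ++ [ suc s ]) ≡ suc (size (p ++ [ s ]))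
    size-suc p s = cong₂ _+_ (trans (drift-snoc p (suc s)) (trans (ℕ.+-suc _ s) (cong suc (sym (drift-snoc p s)))))
      (trans (length-snoc p (suc s)) (sym (length-snoc p s)))

    Order : Fin n → ℕ → Fin n → ℕ → Set
    Order j s k t = s ≤ m → t ≤ m → (path j ++ [ s ]) ≺ (path k ++ [ t ]) → (j , s) ⊏ (k , t)

    -- Two positive last letters are lowered together. A last letter 0 on the left is replaced by
    -- the parent position of `j`, whose path is `path j`; by maximality it cannot precede `(k , t)`
    -- if `(k , t)` precedes `(j , 0)`. On the right, `path k ++ [ 0 ]` is the immediate successor
    -- of `path k`, so the parent position of `k` can stand in for it.
    order-acc : ∀ j s k t → Acc _<_ (size (path j ++ [ s ]) + size (path k ++ [ t ])) → Order j s k t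
    order-acc j (suc s) k (suc t) (acc rec) s≤m t≤m h = ⊏-suc {j} {s} {k} {t} (order-acc j s k t
      (rec (ℕ.+-mono-< (ℕ.≤-reflexive (sym (size-suc (path j) s))) (ℕ.≤-reflexive (sym (size-suc (path k) t)))))
      (ℕ.<⇒≤ s≤m) (ℕ.<⇒≤ t≤m) (≺-pred-snoc (path j) (path k) s t h))
    order-acc j zero k t (acc rec) s≤m t≤m h with ⊏-cmp (j , 0) (k , t)
    ... | inj₁ r = r
    ... | inj₂ (inj₁ refl) = ⊥-elim (≺-irrefl {path j ++ [ 0 ]} h)
    ... | inj₂ (inj₂ r) with parent? j
    ...   | inj₁ R = ⊥-elim (R k t t≤m r)
    ...   | inj₂ ((j' , s') , P) = ⊥-elim (proj₂ (proj₂ P) k t t≤m r (order-acc j' s' k t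
            (rec (ℕ.+-monoˡ-< (size (path k ++ [ t ])) (subst (_< size (path j ++ [ 0 ])) (cong size (parent⇒child P))
              (ℕ.≤-reflexive (sym (size-snoc0 (path j)))))))
            (proj₁ P) t≤m (subst (_≺ (path k ++ [ t ])) (parent⇒child P) (≺-trans {path j} (≺-snoc (path j) 0) h))))
    order-acc j (suc s) k zero (acc rec) s≤m t≤m h with parent? k
    ... | inj₁ R = ⊥-elim (absurd (subst (λ q → (path j ++ [ suc s ]) ≺ (q ++ [ 0 ])) (root-path R) h))
      where
      absurd : ¬ ((path j ++ [ suc s ]) ≺ ([] ++ [ 0 ]))
      absurd (inj₁ ())
      absurd (inj₂ (e , _)) with trans (sym e) (trans (drift-snoc (path j) (suc s)) (ℕ.+-suc _ s))
      ... | ()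
    ... | inj₂ ((k' , t') , P) with ≺-snoc0⁻ (path k) h
    ...   | inj₁ r = ⊏-trans {j , suc s} {k' , t'} {k , 0} (order-acc j (suc s) k' t'
            (rec (ℕ.+-monoʳ-< (size (path j ++ [ suc s ])) (subst (_< size (path k ++ [ 0 ])) (cong size (parent⇒child P))
              (ℕ.≤-reflexive (sym (size-snoc0 (path k)))))))
            s≤m (proj₁ P) (subst ((path j ++ [ suc s ]) ≺_) (parent⇒child P) r)) (proj₁ (proj₂ P))
    ...   | inj₂ r with snoc-injective {path j} {path k'} (trans r (parent⇒child P))
    ...     | e , refl with path-injective e
    ...       | refl = proj₁ (proj₂ P)

  path-order : ∀ {j s k t} → s ≤ m → t ≤ m → (path j ++ [ s ]) ≺ (path k ++ [ t ]) → (j , s) ⊏ (k , t)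
  path-order {j} {s} {k} {t} = order-acc j s k t (<-wellFounded _)

  IsMarked : Fin n → Set
  IsMarked i = Σ (Fin n) λ k → Σ ℕ λ t → Parent i (k , t) × GapEq x i k (+ t)

  isMarked? : ∀ i → Dec (IsMarked i)
  isMarked? i with parent? i
  ... | inj₁ R = no λ { (k , t , (t≤m , h , _) , _) → R k t t≤m h }
  ... | inj₂ ((k , t) , P) = map′ (λ e → k , t , P , e) (λ { (k' , t' , P' , e) → same P' e }) (gapEq? x i k (+ t))
    where
    same : ∀ {k' t'} → Parent i (k' , t') → GapEq x i k' (+ t') → GapEq x i k (+ t)
    same P' e with parent-unique P P'
    ... | refl = e

  marks : Subset n
  marks = proj₁ (decSubset isMarked?)

  marks⇒ : ∀ {i} → i ∈ marks → IsMarked i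
  marks⇒ = proj₁ (proj₂ (decSubset isMarked?))

  ⇒marks : ∀ {i} → IsMarked i → i ∈ marks
  ⇒marks = proj₂ (proj₂ (decSubset isMarked?))

  tie-break : ∀ {i k t} → (k , t) ⊏ (i , 0) → GapEq x i k (+ t) → 0 < t ⊎ (t ≡ 0 × k Fin.< i)
  tie-break {i} {k} {t} (inj₁ p) e = ⊥-elim (lt⇒¬eq p (subst (GapEq x k i) (sym (ℤ.+-identityˡ (ℤ.- + t))) (eq-swap e)))
  tie-break (inj₂ (_ , h)) _ = h

  tie⇒⊏ : ∀ {i k t} → GapEq x i k (+ t) → 0 < t ⊎ (t ≡ 0 × k Fin.< i) → (k , t) ⊏ (i , 0)
  tie⇒⊏ {i} {k} {t} e h = inj₂ (subst (GapEq x k i) (sym (ℤ.+-identityˡ (ℤ.- + t))) (eq-swap e) , h)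

  -- Suppose `i` ties with the position `(k , t)` and `k` had a child `l` further right at `t'`.
  -- Then `(i , t' ∸ t)` has the value of `(k , t')` but comes after it, so it cannot precede `l` by
  -- maximality, nor follow it without putting `l` below its own parent position.
  marking : Marking system marks
  marking i i∈ with marks⇒ i∈
  ... | k , t , P , e = t , k , (parent⇒child P , last) , zero-label
    where
    tb : 0 < t ⊎ (t ≡ 0 × k Fin.< i)
    tb = tie-break (proj₁ (proj₂ P)) e
    zero-label : t ≡ 0 → k Fin.< i
    zero-label t≡0 with tb
    ... | inj₁ 0<t = ⊥-elim (ℕ.<-irrefl (sym t≡0) 0<t)
    ... | inj₂ (_ , h) = h
    last : ∀ t' l → t < t' → ¬ Child system l t' k
    last t' l t<t' c with child⇒parent c
    ... | t'≤m , k⊏l , maxl = lt⇒¬eq (le-lt (⊏-gap {k} {t'} {l} {0} k⊏l) l<i (lem₁ (+ t'))) (eq-swap e)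
      where
      d : ℕ
      d = t' ∸ t
      t+d : t' ≡ t + d
      t+d = sym (ℕ.m+[n∸m]≡n (ℕ.<⇒≤ t<t'))
      k⊏i+d : (k , t') ⊏ (i , d)
      k⊏i+d = inj₂ (subst (GapEq x k i) gap (eq-swap e) , tie tb)
        where
        lem : ∀ t d → ℤ.- t ≡ d ℤ.- (t ℤ.+ d)
        lem = ℤSolver.solve-∀
        gap : ℤ.- + t ≡ + d ℤ.- + t'
        gap = trans (lem (+ t) (+ d)) (cong (λ z → + d ℤ.- + z) (sym t+d))
        tie : 0 < t ⊎ (t ≡ 0 × k Fin.< i) → d < t' ⊎ (t' ≡ d × k Fin.< i)
        tie (inj₁ 0<t) = inj₁ (subst (d <_) (sym t+d) (ℕ.m<n+m d 0<t))
        tie (inj₂ (t≡0 , h)) = inj₂ (trans t+d (cong (_+ d) t≡0) , h)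
      0<d : 0 < d
      0<d = ℕ.m<n⇒0<n∸m t<t'
      lem₁ : ∀ {t} t' → (+ 0 ℤ.- t') ℤ.+ (t' ℤ.- t) ≡ ℤ.- t
      lem₁ {t} t' = go t t'
        where
        go : ∀ t t' → (+ 0 ℤ.- t') ℤ.+ (t' ℤ.- t) ≡ ℤ.- t
        go = ℤSolver.solve-∀
      l<i : GapLt x l i (+ t' ℤ.- + t)
      l<i with ⊏-cmp (i , d) (l , 0)
      ... | inj₁ r = ⊥-elim (maxl i d (ℕ.≤-trans (ℕ.m∸n≤m t' t) t'≤m) r k⊏i+d)
      ... | inj₂ (inj₁ r) = ⊥-elim (ℕ.<-irrefl (sym (cong proj₂ r)) 0<d)
      ... | inj₂ (inj₂ (inj₁ r)) = subst (GapLt x l i) (trans (ℤ.+-identityʳ (+ d)) (sym (+m-n (ℕ.<⇒≤ t<t')))) r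
      ... | inj₂ (inj₂ (inj₂ (_ , inj₁ ())))
      ... | inj₂ (inj₂ (inj₂ (_ , inj₂ (r , _)))) = ⊥-elim (ℕ.<-irrefl r 0<d)

  open Blocks system marking

  -- The parent position of `i` lies between `(k , t)` and `(i , 0)`, which have equal values, so it
  -- shares that value: the edge is marked, and the tie passes to the parent with `t` reduced by its
  -- letter.
  tie⇒↓ : ∀ {i k t} → t ≤ m → GapEq x i k (+ t) → 0 < t ⊎ (t ≡ 0 × k Fin.< i) → k ↓ i
  tie⇒↓ {i} = go i (<-wellFounded (precedes i))
    where
    go : ∀ i {k t} → Acc _<_ (precedes i) → t ≤ m → GapEq x i k (+ t) → 0 < t ⊎ (t ≡ 0 × k Fin.< i) → k ↓ i
    go i {k} {t} (acc rec) t≤m e tb with parent? i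
    ... | inj₁ R = ⊥-elim (R k t t≤m (tie⇒⊏ e tb))
    ... | inj₂ ((l , u) , P) with ⊏-cmp (k , t) (l , u)
    ...   | inj₁ h = down (go l (rec (parent-precedes (proj₁ (proj₂ P)))) (ℕ.≤-trans (ℕ.m∸n≤m t u) t≤m)
                (proj₁ (proj₂ both)) (proj₂ (proj₂ both))) (⇒marks (l , u , P , proj₁ both)) (parent⇒child P)
      where
      sum : ∀ t u → (u ℤ.- t) ℤ.+ (+ 0 ℤ.- u) ≡ ℤ.- t
      sum = ℤSolver.solve-∀
      both : GapEq x i l (+ u) × GapEq x l k (+ (t ∸ u)) × (0 < t ∸ u ⊎ (t ∸ u ≡ 0 × k Fin.< l))
      both = resolve h (proj₁ (proj₂ P))
        where
        neg : ∀ u → ℤ.- (+ 0 ℤ.- u) ≡ u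
        neg = ℤSolver.solve-∀
        u≤t : u < t ⊎ (t ≡ u × k Fin.< l) → u ≤ t
        u≤t (inj₁ h) = ℕ.<⇒≤ h
        u≤t (inj₂ (refl , _)) = ℕ.≤-refl
        tie' : u < t ⊎ (t ≡ u × k Fin.< l) → 0 < t ∸ u ⊎ (t ∸ u ≡ 0 × k Fin.< l)
        tie' (inj₁ h) = inj₁ (ℕ.m<n⇒0<n∸m h)
        tie' (inj₂ (refl , h)) = inj₂ (ℕ.n∸n≡0 t , h)
        resolve : (k , t) ⊏ (l , u) → (l , u) ⊏ (i , 0) →
                  GapEq x i l (+ u) × GapEq x l k (+ (t ∸ u)) × (0 < t ∸ u ⊎ (t ∸ u ≡ 0 × k Fin.< l))
        resolve (inj₁ p) q = ⊥-elim (lt⇒¬eq (lt-le p (⊏-gap {l} {u} {i} {0} q) (sum (+ t) (+ u))) (eq-swap e))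
        resolve (inj₂ (p , _)) (inj₁ q) = ⊥-elim (lt⇒¬eq (eq-lt p q (sum (+ t) (+ u))) (eq-swap e))
        resolve (inj₂ (p , tie)) (inj₂ (q , _)) =
          subst (GapEq x i l) (neg (+ u)) (eq-swap q) ,
          subst (GapEq x l k) (trans (neg-minus (+ u) (+ t)) (+m-n (u≤t tie))) (eq-swap p) , tie' tie
    ...   | inj₂ (inj₁ refl) = down stay (⇒marks (k , t , P , e)) (parent⇒child P)
    ...   | inj₂ (inj₂ h) = ⊥-elim (proj₂ (proj₂ P) k t t≤m (tie⇒⊏ e tb) h)

  compatible : Compatible system marking x
  compatible = record { edge-gap = edge ; before = bef ; after = aft }
    where
    edge : ∀ {i s j} → i ∈ marks → Child system i s j → GapEq x i j (+ s)
    edge i∈ c with marks⇒ i∈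
    ... | k , t , P , e with parent-unique P (child⇒parent c)
    ...   | refl = e
    bef : ∀ {i j s} → s ≤ m → ¬ (i ~ j) → path i ≺ (path j ++ [ s ]) → GapLt x i j (+ s)
    bef {i} {j} {s} s≤m ¬p h with ≺-cmp (path i ++ [ 0 ]) (path j ++ [ s ])
    ... | inj₂ (inj₁ e) with path-injective (proj₁ (snoc-injective {path i} {path j} e))
    ...   | refl = ⊥-elim (¬p (inj₁ stay))
    bef {i} {j} {s} s≤m ¬p h | inj₂ (inj₂ k) with ≺-snoc0⁻ (path i) k
    ... | inj₁ r = ⊥-elim (≺-asym {path i} h r)
    ... | inj₂ r = ⊥-elim (≺-irrefl {path i} (subst (path i ≺_) r h))
    bef {i} {j} {s} s≤m ¬p h | inj₁ k with path-order {i} {0} {j} {s} z≤n s≤m k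
    ... | inj₁ r = subst (GapLt x i j) (ℤ.+-identityʳ (+ s)) r
    ... | inj₂ (_ , inj₁ ())
    ... | inj₂ (e , inj₂ (refl , i<j)) = ⊥-elim (¬p (inj₁ (tie⇒↓ z≤n (eq-swap e) (inj₂ (refl , i<j)))))
    aft : ∀ {i j s} → s ≤ m → ¬ (i ~ j) → path i ⪰ (path j ++ [ s ]) → GapLt x j i (ℤ.- + s)
    aft {i} {j} {s} s≤m ¬p h with path-order {j} {s} {i} {0} s≤m z≤n (up h)
      where
      up : path i ⪰ (path j ++ [ s ]) → (path j ++ [ s ]) ≺ (path i ++ [ 0 ])
      up (inj₁ k) = ≺-trans {path j ++ [ s ]} k (≺-snoc (path i) 0)
      up (inj₂ k) = subst (_≺ (path i ++ [ 0 ])) k (≺-snoc (path i) 0)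
    ... | inj₁ r = subst (GapLt x j i) (ℤ.+-identityˡ (ℤ.- + s)) r
    ... | inj₂ (e , tb) = ⊥-elim (¬p (inj₂ (tie⇒↓ s≤m (subst (GapEq x i j) (neg (+ s)) (eq-swap e)) tb)))
      where
      neg : ∀ u → ℤ.- (+ 0 ℤ.- u) ≡ u
      neg = ℤSolver.solve-∀

-- Surjectivity

module _ {m n : ℕ} {S : PathSystem m n} {μ : Subset n} {M : Marking S μ} where
  open PathSystem S
  open Blocks S M

  compatible⇒gapLt : ∀ {x y i j s} → Compatible S M x → Compatible S M y → s ≤ m → GapLt x i j (+ s) → GapLt y i j (+ s)
  compatible⇒gapLt {i = i} {j} {s} C C' s≤m h with i ~? j
  ... | yes p = gap-transfer (block-gap {M = M} (Compatible.edge-gap C) p) (block-gap {M = M} (Compatible.edge-gap C') p) h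
  ... | no ¬p with ≺-or-⪰ (path i) (path j ++ [ s ])
  ...   | inj₁ k = Compatible.before C' s≤m ¬p k
  ...   | inj₂ k = ⊥-elim (lt-irrefl h (inj₁ (Compatible.after C s≤m ¬p k)))

module _ {n : ℕ} (m : ℕ) (x : Point n) where

  Exceeds : Fin n × Fin n × ℕ → Set
  Exceeds (i , k , t) = t ≤ m × (0 < t ⊎ k Fin.< i) × ¬ GapLt x i k (+ t)

  exceeds? : ∀ v → Dec (Exceeds v)
  exceeds? (i , k , t) = t ℕ.≤? m ×-dec ((0 ℕ.<? t ⊎-dec k Fin.<? i) ×-dec ¬? (gapLt? x i k (+ t)))

triples : (m n : ℕ) → List (Fin n × Fin n × ℕ)
triples m n = cartesianProduct (allFin n) (cartesianProduct (allFin n) (List.upTo (suc m)))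

∈-triples : ∀ {m n} (i k : Fin n) {t} → t ≤ m → (i , k , t) Mem.∈ triples m n
∈-triples i k t≤m = Mem.∈-cartesianProduct⁺ (Mem.∈-allFin i) (Mem.∈-cartesianProduct⁺ (Mem.∈-allFin k) (Mem.∈-upTo⁺ (s≤s t≤m)))

-- Termination measure of the descent: the number of (i , k , t) in Tr with x_i - x_k ≥ t.
excess : ∀ {n} → ℕ → Point n → ℕ
excess {n} m x = count (exceeds? m x) (triples m n)

module _ {n : ℕ} (h : Fin n → ℕ) {N N' : ℕ} {w w' : Fin n → ℕ} (w< : ∀ i → w i < suc N) (w'< : ∀ i → w' i < suc N') where

  -- Away from a tie the integer heights alone decide, whatever the scale; only at `H i j ≡ d` does
  -- the order of the weights count.
  perturbed-transfer : ∀ {i j d} → (+ h i ℤ.- + h j ≡ d → w i < w j → w' i < w' j) →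
                       GapLt (perturbed N h w) i j d → GapLt (perturbed N' h w') i j d
  perturbed-transfer {i} {j} {d} mono g with ℤ.<-cmp (+ h i ℤ.- + h j) d
  ... | tri< l _ _ = perturbed-< N' h w'< l
  ... | tri> _ _ l = ⊥-elim (lt-irrefl g (inj₁ (perturbed-< N h w<
        (subst (ℤ._< ℤ.- d) (neg-minus (+ h i) (+ h j)) (ℤ.neg-mono-< l)))))
  ... | tri≈ _ e _ with ℕ.<-cmp (w i) (w j)
  ...   | tri< l _ _ = perturbed-tie< N' h w'< e (mono e l)
  ...   | tri≈ _ l _ = ⊥-elim (lt⇒¬eq g (perturbed-tie≡ N h w< e l))
  ...   | tri> _ _ l = ⊥-elim (lt-irrefl g (inj₁ (perturbed-tie< N h w<
          (trans (sym (neg-minus (+ h i) (+ h j))) (cong ℤ.-_ e)) l)))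

perturbed-sameFace : ∀ {m n} (A : Arr m n) (S : PathSystem m n) {N N' w w'} (w< : ∀ i → w i < suc N) (w'< : ∀ i → w' i < suc N') →
  (∀ {i j} → InA A i j (heightGap S i j) → w i < w j → w' i < w' j) →
  (∀ {i j} → InA A i j (heightGap S i j) → w i ≡ w j → w' i ≡ w' j) →
  SameFace A (perturbed N (height S) w) (perturbed N' (height S) w')
perturbed-sameFace A S {N} {N'} {w} {w'} w< w'< mono mono≡ =
  (λ a → perturbed-transfer (height S) w< w'< λ e → mono (subst (InA A _ _) (sym e) a)) ,
  (λ {i} {j} a → perturbed-transfer (height S) w'< w< λ e → reflect (subst (InA A i j) (sym e) a))
  where
  reflect : ∀ {i j} → InA A i j (heightGap S i j) → w' i < w' j → w i < w j
  reflect {i} {j} a l with ℕ.<-cmp (w i) (w j)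
  ... | tri< k _ _ = k
  ... | tri≈ _ k _ = ⊥-elim (ℕ.<-irrefl (mono≡ a k) l)
  ... | tri> _ _ k = ⊥-elim (ℕ.<-asym l (mono (subst (InA A j i) (neg-minus (+ height S i) (+ height S j)) (inA-swap A a)) k))

-- If no hyperplane of A crosses the cadet edge between k₀ and its child h₀, the part of the
-- block of h₀ below this edge can be moved down, just past k₀, without leaving the face.
module Descent {m n : ℕ} (A : Arr m n) (S : PathSystem m n) {μ : Subset n} (M : Marking S μ)
    {h₀ k₀ : Fin n} {t₀ : ℕ} (cad : Cadet S h₀ t₀ k₀)
    (¬exempt : ¬ (t₀ ≡ 0 × h₀ Fin.< k₀ × h₀ ∉ μ)) (¬crossing : ¬ Crossing S M A h₀ k₀) where
  open PathSystem S
  open Blocks S M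

  private
    w : Fin n → ℕ
    w = rank

    w-below : ∀ {i} → h₀ ↓ i → w i ≡ w h₀
    w-below p = rank-~ (inj₂ p)

    ¬h₀↓k₀ : ¬ (h₀ ↓ k₀)
    ¬h₀↓k₀ p = child-not-above {S = S} (proj₁ cad) (↓-prefix p)

    wk₀≤wh₀ : w k₀ ≤ w h₀
    wk₀≤wh₀ with h₀ Subset.∈? μ
    ... | yes h₀∈ = ℕ.≤-reflexive (rank-~ (inj₁ (down stay h₀∈ (proj₁ cad))))
    ... | no h₀∉ = ℕ.<⇒≤ (rank-mono {k₀} {h₀} (subst (λ t → prefLex (path (top k₀)) (path t)) (sym (top-fix h₀∉))
      (prefix⇒pl (prefix-trans (↓-prefix (top-↓ k₀)) (child-prefix {S = S} (proj₁ cad)))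
        λ e → child-not-above {S = S} (proj₁ cad) (subst (λ p → IsPrefix p (path k₀)) e (↓-prefix (top-↓ k₀))))))

    -- No foreign block is ranked between those of `k₀` and `h₀`: its top would come
    -- lexicographically after `k₀` and before `h₀`, hence lie below a child of `k₀` to the right of
    -- the cadet.
    adjacent : ∀ {v} → ¬ (h₀ ↓ v) → w k₀ ≤ w v → w v ≤ w h₀ → v ↓ k₀
    adjacent {v} ¬h₀↓v k≤v v≤h with ℕ.m≤n⇒m<n∨m≡n k≤v | ℕ.m≤n⇒m<n∨m≡n v≤h
    ... | inj₂ e | _ with rank≡⇒~ {k₀} {v} e
    ...   | inj₂ p = p
    ...   | inj₁ p with ↓-front p
    ...     | inj₁ refl = stay
    ...     | inj₂ (c , s , c∈ , ch , q) with cadet-unique {S = S} (proj₁ (marked-cadet c∈ ch)) cad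
    ...       | refl = ⊥-elim (¬h₀↓v q)
    adjacent {v} ¬h₀↓v k≤v v≤h | inj₁ _ | inj₂ e with rank≡⇒~ {v} {h₀} e
    ... | inj₂ p = ⊥-elim (¬h₀↓v p)
    ... | inj₁ stay = ⊥-elim (¬h₀↓v stay)
    ... | inj₁ (down q h₀∈ c) with child-unique S c (proj₁ cad)
    ...   | _ , refl = q
    adjacent {v} ¬h₀↓v k≤v v≤h | inj₁ k<v | inj₁ v<h with h₀ Subset.∈? μ
    ... | yes h₀∈ = ⊥-elim (ℕ.<-irrefl (rank-~ (inj₁ (down stay h₀∈ (proj₁ cad)))) (ℕ.<-trans k<v v<h))
    ... | no h₀∉ with pl-extendˡ (path k₀) (path (top v)) t₀
                        (↓-right (top-↓ k₀) (top-unmarked v) (rank-reflects {k₀} {v} k<v))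
    ...   | inj₁ h<v = ⊥-elim (pl-asym (path k₀ ++ [ t₀ ]) (path (top v)) h<v below-h₀)
      where
      below-h₀ : prefLex (path (top v)) (path k₀ ++ [ t₀ ])
      below-h₀ = subst (prefLex (path (top v))) (trans (cong path (top-fix h₀∉)) (proj₁ cad)) (rank-reflects {v} {h₀} v<h)
    ...   | inj₂ (a , u , e) = ⊥-elim (impossible (pl-++⁻ (path k₀) (subst₂ prefLex e
              (trans (cong path (top-fix h₀∉)) (proj₁ cad)) (rank-reflects {v} {h₀} v<h))))
      where
      impossible : ¬ prefLex (a ∷ u) [ t₀ ]
      impossible (inj₁ t₀<a) with prefix-closed {path k₀ ++ [ a ]} (top v) (u , trans (List.++-assoc (path k₀) [ a ] u) (sym e))
      ... | l , ch = proj₂ cad a l t₀<a ch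
      impossible (inj₂ (_ , b)) = nil u b
        where
        nil : ∀ u → ¬ prefLex u []
        nil [] ()
        nil (_ ∷ _) ()

    -- Odd values keep the old order and leave an even slot under every rank. The slot `2 * w k₀` is
    -- just below the block of `k₀` and above all blocks of smaller rank.
    lower : ∀ i → Dec (h₀ ↓ i) → ℕ
    lower i (yes _) = 2 * w k₀
    lower i (no _)  = suc (2 * w i)

    w' : Fin n → ℕ
    w' i = lower i (h₀ ↓? i)

    w'< : ∀ i → w' i < suc (suc (2 * n))
    w'< i with h₀ ↓? i
    ... | yes _ = s≤s (ℕ.m≤n⇒m≤1+n (ℕ.*-monoʳ-≤ 2 (ℕ.s≤s⁻¹ (rank<n S M k₀))))
    ... | no _ = s≤s (s≤s (ℕ.*-monoʳ-≤ 2 (ℕ.s≤s⁻¹ (rank<n S M i))))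

    odd<even : ∀ {a b} → a < b → suc (2 * a) < 2 * b
    odd<even {a} {b} h = subst (_≤ 2 * b) (ℕ.*-suc 2 a) (ℕ.*-monoʳ-≤ 2 h)

    even<odd : ∀ {a b} → a ≤ b → 2 * a < suc (2 * b)
    even<odd h = s≤s (ℕ.*-monoʳ-≤ 2 h)

    -- An order can be lost only if `j` is moved down past an unmoved `i`; by `adjacent` such an `i`
    -- belongs to the block of `k₀`, above the edge. The hypothesis excludes this case.
    w'-mono : ∀ {i j} → (¬ (h₀ ↓ i) → i ↓ k₀ → h₀ ↓ j → w i < w j → ⊥) → w i < w j → w' i < w' j
    w'-mono {i} {j} safe l with h₀ ↓? i | h₀ ↓? j
    ... | yes p | yes q = ⊥-elim (ℕ.<-irrefl (trans (w-below p) (sym (w-below q))) l)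
    ... | no _ | no _ = s≤s (ℕ.*-monoʳ-< 2 l)
    ... | yes p | no _ = even<odd (ℕ.≤-trans wk₀≤wh₀ (ℕ.<⇒≤ (subst (_< w j) (w-below p) l)))
    ... | no ¬p | yes q with w i ℕ.<? w k₀
    ...   | yes r = odd<even r
    ...   | no ¬r = ⊥-elim (safe ¬p (adjacent ¬p (ℕ.≮⇒≥ ¬r) (ℕ.<⇒≤ (subst (w i <_) (w-below q) l))) q l)

    crossed : ∀ {s u} → h₀ ↓ s → u ↓ k₀ → ¬ InA A s u (heightGap S s u)
    crossed p q a = ¬crossing (_ , _ , p , q , a)

    w'-eq : ∀ {i j} → InA A i j (heightGap S i j) → w i ≡ w j → w' i ≡ w' j
    w'-eq {i} {j} a e with h₀ ↓? i | h₀ ↓? j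
    ... | yes p | yes q = refl
    ... | no _ | no _ = cong (λ z → suc (2 * z)) e
    ... | yes p | no ¬q = ⊥-elim (crossed p (adjacent ¬q (subst (w k₀ ≤_) e' wk₀≤wh₀) (ℕ.≤-reflexive (sym e'))) a)
      where
      e' : w h₀ ≡ w j
      e' = trans (sym (w-below p)) e
    ... | no ¬p | yes q = ⊥-elim (crossed q (adjacent ¬p (subst (w k₀ ≤_) (sym e') wk₀≤wh₀) (ℕ.≤-reflexive e'))
          (subst (InA A j i) (neg-minus (+ height S i) (+ height S j)) (inA-swap A a)))
      where
      e' : w i ≡ w h₀
      e' = trans e (w-below q)

    hk₀ : height S h₀ ≡ height S k₀ + t₀
    hk₀ = child-height S (proj₁ cad)

    k₀≤h₀ : height S k₀ ≤ height S h₀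
    k₀≤h₀ = subst (height S k₀ ≤_) (sym hk₀) (ℕ.m≤m+n _ t₀)

    edge-label : t₀ ≡ 0 → k₀ Fin.< h₀
    edge-label t₀≡0 with h₀ Subset.∈? μ
    ... | yes h₀∈ = proj₂ (marked-cadet h₀∈ (proj₁ cad)) t₀≡0
    ... | no h₀∉ = ℕ.≤∧≢⇒< (ℕ.≮⇒≥ λ l → ¬exempt (t₀≡0 , l , h₀∉)) λ e →
      ¬h₀↓k₀ (subst (h₀ ↓_) (Fin.toℕ-injective (sym e)) stay)

  lowered : Point n
  lowered = perturbed (suc (2 * n)) (height S) w'

  lowered-sameFace : SameFace A (treePoint S M) lowered
  lowered-sameFace = perturbed-sameFace A S (rank<n S M) w'<
    (λ {i} {j} a → w'-mono {i} {j} λ ¬p p q l → crossed q p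
      (subst (InA A j i) (neg-minus (+ height S i) (+ height S j)) (inA-swap A a))) w'-eq

  lowered-excess : excess m lowered < excess m (treePoint S M)
  lowered-excess = count-mono-< (exceeds? m lowered) (exceeds? m (treePoint S M)) shrink
    (∈-triples h₀ k₀ t₀≤m) (t₀≤m , tr , not-below) λ { (_ , _ , ¬g) → ¬g (perturbed-tie< (suc (2 * n)) (height S) w'< (m+s-m (height S k₀) t₀ hk₀) w'h₀<w'k₀) }
    where
    t₀≤m : t₀ ≤ m
    t₀≤m = path-bound (proj₁ cad)
    tr : 0 < t₀ ⊎ k₀ Fin.< h₀
    tr with t₀ ℕ.≟ 0
    ... | yes e = inj₂ (edge-label e)
    ... | no ne = inj₁ (ℕ.n≢0⇒n>0 ne)
    not-below : ¬ GapLt (treePoint S M) h₀ k₀ (+ t₀)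
    not-below g with ℕ.m≤n⇒m<n∨m≡n wk₀≤wh₀
    ... | inj₂ e = lt⇒¬eq g (perturbed-tie≡ n (height S) (rank<n S M) (m+s-m (height S k₀) t₀ hk₀) (sym e))
    ... | inj₁ l = lt-irrefl g (inj₁ (perturbed-tie< n (height S) (rank<n S M)
          (trans (sym (neg-minus (+ height S h₀) (+ height S k₀))) (cong ℤ.-_ (m+s-m (height S k₀) t₀ hk₀))) l))
    w'h₀<w'k₀ : w' h₀ < w' k₀
    w'h₀<w'k₀ with h₀ ↓? h₀ | h₀ ↓? k₀
    ... | no ¬p | _ = ⊥-elim (¬p stay)
    ... | yes _ | yes p = ⊥-elim (¬h₀↓k₀ p)
    ... | yes _ | no _ = ℕ.≤-refl
    shrink : ∀ v → Exceeds m lowered v → Exceeds m (treePoint S M) v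
    shrink (i , k , t) (t≤m , tr' , ¬g) = t≤m , tr' , λ g → ¬g (perturbed-transfer (height S) (rank<n S M) w'<
      (λ e → w'-mono {i} {k} (safe e)) g)
      where
      -- No new inequality `x_i - x_k ≥ t` can arise: the heights satisfy `k₀ ≤ h₀ ≤ k ≤ i ≤ k₀`, so
      -- all agree and `t = t₀ = 0`; the labels then satisfy `k < i ≤ k₀ < h₀ ≤ k`.
      safe : heightGap S i k ≡ + t → ¬ (h₀ ↓ i) → i ↓ k₀ → h₀ ↓ k → w i < w k → ⊥
      safe e _ p q l = ℕ.<-irrefl refl (ℕ.<-≤-trans (ℕ.<-≤-trans k<i (↓-label p (ℕ.≤-antisym (↓-height p) k₀≤i)))
        (ℕ.≤-trans (ℕ.<⇒≤ (edge-label t₀≡0)) (↓-label q (ℕ.≤-antisym (↓-height q) k≤h₀))))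
        where
        i≡k+t : height S i ≡ height S k + t
        i≡k+t = ℤ.+-injective (trans (lem (+ height S i) (+ height S k)) (cong (λ z → + height S k ℤ.+ z) e))
          where
          lem : ∀ a b → a ≡ b ℤ.+ (a ℤ.- b)
          lem = ℤSolver.solve-∀
        k≤i : height S k ≤ height S i
        k≤i = subst (height S k ≤_) (sym i≡k+t) (ℕ.m≤m+n _ t)
        k₀≤i : height S k₀ ≤ height S i
        k₀≤i = ℕ.≤-trans k₀≤h₀ (ℕ.≤-trans (↓-height q) k≤i)
        k≤h₀ : height S k ≤ height S h₀
        k≤h₀ = ℕ.≤-trans k≤i (ℕ.≤-trans (↓-height p) k₀≤h₀)
        zero-sum : ∀ {a b c} → a ≡ b + c → a ≤ b → c ≡ 0
        zero-sum {a} {b} {c} e l = ℕ.n≤0⇒n≡0 (ℕ.+-cancelˡ-≤ b _ _ (subst₂ _≤_ e (sym (ℕ.+-identityʳ b)) l))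
        t₀≡0 : t₀ ≡ 0
        t₀≡0 = zero-sum hk₀ (ℕ.≤-trans (↓-height q) (ℕ.≤-trans k≤i (↓-height p)))
        k<i : k Fin.< i
        k<i = [ (λ 0<t → ⊥-elim (ℕ.<-irrefl (sym t≡0) 0<t)) , id ]′ tr'
          where
          t≡0 : t ≡ 0
          t≡0 = zero-sum i≡k+t (ℕ.≤-trans (↓-height p) (ℕ.≤-trans k₀≤h₀ (↓-height q)))

module _ {m n : ℕ} (A : Arr m n) (S : PathSystem m n) {μ : Subset n} (M : Marking S μ) where
  open PathSystem S
  open Blocks S M

  Violation : Set
  Violation = Σ (Fin n) λ h → Σ (Fin n) λ k → Σ (Fin (suc m)) λ t →
    Cadet S h (toℕ t) k × ¬ (toℕ t ≡ 0 × h Fin.< k × h ∉ μ) × ¬ Crossing S M A h k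

  private
    cadet? : ∀ h t k → Dec (Cadet S h t k)
    cadet? h t k = map′
      (λ { (c , none) → c , λ t' l t<t' c' → none (Fin.fromℕ< (s≤s (path-bound c')) , l ,
           subst (λ z → t < z × Child S l z k) (sym (Fin.toℕ-fromℕ< (s≤s (path-bound c')))) (t<t' , c')) })
      (λ { (c , last) → c , λ { (f , l , t<f , c') → last (toℕ f) l t<f c' } })
      (child? t h ×-dec ¬? (Fin.any? {n = suc m} λ f → Fin.any? λ l → (t ℕ.<? toℕ f) ×-dec child? (toℕ f) l))
      where
      child? : ∀ t l → Dec (Child S l t k)
      child? t l = path l ≟ᵖ (path k ++ [ t ])

    exempt? : ∀ h t (k : Fin n) → Dec (t ≡ 0 × h Fin.< k × h ∉ μ)
    exempt? h t k = (t ℕ.≟ 0) ×-dec ((h Fin.<? k) ×-dec ¬? (h Subset.∈? μ))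

    crossing? : ∀ h k → Dec (Crossing S M A h k)
    crossing? h k = Fin.any? λ s → Fin.any? λ u → (h ↓? s) ×-dec ((u ↓? k) ×-dec inA? A s u (heightGap S s u))

  crossed-or-violation : Crossed S M A ⊎ Violation
  crossed-or-violation with Fin.any? (λ h → Fin.any? λ k → Fin.any? {n = suc m} λ t →
    cadet? h (toℕ t) k ×-dec (¬? (exempt? h (toℕ t) k) ×-dec ¬? (crossing? h k)))
  ... | yes v = inj₂ v
  ... | no none = inj₁ go
    where
    go : Crossed S M A
    go {h} {t} {k} cad = decide (exempt? h t k) (crossing? h k)
      where
      t< : t < suc m
      t< = s≤s (path-bound (proj₁ cad))
      decide : Dec (t ≡ 0 × h Fin.< k × h ∉ μ) → Dec (Crossing S M A h k) →
               (t ≡ 0 × h Fin.< k × h ∉ μ) ⊎ Crossing S M A h k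
      decide (yes e) _ = inj₁ e
      decide (no _) (yes c) = inj₂ c
      decide (no ¬e) (no ¬c) = ⊥-elim (none (h , k , Fin.fromℕ< t< ,
          subst (λ z → Cadet S h z k × ¬ (z ≡ 0 × h Fin.< k × h ∉ μ) × ¬ Crossing S M A h k)
                (sym (Fin.toℕ-fromℕ< t<)) (cad , ¬e , ¬c)))

module _ {m n : ℕ} (A : Arr m n) where

  Canonical : Point n → Set
  Canonical x = Σ (Point n) λ y → SameFace A x y × Crossed (PointTree.system m y) (PointTree.marking m y) A

  -- Lowering is defined on the point of a tree, so `x` is first exchanged for the point of its own
  -- tree. Both lie in one Catalan face, so the excess does not grow.
  descent : ∀ {x} {S : PathSystem m n} {μ} {M : Marking S μ} → Compatible S M x → Violation A S M →
            Σ (Point n) λ z → SameFace A x z × excess m z < excess m x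
  descent {x} {S} {μ} {M} C (h , k , t , cad , ¬e , ¬c) = D.lowered ,
    sameFace-trans A {x} {y} {D.lowered} (inΦ⇒sameFace {M = M} {A} {x} {y}
      (compatible⇒inΦ {M = M} {A} C) (compatible⇒inΦ {M = M} {A} (treePoint-compatible S M))) D.lowered-sameFace ,
    ℕ.<-≤-trans D.lowered-excess (count-mono (exceeds? m y) (exceeds? m x)
      (λ { (i , j , s) (s≤m , tr , ¬g) → s≤m , tr ,
        λ g → ¬g (compatible⇒gapLt {M = M} C (treePoint-compatible S M) s≤m g) }) (triples m n))
    where
    module D = Descent A S M cad ¬e ¬c
    y : Point n
    y = treePoint S M

  -- The lowered point breaks the condition of the old tree at the cadet edge, so each round
  -- continues with the tree of the new point.
  canonical-point : ∀ x → Canonical x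
  canonical-point x = go x (<-wellFounded (excess m x))
    where
    go : ∀ x → Acc _<_ (excess m x) → Canonical x
    continue : ∀ x → Acc _<_ (excess m x) → Crossed (PointTree.system m x) (PointTree.marking m x) A ⊎
               Violation A (PointTree.system m x) (PointTree.marking m x) → Canonical x
    go x ac = continue x ac (crossed-or-violation A (PointTree.system m x) (PointTree.marking m x))
    continue x _ (inj₁ cr) = x , ((λ _ h → h) , (λ _ h → h)) , cr
    continue x (acc rec) (inj₂ v) =
      let (z , sf , l) = descent {x} (PointTree.compatible m x) v
          (z' , sf' , cr) = go z (rec l)
      in z' , sameFace-trans A {x} {z} {z'} sf sf' , cr

-- The bijection

module _ {m n : ℕ} (A : Arr m n) (st : StronglyTransitive A) where

  record Analysis (T : Tree m n) (μ : Subset n) : Set where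
    field
      system     : PathSystem m n
      represents : Represents T system
      marking    : Marking system μ
      connected  : Connected system marking A
      crossed    : Crossed system marking A

    point : Point n
    point = treePoint system marking

    point-compatible : Compatible system marking point
    point-compatible = treePoint-compatible system marking

    point-inΦ : InΦ system marking A point
    point-inΦ = compatible⇒inΦ {M = marking} {A} point-compatible

    Φ⇒sameFace : ∀ {x} → Φ A T μ x → SameFace A x point
    Φ⇒sameFace {x} h = inΦ⇒sameFace {M = marking} {A} {x} {point} (Φ⇒inΦ {M = marking} represents h) point-inΦ

    sameFace⇒Φ : ∀ {x} → SameFace A x point → Φ A T μ x
    sameFace⇒Φ {x} sf = inΦ⇒Φ represents (sameFace⇒inΦ {M = marking} {A} {x} {point} connected sf point-inΦ)

    point-Φ : Φ A T μ point
    point-Φ = inΦ⇒Φ represents point-inΦ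

  analyse : ∀ {T μ} → MTree A T μ → Analysis T μ
  analyse {T} {μ} (valid , mok , ac , cc) = record
    { system = proj₁ S ; represents = R ; marking = M
    ; connected = aConnected⇒connected A R M ac
    ; crossed = mtree⇒crossed {A = A} R M ac cc }
    where
    S : Σ (PathSystem m n) (Represents T)
    S = tree⇒pathSystem T valid
    R : Represents T (proj₁ S)
    R = proj₂ S
    M : Marking (proj₁ S) μ
    M = markedOK⇒marking R mok

  -- An edge marked in only one of the two trees would be an equality at `y` by the first marking
  -- and a strict inequality by the second.
  marks-transfer : ∀ {S S' : PathSystem m n} {μ μ'} {M : Marking S μ} {M' : Marking S' μ'} →
    (∀ i → PathSystem.path S i ≡ PathSystem.path S' i) → ∀ {x y} → Connected S M A → InΦ S M A x →
    Compatible S' M' y → SameFace A x y → ∀ {i} → i ∈ μ → i ∈ μ'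
  marks-transfer {S} {S'} {μ} {μ'} {M} {M'} paths {x} {y} conn Fx C sf {i} i∈ with i Subset.∈? μ'
  ... | yes i∈' = i∈'
  ... | no i∉' with M i i∈
  ...   | s , k , (c , _) , _ = ⊥-elim (lt-irrefl
          (Compatible.after C (PathSystem.path-bound S' c') (unmarked-child M' i∉' c') (inj₂ c'))
          (inj₂ (eq-swap (eq-swap (InΦ.edge-gap y-inΦ i∈ c)))))
    where
    y-inΦ : InΦ S M A y
    y-inΦ = sameFace⇒inΦ {M = M} {A} {y} {x} conn (sameFace-sym A {x} {y} sf) Fx
    c' : Child S' i s k
    c' = trans (sym (paths i)) (trans c (cong (_++ [ s ]) (paths k)))

  Φ-isFace : ∀ {T μ} → MTree A T μ → IsFace A (Φ A T μ) × Codim (Φ A T μ) ∣ μ ∣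
  Φ-isFace {T} {μ} h = (signs A point , same , point , point-Φ) , Φ-codim A represents marking
    where
    open Analysis (analyse h)
    same : Φ A T μ ≐ FaceSet A (signs A point)
    same x = (λ φ → sameFace⇒faceSet A {signs A point} {x} {point} (Φ⇒sameFace φ) (signs-self A point)) ,
             (λ f → sameFace⇒Φ (faceSet⇒refines A {signs A point} {x} {point} f (signs-self A point) ,
                                faceSet⇒refines A {signs A point} {point} {x} (signs-self A point) f))

  Φ-injective : ∀ {T T' μ μ'} → MTree A T μ → MTree A T' μ' → Φ A T μ ≐ Φ A T' μ' → (T ≡ T') × (μ ≡ μ')
  Φ-injective {T} {T'} {μ} {μ'} h h' e =
      represents-injective X.represents Y.represents paths ,
      Subset.⊆-antisym
        (marks-transfer {M = X.marking} {Y.marking} paths X.connected X.point-inΦ Y.point-compatible sf)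
        (marks-transfer {M = Y.marking} {X.marking} (sym ∘ paths) Y.connected Y.point-inΦ X.point-compatible
          (sameFace-sym A {X.point} {Y.point} sf))
    where
    module X = Analysis (analyse h)
    module Y = Analysis (analyse h')
    sf : SameFace A X.point Y.point
    sf = Y.Φ⇒sameFace (proj₁ (e X.point) X.point-Φ)
    paths : ∀ i → PathSystem.path X.system i ≡ PathSystem.path Y.system i
    paths = same-paths {A = A} st {M = X.marking} {M' = Y.marking} sf X.point-compatible Y.point-compatible
      X.connected X.crossed Y.connected Y.crossed
  crossed⇒face : ∀ {S : PathSystem m n} {μ} {M : Marking S μ} {y} → Compatible S M y → Crossed S M A →
    Σ (Tree m n) λ T → MTree A T μ × (∀ x → (SameFace A x y → Φ A T μ x) × (Φ A T μ x → SameFace A x y))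
  crossed⇒face {S} {μ} {M} {y} C crossed with pathSystem⇒tree S
  ... | T , valid , R = T ,
      (valid , marking⇒markedOK R M , connected⇒aConnected A R M conn , crossed⇒cadetCond {A = A} R M crossed) ,
      λ x → (λ sf → inΦ⇒Φ R (sameFace⇒inΦ {M = M} {A} {x} {y} conn sf y-inΦ)) ,
            (λ φ → inΦ⇒sameFace {M = M} {A} {x} {y} (Φ⇒inΦ {M = M} R φ) y-inΦ)
    where
    conn : Connected S M A
    conn = crossed⇒connected {A = A} R M st crossed
    y-inΦ : InΦ S M A y
    y-inΦ = compatible⇒inΦ {M = M} {A} C

  Φ-surjective : ∀ {F} → IsFace A F → Σ (Tree m n) λ T → Σ (Subset n) λ μ → MTree A T μ × (F ≐ Φ A T μ)
  Φ-surjective {F} (σ , F≐σ , x , Fx) = finish (canonical-point A x)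
    where
    σx : FaceSet A σ x
    σx = proj₁ (F≐σ x) Fx
    from-tree : ∀ {μ} y → SameFace A x y →
      (Σ (Tree m n) λ T → MTree A T μ × (∀ z → (SameFace A z y → Φ A T μ z) × (Φ A T μ z → SameFace A z y))) →
      Σ (Tree m n) λ T → Σ (Subset n) λ μ → MTree A T μ × (F ≐ Φ A T μ)
    from-tree {μ} y sf (T , tree , face) = T , μ , tree , λ z →
      (λ f → proj₁ (face z) (sameFace-trans A {z} {x} {y} (faceSet⇒refines A {σ} {z} {x} (proj₁ (F≐σ z) f) σx ,
               faceSet⇒refines A {σ} {x} {z} σx (proj₁ (F≐σ z) f)) sf)) ,
      (λ φ → proj₂ (F≐σ z) (sameFace⇒faceSet A {σ} {z} {x}
               (sameFace-trans A {z} {y} {x} (proj₂ (face z) φ) (sameFace-sym A {x} {y} sf)) σx))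
    finish : Canonical A x → Σ (Tree m n) λ T → Σ (Subset n) λ μ → MTree A T μ × (F ≐ Φ A T μ)
    finish (y , sf , crossed) = from-tree {PointTree.marks m y} y sf
      (crossed⇒face {PointTree.system m y} {PointTree.marks m y} {PointTree.marking m y} (PointTree.compatible m y) crossed)

theorem3p8 : (m n : ℕ) → 1 ≤ m → 1 ≤ n → (A : Arr m n) → StronglyTransitive A →
    ((T : Tree m n) (μ : Subset n) → MTree A T μ →
    IsFace A (Φ A T μ) × Codim (Φ A T μ) ∣ μ ∣)
    × ((T T' : Tree m n) (μ μ' : Subset n) → MTree A T μ → MTree A T' μ' →
    Φ A T μ ≐ Φ A T' μ' → (T ≡ T') × (μ ≡ μ'))
    × ((F : Point n → Set) → IsFace A F →
    Σ (Tree m n) λ T → Σ (Subset n) λ μ → MTree A T μ × (F ≐ Φ A T μ))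
theorem3p8 m n _ _ A st =
  (λ T μ → Φ-isFace A st) , (λ T T' μ μ' → Φ-injective A st) , (λ F → Φ-surjective A st)
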